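{- Let $p=p(n)\in(0,1)$ with $\limsup_{n\to\infty}p<1$, and let $K_{n,p}$ denote the number of edges of a unimodular triangulation of the random symmetric edge polytope $P_{n,p}$. Then $$\mathbb{V}(K_{n,p})\gtrsim\begin{cases} n^6p^3, & \text{if } p\gg n^{ -2},\\ n^2p, & \text{if } p\lesssim n^{ -2}.\end{cases}$$
   Context: For a finite simple graph $G=(V,E)$ (elements of $V$ are nodes, elements of $E\subseteq\binom V2$ are arcs), with $(\mathbf{e}_i)_{i\in V}$ the standard basis of $\mathbb{R}^V$, the symmetric edge polytope is $P_G:=\operatorname{conv}\{\pm(\mathbf{e}_i-\mathbf{e}_j):\{i,j\}\in E\}\subset\mathbb{R}^V$ (empty if $E=\emptyset$, in which case the number of edges of a triangulation is $0$). A (lattice) triangulation of a $d$-dimensional lattice polytope $P$ is a subdivision of $P$ into $d$-dimensional lattice simplices with union $P$, any two of which meet in a (possibly empty) common face. It is unimodular if every $d$-simplex in it is lattice equivalent (with respect to the lattice $\mathbb{Z}^V\cap\operatorname{aff}(P)$) to the standard simplex spanned by the origin and the standard unit vectors, i.e. has normalized minimal volume. The edges of a triangulation are the $1$-dimensional elements of the simplicial complex consisting of its simplices and all their faces. It is known that every $P_G$ has a unimodular triangulation, and that all unimodular triangulations of a given lattice polytope have the same number of edges, so $K_{n,p}$ is well defined. It is also known that for any total order $\prec$ on the arcs of $G$ there is a unimodular triangulation of $P_G$, with vertices the origin and the vertices of $P_G$, in which two vertices $\mathbf{x},\mathbf{y}$ form an edge if and only if: one of them is the origin; or (identifying $\mathbf{e}_i-\mathbf{e}_j$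 with the directed arc $i\to j$) they are not antipodal, no directed $3$-cycle in $G$ contains both corresponding directed arcs, and for every directed $4$-cycle of $G$ containing both, the $\prec$-minimal arc of that cycle is one of the arcs corresponding to $\mathbf{x}$ or $\mathbf{y}$. $G_{n,p}$ is the Erdős–Rényi random graph on node set $[n]$, each arc of the complete graph being retained independently with probability $p=p(n)\in(0,1)$; $P_{n,p}:=P_{G_{n,p}}$. $\mathbb{V}$ denotes variance. Asymptotic notation for sequences (as $n\to\infty$): $a_n\gg b_n$ means $\liminf|a_n/b_n|=\infty$; $a_n\lesssim b_n$ means $\limsup|a_n/b_n|<\infty$; $a_n\gtrsim b_n$ means $\liminf|a_n/b_n|>0$. A case distinction means: if the sequence $p=p(n)$ satisfies the asymptotic condition, then the corresponding relation holds. -}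

module Defs where

open import Level using (0ℓ)
open import Data.Nat as ℕ using (ℕ; zero; suc)
import Data.Nat.Properties as ℕ
open import Data.Integer as ℤ using (ℤ; +_)
open import Data.Rational as ℚ using (ℚ; 0ℚ; 1ℚ; ½)
import Data.Rational.Properties as ℚ
open import Data.Rational.Solver using (module +-*-Solver)
open import Data.Fin as Fin using (Fin)
open import Data.Fin.Subset using (Subset; inside; outside)
  renaming (_∈_ to _∈ˢ_)
open import Data.Vec as Vec using (Vec; []; _∷_)
open import Data.Vec.Properties using (≡-dec)
open import Data.Vec.Functional using (Vector; foldr)
open import Data.List as List using (List; []; _∷_; _++_)
open import Data.List.Membership.Propositional using (_∈_)
open import Data.List.Relation.Binary.Subset.Propositional using (_⊆_)
open import Data.List.Relation.Binary.Permutation.Propositional using (_↭_)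
open import Data.Product using (Σ; ∃; _×_; _,_; proj₁; proj₂)
open import Data.Sum using (_⊎_; [_,_]′)
open import Data.Unit using (⊤)
open import Function.Bundles using (_⇔_)
open import Relation.Nullary using (¬_; Dec)
open import Relation.Nullary.Decidable using (_×-dec_; _⊎-dec_)
open import Relation.Unary using (Pred) renaming (_⊆_ to _⊆ᵖ_)
open import Relation.Binary.PropositionalEquality
  using (_≡_; refl; sym; cong; cong₂; subst; module ≡-Reasoning)

Eventually : Pred ℕ 0ℓ → Set
Eventually Q = ∃ λ N → ∀ n → N ℕ.≤ n → Q n

------------------------------------------------------------------------
-- The real numbers, as Cauchy sequences of rationals.  Equality is the
-- relation _≈_, and all operations act termwise.

record ℝ : Set where
  constructor mkℝ
  field
    seq    : ℕ → ℚ
    cauchy : ∀ ε → 0ℚ ℚ.< ε → ∃ λ N → ∀ m n → N ℕ.≤ m → N ℕ.≤ n →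
             ℚ.∣ seq m ℚ.- seq n ∣ ℚ.≤ ε

open ℝ public

infix 4 _≈_ _≤_ _<_

_≈_ _≤_ _<_ : ℝ → ℝ → Set
x ≈ y = ∀ ε → 0ℚ ℚ.< ε → Eventually λ n → ℚ.∣ seq x n ℚ.- seq y n ∣ ℚ.≤ ε
x ≤ y = ∀ ε → 0ℚ ℚ.< ε → Eventually λ n → seq x n ℚ.≤ seq y n ℚ.+ ε
x < y = ∃ λ ε → 0ℚ ℚ.< ε × Eventually λ n → seq x n ℚ.+ ε ℚ.≤ seq y n

private abstract
  half-pos : ∀ {ε} → 0ℚ ℚ.< ε → 0ℚ ℚ.< ½ ℚ.* ε
  half-pos {ε} 0<ε = subst (ℚ._< ½ ℚ.* ε) (ℚ.*-zeroʳ ½) (ℚ.*-monoʳ-<-pos ½ 0<ε)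

  half+half : ∀ ε → ½ ℚ.* ε ℚ.+ ½ ℚ.* ε ≡ ε
  half+half = solve 1 (λ ε → con ½ :* ε :+ con ½ :* ε := ε) refl
    where open +-*-Solver

  +-cauchy : ∀ (x y : ℝ) ε → 0ℚ ℚ.< ε → ∃ λ N → ∀ m n → N ℕ.≤ m → N ℕ.≤ n →
    ℚ.∣ (seq x m ℚ.+ seq y m) ℚ.- (seq x n ℚ.+ seq y n) ∣ ℚ.≤ ε
  +-cauchy x y ε 0<ε =
    let N₁ , h₁ = cauchy x (½ ℚ.* ε) (half-pos 0<ε)
        N₂ , h₂ = cauchy y (½ ℚ.* ε) (half-pos 0<ε)
    in N₁ ℕ.⊔ N₂ , λ m n N≤m N≤n →
      let open ℚ.≤-Reasoning in begin
      ℚ.∣ (seq x m ℚ.+ seq y m) ℚ.- (seq x n ℚ.+ seq y n) ∣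
        ≡⟨ cong ℚ.∣_∣ (regroup (seq x m) (seq y m) (seq x n) (seq y n)) ⟩
      ℚ.∣ (seq x m ℚ.- seq x n) ℚ.+ (seq y m ℚ.- seq y n) ∣
        ≤⟨ ℚ.∣p+q∣≤∣p∣+∣q∣ (seq x m ℚ.- seq x n) (seq y m ℚ.- seq y n) ⟩
      ℚ.∣ seq x m ℚ.- seq x n ∣ ℚ.+ ℚ.∣ seq y m ℚ.- seq y n ∣
        ≤⟨ ℚ.+-mono-≤
             (h₁ m n (ℕ.m⊔n≤o⇒m≤o N₁ N₂ N≤m) (ℕ.m⊔n≤o⇒m≤o N₁ N₂ N≤n))
             (h₂ m n (ℕ.m⊔n≤o⇒n≤o N₁ N₂ N≤m) (ℕ.m⊔n≤o⇒n≤o N₁ N₂ N≤n)) ⟩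
      ½ ℚ.* ε ℚ.+ ½ ℚ.* ε
        ≡⟨ half+half ε ⟩
      ε ∎
    where
    open +-*-Solver
    regroup : ∀ a b c d → (a ℚ.+ b) ℚ.- (c ℚ.+ d) ≡ (a ℚ.- c) ℚ.+ (b ℚ.- d)
    regroup = solve 4 (λ a b c d → (a :+ b) :- (c :+ d) := (a :- c) :+ (b :- d)) refl

  neg-cauchy : ∀ (x : ℝ) ε → 0ℚ ℚ.< ε → ∃ λ N → ∀ m n → N ℕ.≤ m → N ℕ.≤ n →
    ℚ.∣ (ℚ.- seq x m) ℚ.- (ℚ.- seq x n) ∣ ℚ.≤ ε
  neg-cauchy x ε 0<ε =
    let N , h = cauchy x ε 0<ε in
    N , λ m n N≤m N≤n → subst (λ q → ℚ.∣ q ∣ ℚ.≤ ε) (swap (seq x m) (seq x n)) (h n m N≤n N≤m)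
    where
    open +-*-Solver
    swap : ∀ a b → b ℚ.- a ≡ (ℚ.- a) ℚ.- (ℚ.- b)
    swap = solve 2 (λ a b → b :- a := (:- a) :- (:- b)) refl

  bounded : ∀ (x : ℝ) → ∃ λ B → 0ℚ ℚ.< B × Eventually λ n → ℚ.∣ seq x n ∣ ℚ.≤ B
  bounded x with cauchy x 1ℚ (ℚ.positive⁻¹ 1ℚ)
  ... | N , h = 1ℚ ℚ.+ ℚ.∣ seq x N ∣
              , ℚ.+-mono-<-≤ (ℚ.positive⁻¹ 1ℚ) (ℚ.0≤∣p∣ (seq x N))
              , N , λ n N≤n → let open ℚ.≤-Reasoning in begin
    ℚ.∣ seq x n ∣
      ≡⟨ cong ℚ.∣_∣ (split (seq x n) (seq x N)) ⟩
    ℚ.∣ (seq x n ℚ.- seq x N) ℚ.+ seq x N ∣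
      ≤⟨ ℚ.∣p+q∣≤∣p∣+∣q∣ (seq x n ℚ.- seq x N) (seq x N) ⟩
    ℚ.∣ seq x n ℚ.- seq x N ∣ ℚ.+ ℚ.∣ seq x N ∣
      ≤⟨ ℚ.+-monoˡ-≤ ℚ.∣ seq x N ∣ (h n N N≤n ℕ.≤-refl) ⟩
    1ℚ ℚ.+ ℚ.∣ seq x N ∣ ∎
    where
    open +-*-Solver
    split : ∀ a b → a ≡ (a ℚ.- b) ℚ.+ b
    split = solve 2 (λ a b → a := (a :- b) :+ b) refl

  *-mono-≤-0 : ∀ {a b c d} → 0ℚ ℚ.≤ c → 0ℚ ℚ.≤ b → a ℚ.≤ b → c ℚ.≤ d → a ℚ.* c ℚ.≤ b ℚ.* d
  *-mono-≤-0 {a} {b} {c} {d} 0≤c 0≤b a≤b c≤d = ℚ.≤-trans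
    (ℚ.*-monoʳ-≤-nonNeg c {{ℚ.nonNegative 0≤c}} a≤b)
    (ℚ.*-monoˡ-≤-nonNeg b {{ℚ.nonNegative 0≤b}} c≤d)

  shrink : ∀ ε B → 0ℚ ℚ.< ε → 0ℚ ℚ.< B → ∃ λ δ → 0ℚ ℚ.< δ × B ℚ.* δ ≡ ε
  shrink ε B 0<ε 0<B = r ℚ.* ε , 0<rε , eq
    where
    instance
      B-pos : ℚ.Positive B
      B-pos = ℚ.positive 0<B
      B-nonZero : ℚ.NonZero B
      B-nonZero = ℚ.pos⇒nonZero B
    r : ℚ
    r = ℚ.1/ B
    instance
      r-pos : ℚ.Positive r
      r-pos = ℚ.1/pos⇒pos B
    0<rε : 0ℚ ℚ.< r ℚ.* ε
    0<rε = subst (ℚ._< r ℚ.* ε) (ℚ.*-zeroʳ r) (ℚ.*-monoʳ-<-pos r 0<ε)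
    eq : B ℚ.* (r ℚ.* ε) ≡ ε
    eq = let open ≡-Reasoning in begin
      B ℚ.* (r ℚ.* ε) ≡⟨ ℚ.*-assoc B r ε ⟨
      (B ℚ.* r) ℚ.* ε ≡⟨ cong (ℚ._* ε) (ℚ.*-inverseʳ B) ⟩
      1ℚ ℚ.* ε        ≡⟨ ℚ.*-identityˡ ε ⟩
      ε               ∎

  *-cauchy : ∀ (x y : ℝ) ε → 0ℚ ℚ.< ε → ∃ λ N → ∀ m n → N ℕ.≤ m → N ℕ.≤ n →
    ℚ.∣ (seq x m ℚ.* seq y m) ℚ.- (seq x n ℚ.* seq y n) ∣ ℚ.≤ ε
  *-cauchy x y ε 0<ε =
    let A , 0<A , M₁ , bx = bounded x
        B , 0<B , M₂ , by = bounded y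
        δ , 0<δ , ABδ≡ε   = shrink ε (A ℚ.+ B) 0<ε (ℚ.+-mono-< 0<A 0<B)
        N₁ , hx = cauchy x δ 0<δ
        N₂ , hy = cauchy y δ 0<δ
        M = M₁ ℕ.⊔ M₂
        N = N₁ ℕ.⊔ N₂
    in M ℕ.⊔ N , λ m n ≤m ≤n →
      let M≤m = ℕ.m⊔n≤o⇒m≤o M N ≤m
          N≤m = ℕ.m⊔n≤o⇒n≤o M N ≤m
          M≤n = ℕ.m⊔n≤o⇒m≤o M N ≤n
          N≤n = ℕ.m⊔n≤o⇒n≤o M N ≤n
          a = seq x m ; b = seq y m ; c = seq x n ; d = seq y n
          open ℚ.≤-Reasoning in begin
      ℚ.∣ (a ℚ.* b) ℚ.- (c ℚ.* d) ∣
        ≡⟨ cong ℚ.∣_∣ (regroup a b c d) ⟩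
      ℚ.∣ a ℚ.* (b ℚ.- d) ℚ.+ d ℚ.* (a ℚ.- c) ∣
        ≤⟨ ℚ.∣p+q∣≤∣p∣+∣q∣ (a ℚ.* (b ℚ.- d)) (d ℚ.* (a ℚ.- c)) ⟩
      ℚ.∣ a ℚ.* (b ℚ.- d) ∣ ℚ.+ ℚ.∣ d ℚ.* (a ℚ.- c) ∣
        ≡⟨ cong₂ ℚ._+_ (ℚ.∣p*q∣≡∣p∣*∣q∣ a (b ℚ.- d)) (ℚ.∣p*q∣≡∣p∣*∣q∣ d (a ℚ.- c)) ⟩
      ℚ.∣ a ∣ ℚ.* ℚ.∣ b ℚ.- d ∣ ℚ.+ ℚ.∣ d ∣ ℚ.* ℚ.∣ a ℚ.- c ∣
        ≤⟨ ℚ.+-mono-≤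
             (*-mono-≤-0 (ℚ.0≤∣p∣ (b ℚ.- d)) (ℚ.<⇒≤ 0<A)
               (bx m (ℕ.m⊔n≤o⇒m≤o M₁ M₂ M≤m))
               (hy m n (ℕ.m⊔n≤o⇒n≤o N₁ N₂ N≤m) (ℕ.m⊔n≤o⇒n≤o N₁ N₂ N≤n)))
             (*-mono-≤-0 (ℚ.0≤∣p∣ (a ℚ.- c)) (ℚ.<⇒≤ 0<B)
               (by n (ℕ.m⊔n≤o⇒n≤o M₁ M₂ M≤n))
               (hx m n (ℕ.m⊔n≤o⇒m≤o N₁ N₂ N≤m) (ℕ.m⊔n≤o⇒m≤o N₁ N₂ N≤n))) ⟩
      A ℚ.* δ ℚ.+ B ℚ.* δ
        ≡⟨ ℚ.*-distribʳ-+ δ A B ⟨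
      (A ℚ.+ B) ℚ.* δ
        ≡⟨ ABδ≡ε ⟩
      ε ∎
    where
    open +-*-Solver
    regroup : ∀ a b c d → (a ℚ.* b) ℚ.- (c ℚ.* d) ≡ a ℚ.* (b ℚ.- d) ℚ.+ d ℚ.* (a ℚ.- c)
    regroup = solve 4 (λ a b c d → (a :* b) :- (c :* d) := a :* (b :- d) :+ d :* (a :- c)) refl

  ∣∣-triangle : ∀ a b → ℚ.∣ a ∣ ℚ.- ℚ.∣ b ∣ ℚ.≤ ℚ.∣ a ℚ.- b ∣
  ∣∣-triangle a b = let open ℚ.≤-Reasoning in begin
    ℚ.∣ a ∣ ℚ.- ℚ.∣ b ∣
      ≡⟨ cong (λ q → ℚ.∣ q ∣ ℚ.- ℚ.∣ b ∣) (split a b) ⟩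
    ℚ.∣ (a ℚ.- b) ℚ.+ b ∣ ℚ.- ℚ.∣ b ∣
      ≤⟨ ℚ.+-monoˡ-≤ (ℚ.- ℚ.∣ b ∣) (ℚ.∣p+q∣≤∣p∣+∣q∣ (a ℚ.- b) b) ⟩
    (ℚ.∣ a ℚ.- b ∣ ℚ.+ ℚ.∣ b ∣) ℚ.- ℚ.∣ b ∣
      ≡⟨ cancel ℚ.∣ a ℚ.- b ∣ ℚ.∣ b ∣ ⟩
    ℚ.∣ a ℚ.- b ∣ ∎
    where
    open +-*-Solver
    split : ∀ a b → a ≡ (a ℚ.- b) ℚ.+ b
    split = solve 2 (λ a b → a := (a :- b) :+ b) refl
    cancel : ∀ c d → (c ℚ.+ d) ℚ.- d ≡ c
    cancel = solve 2 (λ c d → (c :+ d) :- d := c) refl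

  ∣∣-lipschitz : ∀ a b → ℚ.∣ ℚ.∣ a ∣ ℚ.- ℚ.∣ b ∣ ∣ ℚ.≤ ℚ.∣ a ℚ.- b ∣
  ∣∣-lipschitz a b = [ plus , minus ]′ (ℚ.∣p∣≡p∨∣p∣≡-p (ℚ.∣ a ∣ ℚ.- ℚ.∣ b ∣))
    where
    open +-*-Solver
    flip : ∀ c d → ℚ.- (c ℚ.- d) ≡ d ℚ.- c
    flip = solve 2 (λ c d → :- (c :- d) := d :- c) refl
    plus : ℚ.∣ ℚ.∣ a ∣ ℚ.- ℚ.∣ b ∣ ∣ ≡ ℚ.∣ a ∣ ℚ.- ℚ.∣ b ∣ →
           ℚ.∣ ℚ.∣ a ∣ ℚ.- ℚ.∣ b ∣ ∣ ℚ.≤ ℚ.∣ a ℚ.- b ∣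
    plus eq = subst (ℚ._≤ ℚ.∣ a ℚ.- b ∣) (sym eq) (∣∣-triangle a b)
    minus : ℚ.∣ ℚ.∣ a ∣ ℚ.- ℚ.∣ b ∣ ∣ ≡ ℚ.- (ℚ.∣ a ∣ ℚ.- ℚ.∣ b ∣) →
            ℚ.∣ ℚ.∣ a ∣ ℚ.- ℚ.∣ b ∣ ∣ ℚ.≤ ℚ.∣ a ℚ.- b ∣
    minus eq = let open ℚ.≤-Reasoning in begin
      ℚ.∣ ℚ.∣ a ∣ ℚ.- ℚ.∣ b ∣ ∣   ≡⟨ eq ⟩
      ℚ.- (ℚ.∣ a ∣ ℚ.- ℚ.∣ b ∣)   ≡⟨ flip ℚ.∣ a ∣ ℚ.∣ b ∣ ⟩
      ℚ.∣ b ∣ ℚ.- ℚ.∣ a ∣         ≤⟨ ∣∣-triangle b a ⟩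
      ℚ.∣ b ℚ.- a ∣               ≡⟨ cong ℚ.∣_∣ (flip a b) ⟨
      ℚ.∣ ℚ.- (a ℚ.- b) ∣         ≡⟨ ℚ.∣-p∣≡∣p∣ (a ℚ.- b) ⟩
      ℚ.∣ a ℚ.- b ∣               ∎

  ∣∣-cauchy : ∀ (x : ℝ) ε → 0ℚ ℚ.< ε → ∃ λ N → ∀ m n → N ℕ.≤ m → N ℕ.≤ n →
    ℚ.∣ ℚ.∣ seq x m ∣ ℚ.- ℚ.∣ seq x n ∣ ∣ ℚ.≤ ε
  ∣∣-cauchy x ε 0<ε =
    let N , h = cauchy x ε 0<ε in
    N , λ m n N≤m N≤n → ℚ.≤-trans (∣∣-lipschitz (seq x m) (seq x n)) (h m n N≤m N≤n)

  const-cauchy : ∀ (q : ℚ) ε → 0ℚ ℚ.< ε → ∃ λ N → ∀ (m n : ℕ) → N ℕ.≤ m → N ℕ.≤ n →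
    ℚ.∣ q ℚ.- q ∣ ℚ.≤ ε
  const-cauchy q ε 0<ε = 0 , λ _ _ _ _ →
    subst (λ r → ℚ.∣ r ∣ ℚ.≤ ε) (sym (ℚ.+-inverseʳ q)) (ℚ.<⇒≤ 0<ε)

infixl 6 _+_ _-_
infixl 7 _*_
infix  8 -_
infixr 9 _^_

fromℚ : ℚ → ℝ
fromℚ q = mkℝ (λ _ → q) (const-cauchy q)

fromℤ : ℤ → ℝ
fromℤ z = fromℚ (z ℚ./ 1)

fromℕ : ℕ → ℝ
fromℕ n = fromℤ (+ n)

0ℝ 1ℝ : ℝ
0ℝ = fromℚ 0ℚ
1ℝ = fromℚ 1ℚ

_+_ _*_ : ℝ → ℝ → ℝ
x + y = mkℝ (λ n → seq x n ℚ.+ seq y n) (+-cauchy x y)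
x * y = mkℝ (λ n → seq x n ℚ.* seq y n) (*-cauchy x y)

-_ : ℝ → ℝ
- x = mkℝ (λ n → ℚ.- seq x n) (neg-cauchy x)

_-_ : ℝ → ℝ → ℝ
x - y = x + (- y)

∣_∣ : ℝ → ℝ
∣ x ∣ = mkℝ (λ n → ℚ.∣ seq x n ∣) (∣∣-cauchy x)

_^_ : ℝ → ℕ → ℝ
x ^ zero  = 1ℝ
x ^ suc k = x * x ^ k

∑ : ∀ {m} → Vector ℝ m → ℝ
∑ = foldr _+_ 0ℝ

------------------------------------------------------------------------
-- Asymptotics.  Conditions on a n / b n are multiplied out by ∣ b n ∣;
-- they agree with the quotient forms whenever b n ≠ 0 for all large n.

infix 4 _≫_ _≲_ _≳_

-- liminf ∣a/b∣ = ∞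
_≫_ : (ℕ → ℝ) → (ℕ → ℝ) → Set
a ≫ b = ∀ (C : ℝ) → Eventually λ n → C * ∣ b n ∣ ≤ ∣ a n ∣

-- limsup ∣a/b∣ < ∞
_≲_ : (ℕ → ℝ) → (ℕ → ℝ) → Set
a ≲ b = ∃ λ (C : ℝ) → Eventually λ n → ∣ a n ∣ ≤ C * ∣ b n ∣

-- liminf ∣a/b∣ > 0
_≳_ : (ℕ → ℝ) → (ℕ → ℝ) → Set
a ≳ b = ∃ λ (c : ℝ) → 0ℝ < c × Eventually λ n → c * ∣ b n ∣ ≤ ∣ a n ∣

limsup_<_ : (ℕ → ℝ) → ℝ → Set
limsup a < c = ∃ λ (c′ : ℝ) → c′ < c × Eventually λ n → a n ≤ c′

-- n ↦ n⁻²; the value at 0 is a dummy.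
n⁻² : ℕ → ℝ
n⁻² zero    = 0ℝ
n⁻² (suc k) = fromℚ (+ 1 ℚ./ (suc k ℕ.* suc k))

------------------------------------------------------------------------
-- Convex geometry in ℝⁿ, with lattice ℤⁿ

infix 4 _≋_

_≋_ : ∀ {n} → Vector ℝ n → Vector ℝ n → Set
x ≋ y = ∀ i → x i ≈ y i

combination : ∀ {m n} → Vector ℝ m → Vector (Vector ℝ n) m → Vector ℝ n
combination μ y i = ∑ λ j → μ j * y j i

Aff : ∀ {n} → Pred (Vector ℝ n) 0ℓ → Pred (Vector ℝ n) 0ℓ
Aff {n} S x = ∃ λ m → Σ (Vector (Vector ℝ n) m) λ y → Σ (Vector ℝ m) λ μ →
  (∀ j → S (y j)) × ∑ μ ≈ 1ℝ × x ≋ combination μ y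

Conv : ∀ {n} → Pred (Vector ℝ n) 0ℓ → Pred (Vector ℝ n) 0ℓ
Conv {n} S x = ∃ λ m → Σ (Vector (Vector ℝ n) m) λ y → Σ (Vector ℝ m) λ μ →
  (∀ j → S (y j)) × (∀ j → 0ℝ ≤ μ j) × ∑ μ ≈ 1ℝ × x ≋ combination μ y

AffinelyIndependent : ∀ {k n} → Vector (Vector ℝ n) k → Set
AffinelyIndependent v =
  ∀ μ → ∑ μ ≈ 0ℝ → (∀ i → combination μ v i ≈ 0ℝ) → ∀ j → μ j ≈ 0ℝ

-- dim P = k − 1.  Indexing by k covers the empty polytope, of dimension −1.
record HasDim+1 {n} (P : Pred (Vector ℝ n) 0ℓ) (k : ℕ) : Set where
  field
    basis       : Vector (Vector ℝ n) k
    basis⊆P     : ∀ j → P (basis j)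
    independent : AffinelyIndependent basis
    spanning    : P ⊆ᵖ Aff (λ x → ∃ λ j → x ≋ basis j)

ι : ∀ {n} → Vec ℤ n → Vector ℝ n
ι z i = fromℤ (Vec.lookup z i)

⟦_⟧ : ∀ {n} → Pred (Vec ℤ n) 0ℓ → Pred (Vector ℝ n) 0ℓ
⟦ A ⟧ x = ∃ λ z → A z × x ≋ ι z

conv : ∀ {n} → List (Vec ℤ n) → Pred (Vector ℝ n) 0ℓ
conv vs = Conv ⟦ _∈ vs ⟧

infixl 6 _⊞_ _⊟_

_⊞_ _⊟_ : ∀ {n} → Vec ℤ n → Vec ℤ n → Vec ℤ n
_⊞_ = Vec.zipWith ℤ._+_
_⊟_ = Vec.zipWith ℤ._-_

𝟎 : ∀ {n} → Vec ℤ n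
𝟎 = Vec.replicate _ (+ 0)

𝐞 : ∀ {n} → Fin n → Vec ℤ n
𝐞 i = 𝟎 Vec.[ i ]≔ + 1

standardSimplex : ∀ d → Vec (Vec ℤ d) (suc d)
standardSimplex d = 𝟎 ∷ Vec.tabulate 𝐞

-- A bijection ℤᵈ → Λ preserving integral affine combinations (these are
-- generated by x + y − z) and carrying the vertices of the standard simplex to
-- those of the simplex σ, in some order.
record StandardLatticeEquivalence {d n}
         (Λ : Pred (Vec ℤ n) 0ℓ) (σ : Vec (Vec ℤ n) (suc d)) : Set where
  field
    φ          : Vec ℤ d → Vec ℤ n
    affine     : ∀ x y z → φ (x ⊞ y ⊟ z) ≡ φ x ⊞ φ y ⊟ φ z
    into       : ∀ x → Λ (φ x)
    injective  : ∀ {x y} → φ x ≡ φ y → x ≡ y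
    surjective : ∀ w → Λ w → ∃ λ x → φ x ≡ w
    vertices   : List.map φ (Vec.toList (standardSimplex d)) ↭ Vec.toList σ

-- The case k = 0 concerns only the empty polytope.
Unimodular : ∀ {k n} → Pred (Vec ℤ n) 0ℓ → Vec (Vec ℤ n) k → Set
Unimodular {zero}  Λ σ = ⊤
Unimodular {suc d} Λ σ = StandardLatticeEquivalence Λ σ

-- For simplices, faces are the convex hulls of sets of vertices.
MeetInCommonFace : ∀ {n} → List (Vec ℤ n) → List (Vec ℤ n) → Set
MeetInCommonFace σ τ = ∃ λ φ → φ ⊆ σ × φ ⊆ τ ×
  (∀ x → (conv σ x × conv τ x) ⇔ conv φ x)

-- Simplices are given by their vertices.  The double negation in `covers` is
-- the classical existential: which of two adjacent simplices contains a real
-- point is not constructively decidable.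
record UnimodularTriangulation {n} (P : Pred (Vector ℝ n) 0ℓ) : Set where
  field
    {k}        : ℕ
    dimension  : HasDim+1 P k
    simplices  : List (Vec (Vec ℤ n) k)
    isSimplex  : ∀ {σ} → σ ∈ simplices →
                 AffinelyIndependent (λ j → ι (Vec.lookup σ j))
    contained  : ∀ {σ} → σ ∈ simplices → conv (Vec.toList σ) ⊆ᵖ P
    covers     : ∀ x → P x → ¬ ¬ ∃ λ σ → σ ∈ simplices × conv (Vec.toList σ) x
    meet       : ∀ {σ τ} → σ ∈ simplices → τ ∈ simplices →
                 MeetInCommonFace (Vec.toList σ) (Vec.toList τ)
    unimodular : ∀ {σ} → σ ∈ simplices → Unimodular (λ z → Aff P (ι z)) σ

pairs : ∀ {A : Set} → List A → List (A × A)
pairs []       = []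
pairs (x ∷ xs) = List.map (x ,_) xs ++ pairs xs

SameEdge : ∀ {n} → Vec ℤ n × Vec ℤ n → Vec ℤ n × Vec ℤ n → Set
SameEdge (u , v) (u′ , v′) = (u ≡ u′ × v ≡ v′) ⊎ (u ≡ v′ × v ≡ u′)

sameEdge? : ∀ {n} (e f : Vec ℤ n × Vec ℤ n) → Dec (SameEdge e f)
sameEdge? (u , v) (u′ , v′) =
  ((u ≟ u′) ×-dec (v ≟ v′)) ⊎-dec ((u ≟ v′) ×-dec (v ≟ u′))
  where _≟_ = ≡-dec ℤ._≟_

-- The vertices of a simplex are distinct, so its 1-dimensional faces are the
-- 2-element sublists of its vertex list.
edges : ∀ {n} {P : Pred (Vector ℝ n) 0ℓ} → UnimodularTriangulation P →
        List (Vec ℤ n × Vec ℤ n)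
edges T = List.deduplicate sameEdge?
  (List.concatMap (λ σ → pairs (Vec.toList σ)) (UnimodularTriangulation.simplices T))

------------------------------------------------------------------------
-- Graphs on the node set Fin n and their symmetric edge polytopes

-- An arc {i, j} is listed once, as the pair with i < j.
allArcs : ∀ n → List (Fin n × Fin n)
allArcs n = List.filter (λ a → proj₁ a Fin.<? proj₂ a)
  (List.cartesianProduct (List.allFin n) (List.allFin n))

Graph : ℕ → Set
Graph n = Subset (List.length (allArcs n))

directedArcs : ∀ n → Graph n → Pred (Vec ℤ n) 0ℓ
directedArcs n G z = ∃ λ a → a ∈ˢ G ×
  let i , j = List.lookup (allArcs n) a in
  (z ≡ 𝐞 i ⊟ 𝐞 j) ⊎ (z ≡ 𝐞 j ⊟ 𝐞 i)

symmetricEdgePolytope : ∀ n → Graph n → Pred (Vector ℝ n) 0ℓ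
symmetricEdgePolytope n G = Conv ⟦ directedArcs n G ⟧

------------------------------------------------------------------------
-- Random subsets: each element is kept independently with probability p.
-- For m = length (allArcs n) this is the Erdős–Rényi graph.

𝔼 : ∀ {m} → ℝ → (Subset m → ℝ) → ℝ
𝔼 {zero}  p X = X []
𝔼 {suc m} p X =
  p * 𝔼 p (λ G → X (inside ∷ G)) + (1ℝ - p) * 𝔼 p (λ G → X (outside ∷ G))

𝕍 : ∀ {m} → ℝ → (Subset m → ℝ) → ℝ
𝕍 p X = 𝔼 p (λ G → (X G - 𝔼 p X) ^ 2)

-- For a unimodular triangulation of a polytope P, the map {u , v} ↦ u + v is a
-- bijection from its edges onto the lattice points of 2P that are not in 2ℤⁿ,
-- because the points of ℤⁿ in aff P have integral barycentric coordinates in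
-- every simplex.  So K counts those points, and only grows when an arc {a , b}
-- is added to G.  It grows by at least 1, and for each arc {j , l} of G with
-- {a , l} not in G it gains the point (e_a − e_b) + (e_j − e_l): the functional
-- x_a − x_b − x_l is at most 1 on the polytope without {a , b} and 3 there.
-- Hence the expected gain is at least max (1 , c n² p (1 − p)), and the variance
-- of a function of independent bits is at least the sum over the bits of
-- p (1 − p) times the square of the expected gain.

module Submission where

open import Level using (0ℓ)
open import Data.Bool using (Bool; true; false; if_then_else_; _∧_; not)
open import Data.Bool.Properties using (T-≡; T?; ∧-conicalˡ; ∧-conicalʳ; not-injective)
open import Data.Nat as ℕ using (ℕ; zero; suc)
import Data.Nat.Properties as ℕ
import Data.Nat.DivMod as ℕ
import Data.Nat.Tactic.RingSolver as ℕ-Solver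
open import Data.Integer as ℤ using (ℤ; +_; -[1+_])
import Data.Integer.Properties as ℤ
import Data.Integer.Solver as ℤ-Solver
open import Data.Rational as ℚ using (ℚ; 0ℚ; 1ℚ; ½)
import Data.Rational.Properties as ℚ
import Data.Rational.Unnormalised as ℚᵘ
import Data.Rational.Unnormalised.Properties as ℚᵘ
open import Data.Rational.Solver using (module +-*-Solver)
open import Data.Fin as Fin using (Fin; zero; suc)
import Data.Fin.Properties as Fin
open import Data.Fin.Patterns using (0F; 1F; 2F; 3F)
open import Data.Fin.Subset using (Subset; inside; outside) renaming (_∈_ to _∈ˢ_)
open import Data.Fin.Subset.Properties using () renaming (_∈?_ to _∈ˢ?_)
open import Data.Vec as Vec using (Vec; []; _∷_; _[_]≔_)
import Data.Vec.Properties as Vec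
import Data.Vec.Relation.Unary.Any as VecAny
import Data.Vec.Relation.Unary.Any.Properties as VecAny
import Data.Vec.Membership.Propositional as VecMembership
import Data.Vec.Membership.Propositional.Properties as VecMembership
open import Data.Vec.Functional using (Vector)
open import Data.List as List using (List; []; _∷_; _++_; length; filter; filterᵇ)
import Data.List.Properties as List
open import Data.List.Membership.Propositional using (_∈_; _∉_; find)
open import Data.List.Membership.Propositional.Properties
open import Data.List.Membership.DecPropositional using () renaming (_∈?_ to mem?)
open import Data.List.Relation.Binary.Subset.Propositional using (_⊆_)
open import Data.List.Relation.Binary.Permutation.Propositional using (_↭_)
open import Data.List.Relation.Binary.Permutation.Propositional.Properties using (∈-resp-↭)
open import Data.List.Relation.Unary.All as All using (All; []; _∷_)
open import Data.List.Relation.Unary.Any as Any using (here; there)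
import Data.List.Relation.Unary.Any.Properties as Any
open import Data.List.Relation.Unary.AllPairs as AllPairs using (AllPairs; []; _∷_)
import Data.List.Relation.Unary.AllPairs.Properties as AllPairs
open import Data.List.Relation.Unary.Unique.Propositional using (Unique)
import Data.List.Relation.Unary.Unique.Propositional.Properties as Unique
import Data.List.Relation.Unary.Unique.DecSetoid.Properties as DecSetoidUnique
open import Data.Product using (∃; ∃₂; _×_; _,_; proj₁; proj₂; uncurry)
open import Data.Sum using (_⊎_; inj₁; inj₂; [_,_]′)
open import Function using (_∘_)
open import Function.Bundles using (Equivalence)
open import Algebra.Bundles using (CommutativeRing; Semiring)
open import Algebra.Structures using (IsAbelianGroup; IsCommutativeRing)
import Algebra.Properties.Semiring.Sum as Sum
open import Algebra.Properties.Ring ℤ.+-*-ring using (x+x≈x⇒x≈0; +-cancelˡ)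
open import Relation.Unary using (Pred)
open import Relation.Binary.Bundles using (DecSetoid)
open import Relation.Nullary using (¬_; Dec; yes; no; does)
open import Relation.Nullary.Decidable using (decidable-stable; _×-dec_; _⊎-dec_)
open import Relation.Nullary.Negation using (contradiction)
open import Relation.Binary.PropositionalEquality as ≡
  using (_≡_; _≢_; refl; cong; cong₂; subst)
import Relation.Binary.Reasoning.Setoid as SetoidReasoning

-- The triangulations chosen for a graph with and without an arc need not share any simplex, so
-- nothing can be carried from one to the other. Only the description of edges by lattice points
-- compares them, and a point is shown to lie outside 2P by an integral functional that is at most 1
-- on every directed arc and at least 3 at the point. To count the gained points, four consecutive
-- blocks of h = floor(n/4) nodes supply a, b, j and l in this order. The four nodes are then
-- distinct, the arcs {j , l} and {a , l} differ from each other and from the added arc, and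
-- different choices of (j , l) give different points. Hence the expected gain is at least L = h² q
-- (1 - q) for each of the h² arcs {a , b}, and the sum over these arcs is at least L³; with the
-- gain 1 it is at least L. Both regimes reduce to comparing L with n² q. All estimates are made
-- over ℚ. Operations on reals act termwise, so it suffices to treat the late terms q of `p n`, for
-- which 0 ≤ q and 1 - q is bounded below by a constant independent of n.

module Σℚ = Sum (CommutativeRing.semiring ℚ.+-*-commutativeRing)

-- Inequalities between rationals and the embedding of the integers

module RationalInequalities where
  open import Data.Rational
  open +-*-Solver

  0≤p-q : ∀ {p q} → p ≤ q → 0ℚ ≤ q - p
  0≤p-q {p} {q} p≤q = subst (_≤ q - p) (ℚ.+-inverseʳ p) (ℚ.+-monoˡ-≤ (- p) p≤q)

  0≤p-q⁻¹ : ∀ {p q} → 0ℚ ≤ q - p → p ≤ q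
  0≤p-q⁻¹ {p} {q} h = ≡.subst₂ _≤_ (ℚ.+-identityˡ p)
    (solve 2 (λ p q → (q :- p) :+ p := q) refl p q) (ℚ.+-monoˡ-≤ p h)

  *-nonNeg : ∀ {p q} → 0ℚ ≤ p → 0ℚ ≤ q → 0ℚ ≤ p * q
  *-nonNeg {p} {q} 0≤p 0≤q = ℚ.nonNegative⁻¹ (p * q)
    {{ℚ.nonNeg*nonNeg⇒nonNeg p {{ℚ.nonNegative 0≤p}} q {{ℚ.nonNegative 0≤q}}}}

  +-nonNeg : ∀ {p q} → 0ℚ ≤ p → 0ℚ ≤ q → 0ℚ ≤ p + q
  +-nonNeg 0≤p 0≤q = ℚ.+-mono-≤ 0≤p 0≤q

  *-pos : ∀ {p q} → 0ℚ < p → 0ℚ < q → 0ℚ < p * q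
  *-pos {p} {q} 0<p 0<q = ℚ.positive⁻¹ (p * q)
    {{ℚ.pos*pos⇒pos p {{ℚ.positive 0<p}} q {{ℚ.positive 0<q}}}}

  *-mono-≤-nonNeg : ∀ {p q r s} → 0ℚ ≤ p → 0ℚ ≤ s → p ≤ q → r ≤ s → p * r ≤ q * s
  *-mono-≤-nonNeg {p} {q} {r} {s} 0≤p 0≤s p≤q r≤s = ℚ.≤-trans
    (ℚ.*-monoˡ-≤-nonNeg p {{ℚ.nonNegative 0≤p}} r≤s)
    (ℚ.*-monoʳ-≤-nonNeg s {{ℚ.nonNegative 0≤s}} p≤q)

  0<½ : ∀ {ε} → 0ℚ < ε → 0ℚ < ½ * ε
  0<½ = *-pos (ℚ.positive⁻¹ ½)

  ½+½ : ∀ ε → ½ * ε + ½ * ε ≡ ε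
  ½+½ = solve 1 (λ ε → con ½ :* ε :+ con ½ :* ε := ε) refl

  ∃-divisor : ∀ {ε B} → 0ℚ < ε → 0ℚ < B → ∃ λ δ → 0ℚ < δ × B * δ ≡ ε
  ∃-divisor {ε} {B} 0<ε 0<B = 1/ B * ε ,
    *-pos (ℚ.positive⁻¹ (1/ B) {{ℚ.1/pos⇒pos B}}) 0<ε ,
    (begin
      B * (1/ B * ε) ≡⟨ ℚ.*-assoc B (1/ B) ε ⟨
      B * 1/ B * ε   ≡⟨ cong (_* ε) (ℚ.*-inverseʳ B) ⟩
      1ℚ * ε         ≡⟨ ℚ.*-identityˡ ε ⟩
      ε              ∎)
    where
    open ≡.≡-Reasoning
    instance
      B-pos : Positive B
      B-pos = ℚ.positive 0<B
      B-nonZero : NonZero B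
      B-nonZero = ℚ.pos⇒nonZero B

  p≤∣p∣ : ∀ p → p ≤ ∣ p ∣
  p≤∣p∣ p with ℚ.≤-total 0ℚ p
  ... | inj₁ 0≤p = ℚ.≤-reflexive (≡.sym (ℚ.0≤p⇒∣p∣≡p 0≤p))
  ... | inj₂ p≤0 = ℚ.≤-trans p≤0 (ℚ.0≤∣p∣ p)

  -- Division by 1 normalises its result and does not compute on a variable numerator, so the
  -- identity is checked on unnormalised rationals, where all denominators are 1.
  /1-+ : ∀ a b → (a ℤ.+ b) / 1 ≡ a / 1 + b / 1
  /1-+ a b = ℚ.toℚᵘ-injective (begin
    ℚ.toℚᵘ ((a ℤ.+ b) / 1)              ≈⟨ ℚ.toℚᵘ-fromℚᵘ (ℚᵘ.mkℚᵘ (a ℤ.+ b) 0) ⟩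
    ℚᵘ.mkℚᵘ (a ℤ.+ b) 0                   ≈⟨ ℚᵘ.*≡* (cong (ℤ._* + 1) (cong₂ ℤ._+_ (ℤ.*-identityʳ a) (ℤ.*-identityʳ b))) ⟨
    ℚᵘ.mkℚᵘ a 0 ℚᵘ.+ ℚᵘ.mkℚᵘ b 0          ≈⟨ ℚᵘ.+-cong (ℚ.toℚᵘ-fromℚᵘ (ℚᵘ.mkℚᵘ a 0)) (ℚ.toℚᵘ-fromℚᵘ (ℚᵘ.mkℚᵘ b 0)) ⟨
    ℚ.toℚᵘ (a / 1) ℚᵘ.+ ℚ.toℚᵘ (b / 1) ≈⟨ ℚ.toℚᵘ-homo-+ (a / 1) (b / 1) ⟨
    ℚ.toℚᵘ (a / 1 + b / 1)          ∎)
    where open import Relation.Binary.Reasoning.Setoid ℚᵘ.≃-setoid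

  /1-* : ∀ a b → (a ℤ.* b) / 1 ≡ a / 1 * (b / 1)
  /1-* a b = ℚ.toℚᵘ-injective (begin
    ℚ.toℚᵘ ((a ℤ.* b) / 1)              ≈⟨ ℚ.toℚᵘ-fromℚᵘ (ℚᵘ.mkℚᵘ (a ℤ.* b) 0) ⟩
    ℚᵘ.mkℚᵘ (a ℤ.* b) 0                   ≈⟨ ℚᵘ.*≡* refl ⟩
    ℚᵘ.mkℚᵘ a 0 ℚᵘ.* ℚᵘ.mkℚᵘ b 0          ≈⟨ ℚᵘ.*-cong (ℚ.toℚᵘ-fromℚᵘ (ℚᵘ.mkℚᵘ a 0)) (ℚ.toℚᵘ-fromℚᵘ (ℚᵘ.mkℚᵘ b 0)) ⟨
    ℚ.toℚᵘ (a / 1) ℚᵘ.* ℚ.toℚᵘ (b / 1) ≈⟨ ℚ.toℚᵘ-homo-* (a / 1) (b / 1) ⟨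
    ℚ.toℚᵘ (a / 1 * (b / 1))        ∎)
    where open import Relation.Binary.Reasoning.Setoid ℚᵘ.≃-setoid

  /1-mono-≤ : ∀ {a b} → a ℤ.≤ b → a / 1 ≤ b / 1
  /1-mono-≤ {a} {b} a≤b = ℚ.toℚᵘ-cancel-≤ (begin
    ℚ.toℚᵘ (a / 1) ≃⟨ ℚ.toℚᵘ-fromℚᵘ (ℚᵘ.mkℚᵘ a 0) ⟩
    ℚᵘ.mkℚᵘ a 0      ≤⟨ ℚᵘ.*≤* (ℤ.*-monoʳ-≤-nonNeg (+ 1) a≤b) ⟩
    ℚᵘ.mkℚᵘ b 0      ≃⟨ ℚ.toℚᵘ-fromℚᵘ (ℚᵘ.mkℚᵘ b 0) ⟨
    ℚ.toℚᵘ (b / 1) ∎)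
    where open ℚᵘ.≤-Reasoning

open RationalInequalities

-- Lengths of duplicate-free lists

module _ {A : Set} where

  unique-lookup-injective : ∀ {xs : List A} → Unique xs → ∀ {i j} →
                            List.lookup xs i ≡ List.lookup xs j → i ≡ j
  unique-lookup-injective (_    ∷ _)  {zero}  {zero}  _  = refl
  unique-lookup-injective (x∉xs ∷ _)  {zero}  {suc j} eq = contradiction eq (All.lookup x∉xs (∈-lookup j))
  unique-lookup-injective (x∉xs ∷ _)  {suc i} {zero}  eq = contradiction (≡.sym eq) (All.lookup x∉xs (∈-lookup i))
  unique-lookup-injective (_    ∷ xs!) {suc i} {suc j} eq = cong suc (unique-lookup-injective xs! eq)

  -- Pigeonhole: sending each position of `xs` to a position of the same entry in `ys` is injective
  -- because `xs` has no repetitions.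
  unique∧⊆⇒length≤ : ∀ {xs ys : List A} → Unique xs → xs ⊆ ys → length xs ℕ.≤ length ys
  unique∧⊆⇒length≤ {xs} {ys} xs! xs⊆ys = Fin.injective⇒≤ {f = f} λ {i} {j} fi≡fj →
    unique-lookup-injective xs! (≡.trans (lookup-f i) (≡.trans (cong (List.lookup ys) fi≡fj) (≡.sym (lookup-f j))))
    where
    f : Fin (length xs) → Fin (length ys)
    f i = Any.index (xs⊆ys (∈-lookup i))
    lookup-f : ∀ i → List.lookup xs i ≡ List.lookup ys (f i)
    lookup-f i = Any.lookup-index (xs⊆ys (∈-lookup i))

-- Expectation, variance and influences of functions of independent bits

module BernoulliVariance where
  open import Data.Rational
  open +-*-Solver
  open Σℚ using (sum)

  -- The recursion of `𝔼` with a rational probability. The k-th term of `𝔼 p X` is this expectation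
  -- at the k-th term of `p`.
  𝔼ℚ : ∀ {m} → ℚ → (Subset m → ℚ) → ℚ
  𝔼ℚ {zero}  q f = f []
  𝔼ℚ {suc m} q f = q * 𝔼ℚ q (λ G → f (inside ∷ G)) + (1ℚ - q) * 𝔼ℚ q (λ G → f (outside ∷ G))

  -- The trailing factor 1 is what `_^ 2` unfolds to, so that this matches the terms of `𝕍`.
  𝕍ℚ : ∀ {m} → ℚ → (Subset m → ℚ) → ℚ
  𝕍ℚ q f = 𝔼ℚ q (λ G → (f G - 𝔼ℚ q f) * ((f G - 𝔼ℚ q f) * 1ℚ))

  Δ : ∀ {m} → Fin m → (Subset m → ℚ) → Subset m → ℚ
  Δ i f G = f (G [ i ]≔ inside) - f (G [ i ]≔ outside)

  𝔼ℚ-cong : ∀ {m} q {f g : Subset m → ℚ} → (∀ G → f G ≡ g G) → 𝔼ℚ q f ≡ 𝔼ℚ q g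
  𝔼ℚ-cong {zero}  q f≗g = f≗g []
  𝔼ℚ-cong {suc m} q f≗g = cong₂ (λ x y → q * x + (1ℚ - q) * y)
    (𝔼ℚ-cong q (λ G → f≗g (inside ∷ G))) (𝔼ℚ-cong q (λ G → f≗g (outside ∷ G)))

  𝔼ℚ-const : ∀ {m} q c → 𝔼ℚ {m} q (λ _ → c) ≡ c
  𝔼ℚ-const {zero}  q c = refl
  𝔼ℚ-const {suc m} q c = ≡.trans
    (cong₂ (λ x y → q * x + (1ℚ - q) * y) (𝔼ℚ-const {m} q c) (𝔼ℚ-const {m} q c))
    (solve 2 (λ q c → q :* c :+ (con 1ℚ :- q) :* c := c) refl q c)

  𝔼ℚ-+* : ∀ {m} q c (f g : Subset m → ℚ) →
          𝔼ℚ q (λ G → f G + c * g G) ≡ 𝔼ℚ q f + c * 𝔼ℚ q g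
  𝔼ℚ-+* {zero}  q c f g = refl
  𝔼ℚ-+* {suc m} q c f g = ≡.trans
    (cong₂ (λ x y → q * x + (1ℚ - q) * y)
      (𝔼ℚ-+* q c (λ G → f (inside ∷ G)) (λ G → g (inside ∷ G)))
      (𝔼ℚ-+* q c (λ G → f (outside ∷ G)) (λ G → g (outside ∷ G))))
    (solve 6 (λ q c x y u v →
        q :* (x :+ c :* u) :+ (con 1ℚ :- q) :* (y :+ c :* v)
        := (q :* x :+ (con 1ℚ :- q) :* y) :+ c :* (q :* u :+ (con 1ℚ :- q) :* v))
      refl q c _ _ _ _)

  𝔼ℚ-- : ∀ {m} q (f g : Subset m → ℚ) → 𝔼ℚ q (λ G → f G - g G) ≡ 𝔼ℚ q f - 𝔼ℚ q g
  𝔼ℚ-- q f g = begin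
    𝔼ℚ q (λ G → f G - g G)              ≡⟨ 𝔼ℚ-cong q (λ G → minus (f G) (g G)) ⟩
    𝔼ℚ q (λ G → f G + (- 1ℚ) * g G)     ≡⟨ 𝔼ℚ-+* q (- 1ℚ) f g ⟩
    𝔼ℚ q f + (- 1ℚ) * 𝔼ℚ q g            ≡⟨ minus (𝔼ℚ q f) (𝔼ℚ q g) ⟨
    𝔼ℚ q f - 𝔼ℚ q g                     ∎
    where
    open ≡.≡-Reasoning
    minus : ∀ x y → x - y ≡ x + (- 1ℚ) * y
    minus = solve 2 (λ x y → x :- y := x :+ (:- con 1ℚ) :* y) refl

  𝕍ℚ≡𝔼²-² : ∀ {m} q (f : Subset m → ℚ) → 𝕍ℚ q f ≡ 𝔼ℚ q (λ G → f G * f G) - 𝔼ℚ q f * 𝔼ℚ q f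
  𝕍ℚ≡𝔼²-² {m} q f = begin
    𝕍ℚ q f
      ≡⟨ 𝔼ℚ-cong q (λ G → solve 2 (λ x c → (x :- c) :* ((x :- c) :* con 1ℚ)
           := (x :* x :+ (:- (con 1ℚ :+ con 1ℚ)) :* c :* x) :+ c :* c) refl (f G) c) ⟩
    𝔼ℚ q (λ G → (f G * f G + (- (1ℚ + 1ℚ)) * c * f G) + c * c)
      ≡⟨ 𝔼ℚ-+* q c (λ G → f G * f G + (- (1ℚ + 1ℚ)) * c * f G) (λ _ → c) ⟩
    𝔼ℚ q (λ G → f G * f G + (- (1ℚ + 1ℚ)) * c * f G) + c * 𝔼ℚ {m} q (λ _ → c)
      ≡⟨ cong₂ (λ x y → x + c * y) (𝔼ℚ-+* q ((- (1ℚ + 1ℚ)) * c) (λ G → f G * f G) f) (𝔼ℚ-const {m} q c) ⟩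
    (𝔼ℚ q (λ G → f G * f G) + (- (1ℚ + 1ℚ)) * c * c) + c * c
      ≡⟨ solve 2 (λ e c → (e :+ (:- (con 1ℚ :+ con 1ℚ)) :* c :* c) :+ c :* c := e :- c :* c) refl (𝔼ℚ q (λ G → f G * f G)) c ⟩
    𝔼ℚ q (λ G → f G * f G) - c * c ∎
    where
    open ≡.≡-Reasoning
    c = 𝔼ℚ q f

  0≤p² : ∀ p → 0ℚ ≤ p * p
  0≤p² p with ℚ.≤-total 0ℚ p
  ... | inj₁ 0≤p = *-nonNeg 0≤p 0≤p
  ... | inj₂ p≤0 = ℚ.nonNegative⁻¹ (p * p)
    {{ℚ.nonPos*nonPos⇒nonPos p {{ℚ.nonPositive p≤0}} p {{ℚ.nonPositive p≤0}}}}

  𝟙 : Bool → ℚ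
  𝟙 true  = 1ℚ
  𝟙 false = 0ℚ

  𝔼ℚ-lookup : ∀ {m} q (i : Fin m) (φ : Bool → ℚ) →
              𝔼ℚ q (λ G → φ (Vec.lookup G i)) ≡ q * φ true + (1ℚ - q) * φ false
  𝔼ℚ-lookup {suc m} q zero φ = cong₂ (λ x y → q * x + (1ℚ - q) * y) (𝔼ℚ-const {m} q _) (𝔼ℚ-const {m} q _)
  𝔼ℚ-lookup q (suc i) φ = ≡.trans
    (cong (λ x → q * x + (1ℚ - q) * x) (𝔼ℚ-lookup q i φ))
    (solve 2 (λ q x → q :* x :+ (con 1ℚ :- q) :* x := x) refl q _)

  -- Independence of two different bits. Common positions are averaged away until one of the two
  -- bits comes first; the other is then a single Bernoulli variable.
  𝔼ℚ-∈∧∉ : ∀ {m} q {i j : Fin m} → i ≢ j →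
           𝔼ℚ q (λ G → 𝟙 (Vec.lookup G i ∧ not (Vec.lookup G j))) ≡ q * (1ℚ - q)
  𝔼ℚ-∈∧∉ q {zero}  {zero}  i≢j = contradiction refl i≢j
  𝔼ℚ-∈∧∉ {suc m} q {zero}  {suc j} i≢j = ≡.trans
    (cong₂ (λ x y → q * x + (1ℚ - q) * y) (𝔼ℚ-lookup q j (λ b → 𝟙 (not b))) (𝔼ℚ-const {m} q 0ℚ))
    (solve 1 (λ q → q :* (q :* con 0ℚ :+ (con 1ℚ :- q) :* con 1ℚ) :+ (con 1ℚ :- q) :* con 0ℚ
      := q :* (con 1ℚ :- q)) refl q)
  𝔼ℚ-∈∧∉ {suc m} q {suc i} {zero}  i≢j = ≡.trans
    (cong₂ (λ x y → q * x + (1ℚ - q) * y)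
      (𝔼ℚ-lookup q i (λ b → 𝟙 (b ∧ false))) (𝔼ℚ-lookup q i (λ b → 𝟙 (b ∧ true))))
    (solve 1 (λ q → q :* (q :* con 0ℚ :+ (con 1ℚ :- q) :* con 0ℚ)
        :+ (con 1ℚ :- q) :* (q :* con 1ℚ :+ (con 1ℚ :- q) :* con 0ℚ)
      := q :* (con 1ℚ :- q)) refl q)
  𝔼ℚ-∈∧∉ q {suc i} {suc j} i≢j = ≡.trans
    (cong (λ x → q * x + (1ℚ - q) * x) (𝔼ℚ-∈∧∉ q (i≢j ∘ cong suc)))
    (solve 1 (λ q → q :* (q :* (con 1ℚ :- q)) :+ (con 1ℚ :- q) :* (q :* (con 1ℚ :- q))
      := q :* (con 1ℚ :- q)) refl q)

  fromℕℚ : ℕ → ℚ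
  fromℕℚ n = + n / 1

  fromℕℚ-suc : ∀ n → fromℕℚ (suc n) ≡ 1ℚ + fromℕℚ n
  fromℕℚ-suc n = /1-+ (+ 1) (+ n)

  fromℕℚ-if : ∀ b n → fromℕℚ (if b then suc n else n) ≡ 𝟙 b + 1ℚ * fromℕℚ n
  fromℕℚ-if true  n = ≡.trans (fromℕℚ-suc n) (cong (λ v → 1ℚ + v) (≡.sym (ℚ.*-identityˡ (fromℕℚ n))))
  fromℕℚ-if false n = ≡.sym (≡.trans (ℚ.+-identityˡ (1ℚ * fromℕℚ n)) (ℚ.*-identityˡ (fromℕℚ n)))

  length-filterᵇ-∷ : ∀ {A : Set} (p : A → Bool) x xs →
    length (filterᵇ p (x ∷ xs)) ≡ (if p x then suc (length (filterᵇ p xs)) else length (filterᵇ p xs))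
  length-filterᵇ-∷ p x xs with p x
  ... | true  = refl
  ... | false = refl

  -- Linearity of expectation: the count is a sum of indicators with the common mean c.
  𝔼ℚ-count : ∀ {m} {A : Set} q c (P : Subset m → A → Bool) (xs : List A) →
    (∀ {x} → x ∈ xs → 𝔼ℚ q (λ G → 𝟙 (P G x)) ≡ c) →
    𝔼ℚ q (λ G → fromℕℚ (length (filterᵇ (P G) xs))) ≡ fromℕℚ (length xs) * c
  𝔼ℚ-count {m} q c P [] h = ≡.trans (𝔼ℚ-const {m} q 0ℚ) (≡.sym (ℚ.*-zeroˡ c))
  𝔼ℚ-count q c P (x ∷ xs) h = begin
    𝔼ℚ q (λ G → fromℕℚ (length (filterᵇ (P G) (x ∷ xs))))
      ≡⟨ 𝔼ℚ-cong q count-∷ ⟩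
    𝔼ℚ q (λ G → 𝟙 (P G x) + 1ℚ * fromℕℚ (length (filterᵇ (P G) xs)))
      ≡⟨ 𝔼ℚ-+* q 1ℚ (λ G → 𝟙 (P G x)) (λ G → fromℕℚ (length (filterᵇ (P G) xs))) ⟩
    𝔼ℚ q (λ G → 𝟙 (P G x)) + 1ℚ * 𝔼ℚ q (λ G → fromℕℚ (length (filterᵇ (P G) xs)))
      ≡⟨ cong₂ (λ u v → u + 1ℚ * v) (h (here refl)) (𝔼ℚ-count q c P xs (h ∘ there)) ⟩
    c + 1ℚ * (fromℕℚ (length xs) * c)
      ≡⟨ solve 2 (λ n c → c :+ con 1ℚ :* (n :* c) := (con 1ℚ :+ n) :* c) refl (fromℕℚ (length xs)) c ⟩
    (1ℚ + fromℕℚ (length xs)) * c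
      ≡⟨ cong (_* c) (fromℕℚ-suc (length xs)) ⟨
    fromℕℚ (suc (length xs)) * c ∎
    where
    open ≡.≡-Reasoning
    count-∷ : ∀ G → fromℕℚ (length (filterᵇ (P G) (x ∷ xs))) ≡ 𝟙 (P G x) + 1ℚ * fromℕℚ (length (filterᵇ (P G) xs))
    count-∷ G = ≡.trans (cong fromℕℚ (length-filterᵇ-∷ (P G) x xs)) (fromℕℚ-if (P G x) _)

  private
    -- The function g is there for the induction: the tail of a tabulated list is again tabulated,
    -- with g shifted by `suc`.
    count*≤∑ : ∀ {A : Set} {Q : A → Set} (Q? : ∀ x → Dec (Q x)) {m} (g : Fin m → A) (t : Vector ℚ m) {L} →
      (∀ i → 0ℚ ≤ t i) → (∀ i → Q (g i) → L ≤ t i) →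
      fromℕℚ (length (filter Q? (List.tabulate g))) * L ≤ sum t
    count*≤∑ Q? {zero}  g t {L} 0≤t L≤t = ℚ.≤-reflexive (ℚ.*-zeroˡ L)
    count*≤∑ Q? {suc m} g t {L} 0≤t L≤t with Q? (g zero)
    ... | yes Qg = ℚ.≤-trans
      (ℚ.≤-reflexive (≡.trans (cong (_* L) (fromℕℚ-suc n))
        (solve 2 (λ n L → (con 1ℚ :+ n) :* L := L :+ n :* L) refl (fromℕℚ n) L)))
      (ℚ.+-mono-≤ (L≤t zero Qg) (count*≤∑ Q? (λ i → g (suc i)) (λ i → t (suc i)) (0≤t ∘ suc) (L≤t ∘ suc)))
      where n = length (filter Q? (List.tabulate (λ i → g (suc i))))
    ... | no _ = ℚ.≤-trans (ℚ.≤-reflexive (≡.sym (ℚ.+-identityˡ _)))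
      (ℚ.+-mono-≤ (0≤t zero) (count*≤∑ Q? (λ i → g (suc i)) (λ i → t (suc i)) (0≤t ∘ suc) (L≤t ∘ suc)))

  -- The list may come in any order, so it is first compared with the indices that belong to it,
  -- taken in the order of the sum.
  length*≤∑ : ∀ {m} {is : List (Fin m)} → Unique is → (t : Vector ℚ m) {L : ℚ} → 0ℚ ≤ L →
    (∀ i → 0ℚ ≤ t i) → (∀ {i} → i ∈ is → L ≤ t i) → fromℕℚ (length is) * L ≤ sum t
  length*≤∑ {m} {is} is! t {L} 0≤L 0≤t L≤t = ℚ.≤-trans
    (ℚ.*-monoʳ-≤-nonNeg L {{ℚ.nonNegative 0≤L}} (/1-mono-≤ (ℤ.+≤+ (unique∧⊆⇒length≤ is!
      λ {i} i∈is → ∈-filter⁺ (λ i → mem? Fin._≟_ i is) (∈-allFin i) i∈is))))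
    (count*≤∑ (λ i → mem? Fin._≟_ i is) (λ i → i) t 0≤t (λ i → L≤t))

  module _ {q} (0≤q : 0ℚ ≤ q) (q≤1 : q ≤ 1ℚ) where

    mix-mono : ∀ {x x′ y y′} → x ≤ x′ → y ≤ y′ → q * x + (1ℚ - q) * y ≤ q * x′ + (1ℚ - q) * y′
    mix-mono x≤x′ y≤y′ = ℚ.+-mono-≤
      (ℚ.*-monoˡ-≤-nonNeg q {{ℚ.nonNegative 0≤q}} x≤x′)
      (ℚ.*-monoˡ-≤-nonNeg (1ℚ - q) {{ℚ.nonNegative (0≤p-q q≤1)}} y≤y′)

    𝔼ℚ-mono : ∀ {m} {f g : Subset m → ℚ} → (∀ G → f G ≤ g G) → 𝔼ℚ q f ≤ 𝔼ℚ q g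
    𝔼ℚ-mono {zero}  f≤g = f≤g []
    𝔼ℚ-mono {suc m} f≤g = mix-mono (𝔼ℚ-mono (λ G → f≤g (inside ∷ G))) (𝔼ℚ-mono (λ G → f≤g (outside ∷ G)))

    -- Convexity of the square: the two sides differ by q (1 - q) (x - y)².
    mix-² : ∀ x y → (q * x + (1ℚ - q) * y) * (q * x + (1ℚ - q) * y) ≤ q * (x * x) + (1ℚ - q) * (y * y)
    mix-² x y = 0≤p-q⁻¹ (subst (0ℚ ≤_)
      (solve 3 (λ q x y → (q :* (con 1ℚ :- q)) :* ((x :- y) :* (x :- y))
         := (q :* (x :* x) :+ (con 1ℚ :- q) :* (y :* y))
            :- (q :* x :+ (con 1ℚ :- q) :* y) :* (q :* x :+ (con 1ℚ :- q) :* y)) refl q x y)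
      (*-nonNeg (*-nonNeg 0≤q (0≤p-q q≤1)) (0≤p² (x - y))))

    ∑-mix-² : ∀ {m} (x y : Vector ℚ m) →
      sum (λ i → (q * x i + (1ℚ - q) * y i) * (q * x i + (1ℚ - q) * y i))
      ≤ q * sum (λ i → x i * x i) + (1ℚ - q) * sum (λ i → y i * y i)
    ∑-mix-² {zero}  x y = ℚ.≤-reflexive (solve 1 (λ q → con 0ℚ := q :* con 0ℚ :+ (con 1ℚ :- q) :* con 0ℚ) refl q)
    ∑-mix-² {suc m} x y = ℚ.≤-trans
      (ℚ.+-mono-≤ (mix-² (x zero) (y zero)) (∑-mix-² (λ i → x (suc i)) (λ i → y (suc i))))
      (ℚ.≤-reflexive (solve 5 (λ q a b c d →
        (q :* a :+ (con 1ℚ :- q) :* b) :+ (q :* c :+ (con 1ℚ :- q) :* d)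
        := q :* (a :+ c) :+ (con 1ℚ :- q) :* (b :+ d)) refl q _ _ _ _))

    -- The first-order part of the Hoeffding decomposition.
    𝔼²+influences≤𝔼² : ∀ {m} (f : Subset m → ℚ) →
      𝔼ℚ q f * 𝔼ℚ q f + q * (1ℚ - q) * sum (λ i → 𝔼ℚ q (Δ i f) * 𝔼ℚ q (Δ i f))
      ≤ 𝔼ℚ q (λ G → f G * f G)
    𝔼²+influences≤𝔼² {zero}  f = ℚ.≤-reflexive
      (solve 2 (λ q x → x :* x :+ q :* (con 1ℚ :- q) :* con 0ℚ := x :* x) refl q (f []))
    𝔼²+influences≤𝔼² {suc m} f = begin
      (q * A + r * B) * (q * A + r * B) + q * r * (D * D + S)
        ≡⟨ cong (λ d → (q * A + r * B) * (q * A + r * B) + q * r * (d * d + S)) D≡A-B ⟩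
      (q * A + r * B) * (q * A + r * B) + q * r * ((A - B) * (A - B) + S)
        -- The mean derivative at a later bit is the mixture of its means on the two halves of the
        -- cube. Convexity trades its square for the mixture of squares that the induction
        -- hypotheses contain.
        ≤⟨ ℚ.+-monoʳ-≤ ((q * A + r * B) * (q * A + r * B))
             (ℚ.*-monoˡ-≤-nonNeg (q * r) {{ℚ.nonNegative (*-nonNeg 0≤q (0≤p-q q≤1))}}
               (ℚ.+-monoʳ-≤ ((A - B) * (A - B)) (∑-mix-² x y))) ⟩
      (q * A + r * B) * (q * A + r * B) + q * r * ((A - B) * (A - B) + (q * S₁ + r * S₀))
        -- The influence of the first bit is exactly the convexity defect: (q A + r B)² + q r (A -
        -- B)² = q A² + r B².
        ≡⟨ solve 5 (λ q A B S₁ S₀ → let r = con 1ℚ :- q in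
             (q :* A :+ r :* B) :* (q :* A :+ r :* B)
               :+ q :* r :* ((A :- B) :* (A :- B) :+ (q :* S₁ :+ r :* S₀))
             := q :* (A :* A :+ q :* r :* S₁) :+ r :* (B :* B :+ q :* r :* S₀)) refl q A B S₁ S₀ ⟩
      q * (A * A + q * r * S₁) + r * (B * B + q * r * S₀)
        ≤⟨ mix-mono (𝔼²+influences≤𝔼² f₁) (𝔼²+influences≤𝔼² f₀) ⟩
      𝔼ℚ q (λ G → f G * f G) ∎
      where
      open ℚ.≤-Reasoning
      f₁ f₀ : Subset m → ℚ
      f₁ G = f (inside ∷ G)
      f₀ G = f (outside ∷ G)
      r A B D S S₁ S₀ : ℚ
      r = 1ℚ - q
      A = 𝔼ℚ q f₁
      B = 𝔼ℚ q f₀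
      D = 𝔼ℚ q (Δ zero f)
      x y : Vector ℚ m
      x i = 𝔼ℚ q (Δ i f₁)
      y i = 𝔼ℚ q (Δ i f₀)
      S = sum (λ i → (q * x i + r * y i) * (q * x i + r * y i))
      S₁ = sum (λ i → x i * x i)
      S₀ = sum (λ i → y i * y i)
      D≡A-B : D ≡ A - B
      D≡A-B = ≡.trans (cong (λ e → q * e + r * e) (𝔼ℚ-- q f₁ f₀))
        (solve 2 (λ q e → q :* e :+ (con 1ℚ :- q) :* e := e) refl q (A - B))

    influences≤𝕍ℚ : ∀ {m} (f : Subset m → ℚ) →
      q * (1ℚ - q) * sum (λ i → 𝔼ℚ q (Δ i f) * 𝔼ℚ q (Δ i f)) ≤ 𝕍ℚ q f
    influences≤𝕍ℚ f = begin
      I                                             ≡⟨ solve 2 (λ e i → i := (e :* e :+ i) :- e :* e) refl (𝔼ℚ q f) I ⟩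
      (𝔼ℚ q f * 𝔼ℚ q f + I) - 𝔼ℚ q f * 𝔼ℚ q f       ≤⟨ ℚ.+-monoˡ-≤ (- (𝔼ℚ q f * 𝔼ℚ q f)) (𝔼²+influences≤𝔼² f) ⟩
      𝔼ℚ q (λ G → f G * f G) - 𝔼ℚ q f * 𝔼ℚ q f      ≡⟨ 𝕍ℚ≡𝔼²-² q f ⟨
      𝕍ℚ q f                                        ∎
      where
      open ℚ.≤-Reasoning
      I : ℚ
      I = q * (1ℚ - q) * sum (λ i → 𝔼ℚ q (Δ i f) * 𝔼ℚ q (Δ i f))

    influences-lower-bound : ∀ {m} (f : Subset m → ℚ) {is} {L} → Unique is → 0ℚ ≤ L →
      (∀ {i} → i ∈ is → L ≤ 𝔼ℚ q (Δ i f)) →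
      q * (1ℚ - q) * (fromℕℚ (length is) * (L * L)) ≤ 𝕍ℚ q f
    influences-lower-bound f {is} {L} is! 0≤L L≤ = ℚ.≤-trans
      (ℚ.*-monoˡ-≤-nonNeg (q * (1ℚ - q)) {{ℚ.nonNegative (*-nonNeg 0≤q (0≤p-q q≤1))}}
        (length*≤∑ is! (λ i → 𝔼ℚ q (Δ i f) * 𝔼ℚ q (Δ i f)) (*-nonNeg 0≤L 0≤L)
          (λ i → 0≤p² (𝔼ℚ q (Δ i f)))
          (λ i∈is → *-mono-≤-nonNeg 0≤L (ℚ.≤-trans 0≤L (L≤ i∈is)) (L≤ i∈is) (L≤ i∈is))))
      (influences≤𝕍ℚ f)

-- Kronecker deltas and collecting weights, over ℤ and over ℝ alike

module Collect (R : Semiring 0ℓ 0ℓ) where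
  open Semiring R renaming (Carrier to C; _≈_ to _≈ᴿ_; _+_ to _+ᴿ_; _*_ to _*ᴿ_)
    hiding (zero; refl)
  open Sum R
  open SetoidReasoning setoid

  -- Only `does` of the decision is inspected, so `δ (suc i) (suc j)` computes to `δ i j` and sums
  -- of deltas can be evaluated by recursion.
  δ : ∀ {k} → Fin k → Fin k → C
  δ i j = if does (i Fin.≟ j) then 1# else 0#

  δ-diagonal : ∀ {k} (i : Fin k) → δ i i ≡ 1#
  δ-diagonal i with i Fin.≟ i
  ... | yes _   = refl
  ... | no  i≢i = contradiction refl i≢i

  δ-off-diagonal : ∀ {k} {i j : Fin k} → i ≢ j → δ i j ≡ 0#
  δ-off-diagonal {i = i} {j} i≢j with i Fin.≟ j
  ... | yes i≡j = contradiction i≡j i≢j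
  ... | no  _   = refl

  sum-0* : ∀ {k} (g : Vector C k) → sum (λ j → 0# *ᴿ g j) ≈ᴿ 0#
  sum-0* {k} g = trans (sum-cong-≋ (λ j → zeroˡ (g j))) (sum-replicate-zero k)

  sum-δ : ∀ {k} (i : Fin k) (g : Vector C k) → sum (λ j → δ i j *ᴿ g j) ≈ᴿ g i
  sum-δ zero    g = begin
    1# *ᴿ g zero +ᴿ sum (λ j → 0# *ᴿ g (suc j)) ≈⟨ +-cong (*-identityˡ (g zero)) (sum-0* (g ∘ suc)) ⟩
    g zero +ᴿ 0#                                ≈⟨ +-identityʳ (g zero) ⟩
    g zero                                      ∎
  sum-δ (suc i) g = begin
    0# *ᴿ g zero +ᴿ sum (λ j → δ i j *ᴿ g (suc j)) ≈⟨ +-cong (zeroˡ (g zero)) (sum-δ i (g ∘ suc)) ⟩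
    0# +ᴿ g (suc i)                                ≈⟨ +-identityˡ (g (suc i)) ⟩
    g (suc i)                                      ∎

  -- A convex combination may list the same point several times. This adds up the weights that land
  -- on each vertex.
  collect : ∀ {m k} → (Fin m → Fin k) → Vector C m → Vector C k
  collect ix μ i = sum (λ j → μ j *ᴿ δ (ix j) i)

  sum-collect-* : ∀ {m k} (ix : Fin m → Fin k) (μ : Vector C m) (g : Vector C k) →
                  sum (λ i → collect ix μ i *ᴿ g i) ≈ᴿ sum (λ j → μ j *ᴿ g (ix j))
  sum-collect-* ix μ g = begin
    sum (λ i → collect ix μ i *ᴿ g i)
      ≈⟨ sum-cong-≋ (λ i → *-distribʳ-sum (g i) (λ j → μ j *ᴿ δ (ix j) i)) ⟩
    sum (λ i → sum (λ j → μ j *ᴿ δ (ix j) i *ᴿ g i))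
      ≈⟨ ∑-comm (λ i j → μ j *ᴿ δ (ix j) i *ᴿ g i) ⟩
    sum (λ j → sum (λ i → μ j *ᴿ δ (ix j) i *ᴿ g i))
      ≈⟨ sum-cong-≋ (λ j → sum-cong-≋ (λ i → *-assoc (μ j) (δ (ix j) i) (g i))) ⟩
    sum (λ j → sum (λ i → μ j *ᴿ (δ (ix j) i *ᴿ g i)))
      ≈⟨ sum-cong-≋ (λ j → *-distribˡ-sum (μ j) (λ i → δ (ix j) i *ᴿ g i)) ⟨
    sum (λ j → μ j *ᴿ sum (λ i → δ (ix j) i *ᴿ g i))
      ≈⟨ sum-cong-≋ (λ j → *-congˡ (sum-δ (ix j) g)) ⟩
    sum (λ j → μ j *ᴿ g (ix j)) ∎

  sum-*1 : ∀ {k} (g : Vector C k) → sum (λ i → g i *ᴿ 1#) ≈ᴿ sum g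
  sum-*1 g = sum-cong-≋ (λ i → *-identityʳ (g i))

  sum-collect : ∀ {m k} (ix : Fin m → Fin k) (μ : Vector C m) → sum (collect ix μ) ≈ᴿ sum μ
  sum-collect ix μ = begin
    sum (collect ix μ)                ≈⟨ sum-*1 (collect ix μ) ⟨
    sum (λ i → collect ix μ i *ᴿ 1#)  ≈⟨ sum-collect-* ix μ (λ _ → 1#) ⟩
    sum (λ j → μ j *ᴿ 1#)             ≈⟨ sum-*1 μ ⟩
    sum μ                             ∎

open BernoulliVariance using (𝔼ℚ; 𝕍ℚ; Δ; fromℕℚ; 𝔼ℚ-const; 𝔼ℚ-mono; 𝔼ℚ-∈∧∉; 𝔼ℚ-count; influences-lower-bound)

open import Defs

-- The ordered ring of real numbers

Eventually-map : ∀ {P Q : ℕ → Set} → (∀ n → P n → Q n) → Eventually P → Eventually Q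
Eventually-map f (N , h) = N , λ n N≤n → f n (h n N≤n)

Eventually-zip : ∀ {P Q R : ℕ → Set} → (∀ n → P n → Q n → R n) →
                 Eventually P → Eventually Q → Eventually R
Eventually-zip f (M , g) (N , h) = M ℕ.⊔ N , λ n ≤n →
  f n (g n (ℕ.m⊔n≤o⇒m≤o M N ≤n)) (h n (ℕ.m⊔n≤o⇒n≤o M N ≤n))

always : ∀ {P : ℕ → Set} → (∀ n → P n) → Eventually P
always f = 0 , λ n _ → f n

Eventually⇒∃ : ∀ {P : ℕ → Set} → Eventually P → ∃ P
Eventually⇒∃ (N , h) = N , h N ℕ.≤-refl

-- A wrapper from which, unlike from _≈_, the two sides can be inferred.
infix 4 _≃_
record _≃_ (x y : ℝ) : Set where
  constructor wrap
  field unwrap : x ≈ y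

open _≃_ public

pointwise : ∀ {x y} → (∀ k → seq x k ≡ seq y k) → x ≃ y
pointwise {x} {y} x≡y .unwrap ε 0<ε = always λ k → ℚ.≤-trans
  (ℚ.≤-reflexive (≡.trans (cong (λ q → ℚ.∣ q ℚ.- seq y k ∣) (x≡y k))
                          (cong ℚ.∣_∣ (ℚ.+-inverseʳ (seq y k)))))
  (ℚ.<⇒≤ 0<ε)

abstract
  ≃-sym : ∀ {x y} → x ≃ y → y ≃ x
  ≃-sym {x} {y} (wrap x≈y) .unwrap ε 0<ε = Eventually-map
    (λ n → subst (ℚ._≤ ε) (flip (seq x n) (seq y n))) (x≈y ε 0<ε)
    where
    open +-*-Solver
    flip : ∀ p q → ℚ.∣ p ℚ.- q ∣ ≡ ℚ.∣ q ℚ.- p ∣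
    flip p q = ≡.trans
      (cong ℚ.∣_∣ (solve 2 (λ p q → p :- q := :- (q :- p)) refl p q)) (ℚ.∣-p∣≡∣p∣ (q ℚ.- p))

  ∣∣-combine : ∀ {ε} p q r s t → t ≡ (p ℚ.- q) ℚ.+ (r ℚ.- s) →
               ℚ.∣ p ℚ.- q ∣ ℚ.≤ ½ ℚ.* ε → ℚ.∣ r ℚ.- s ∣ ℚ.≤ ½ ℚ.* ε → ℚ.∣ t ∣ ℚ.≤ ε
  ∣∣-combine {ε} p q r s t eq h h′ = begin
    ℚ.∣ t ∣                                ≡⟨ cong ℚ.∣_∣ eq ⟩
    ℚ.∣ (p ℚ.- q) ℚ.+ (r ℚ.- s) ∣          ≤⟨ ℚ.∣p+q∣≤∣p∣+∣q∣ (p ℚ.- q) (r ℚ.- s) ⟩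
    ℚ.∣ p ℚ.- q ∣ ℚ.+ ℚ.∣ r ℚ.- s ∣        ≤⟨ ℚ.+-mono-≤ h h′ ⟩
    ½ ℚ.* ε ℚ.+ ½ ℚ.* ε                    ≡⟨ ½+½ ε ⟩
    ε                                      ∎
    where open ℚ.≤-Reasoning

  ≃-trans : ∀ {x y z} → x ≃ y → y ≃ z → x ≃ z
  ≃-trans {x} {y} {z} (wrap x≈y) (wrap y≈z) .unwrap ε 0<ε = Eventually-zip
    (λ n → ∣∣-combine (seq x n) (seq y n) (seq y n) (seq z n) _
      (solve 3 (λ x y z → x :- z := (x :- y) :+ (y :- z)) refl (seq x n) (seq y n) (seq z n)))
    (x≈y _ (0<½ 0<ε)) (y≈z _ (0<½ 0<ε))
    where open +-*-Solver

  +-cong : ∀ {x y u v} → x ≃ y → u ≃ v → x + u ≃ y + v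
  +-cong {x} {y} {u} {v} (wrap x≈y) (wrap u≈v) .unwrap ε 0<ε = Eventually-zip
    (λ n → ∣∣-combine (seq x n) (seq y n) (seq u n) (seq v n) _
      (solve 4 (λ x y u v → (x :+ u) :- (y :+ v) := (x :- y) :+ (u :- v)) refl
        (seq x n) (seq y n) (seq u n) (seq v n)))
    (x≈y _ (0<½ 0<ε)) (u≈v _ (0<½ 0<ε))
    where open +-*-Solver

  -‿cong : ∀ {x y} → x ≃ y → - x ≃ - y
  -‿cong {x} {y} (wrap x≈y) .unwrap ε 0<ε = Eventually-map
    (λ n → subst (ℚ._≤ ε) (≡.trans (≡.sym (ℚ.∣-p∣≡∣p∣ (seq x n ℚ.- seq y n)))
      (cong ℚ.∣_∣ (solve 2 (λ x y → :- (x :- y) := (:- x) :- (:- y)) refl (seq x n) (seq y n)))))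
    (x≈y ε 0<ε)
    where open +-*-Solver

  bounded : ∀ x → ∃ λ B → 0ℚ ℚ.< B × Eventually λ n → ℚ.∣ seq x n ∣ ℚ.≤ B
  bounded x with cauchy x 1ℚ (ℚ.positive⁻¹ 1ℚ)
  ... | N , h = 1ℚ ℚ.+ ℚ.∣ seq x N ∣ , ℚ.+-mono-<-≤ (ℚ.positive⁻¹ 1ℚ) (ℚ.0≤∣p∣ (seq x N)) ,
    N , λ n N≤n → begin
      ℚ.∣ seq x n ∣                               ≡⟨ cong ℚ.∣_∣ (split (seq x n) (seq x N)) ⟩
      ℚ.∣ (seq x n ℚ.- seq x N) ℚ.+ seq x N ∣     ≤⟨ ℚ.∣p+q∣≤∣p∣+∣q∣ (seq x n ℚ.- seq x N) (seq x N) ⟩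
      ℚ.∣ seq x n ℚ.- seq x N ∣ ℚ.+ ℚ.∣ seq x N ∣ ≤⟨ ℚ.+-monoˡ-≤ _ (h n N N≤n ℕ.≤-refl) ⟩
      1ℚ ℚ.+ ℚ.∣ seq x N ∣                        ∎
    where
    open ℚ.≤-Reasoning
    open +-*-Solver
    split : ∀ p q → p ≡ (p ℚ.- q) ℚ.+ q
    split = solve 2 (λ p q → p := (p :- q) :+ q) refl

  *-congˡ : ∀ {x u v} → u ≃ v → x * u ≃ x * v
  *-congˡ {x} {u} {v} (wrap u≈v) .unwrap ε 0<ε =
    let B , 0<B , x≤B = bounded x
        δ , 0<δ , Bδ≡ε = ∃-divisor 0<ε 0<B
    in Eventually-zip
    (λ n h h′ → let open ℚ.≤-Reasoning in begin
      ℚ.∣ seq x n ℚ.* seq u n ℚ.- seq x n ℚ.* seq v n ∣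
        ≡⟨ cong ℚ.∣_∣ (factor (seq x n) (seq u n) (seq v n)) ⟩
      ℚ.∣ seq x n ℚ.* (seq u n ℚ.- seq v n) ∣
        ≡⟨ ℚ.∣p*q∣≡∣p∣*∣q∣ (seq x n) (seq u n ℚ.- seq v n) ⟩
      ℚ.∣ seq x n ∣ ℚ.* ℚ.∣ seq u n ℚ.- seq v n ∣
        ≤⟨ *-mono-≤-nonNeg (ℚ.0≤∣p∣ (seq x n)) (ℚ.<⇒≤ 0<δ) h h′ ⟩
      B ℚ.* δ
        ≡⟨ Bδ≡ε ⟩
      ε ∎)
    x≤B (u≈v δ 0<δ)
    where
    open +-*-Solver
    factor : ∀ x u v → x ℚ.* u ℚ.- x ℚ.* v ≡ x ℚ.* (u ℚ.- v)
    factor = solve 3 (λ x u v → x :* u :- x :* v := x :* (u :- v)) refl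

*-comm : ∀ x y → x * y ≃ y * x
*-comm x y = pointwise λ k → ℚ.*-comm (seq x k) (seq y k)

*-cong : ∀ {x y u v} → x ≃ y → u ≃ v → x * u ≃ y * v
*-cong {x} {y} {u} {v} x≃y u≃v =
  ≃-trans (*-comm x u) (≃-trans (*-congˡ x≃y) (≃-trans (*-comm u y) (*-congˡ u≃v)))

ℝ-isAbelianGroup : IsAbelianGroup _≃_ _+_ 0ℝ (λ x → - x)
ℝ-isAbelianGroup = record
  { isGroup = record
    { isMonoid = record
      { isSemigroup = record
        { isMagma = record
          { isEquivalence = record
            { refl = pointwise λ _ → refl ; sym = ≃-sym ; trans = ≃-trans }
          ; ∙-cong = +-cong }
        ; assoc = λ x y z → pointwise λ k → ℚ.+-assoc (seq x k) (seq y k) (seq z k) }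
      ; identity = (λ x → pointwise λ k → ℚ.+-identityˡ (seq x k))
                 , (λ x → pointwise λ k → ℚ.+-identityʳ (seq x k)) }
    ; inverse = (λ x → pointwise λ k → ℚ.+-inverseˡ (seq x k))
              , (λ x → pointwise λ k → ℚ.+-inverseʳ (seq x k))
    ; ⁻¹-cong = -‿cong }
  ; comm = λ x y → pointwise λ k → ℚ.+-comm (seq x k) (seq y k) }

ℝ-isCommutativeRing : IsCommutativeRing _≃_ _+_ _*_ (λ x → - x) 0ℝ 1ℝ
ℝ-isCommutativeRing = record
  { isRing = record
    { +-isAbelianGroup = ℝ-isAbelianGroup
    ; *-cong = *-cong
    ; *-assoc = λ x y z → pointwise λ k → ℚ.*-assoc (seq x k) (seq y k) (seq z k)
    ; *-identity = (λ x → pointwise λ k → ℚ.*-identityˡ (seq x k))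
                 , (λ x → pointwise λ k → ℚ.*-identityʳ (seq x k))
    ; distrib = (λ x y z → pointwise λ k → ℚ.*-distribˡ-+ (seq x k) (seq y k) (seq z k))
              , (λ x y z → pointwise λ k → ℚ.*-distribʳ-+ (seq x k) (seq y k) (seq z k)) }
  ; *-comm = *-comm }

ℝ-commutativeRing : CommutativeRing 0ℓ 0ℓ
ℝ-commutativeRing = record { isCommutativeRing = ℝ-isCommutativeRing }

module ℝ-Ring = CommutativeRing ℝ-commutativeRing

fromℤ-+ : ∀ a b → fromℤ (a ℤ.+ b) ≃ fromℤ a + fromℤ b
fromℤ-+ a b = pointwise λ _ → /1-+ a b

fromℤ-* : ∀ a b → fromℤ (a ℤ.* b) ≃ fromℤ a * fromℤ b
fromℤ-* a b = pointwise λ _ → /1-* a b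

-- Wrapped for the same reason as `_≃_`: `0ℝ ≤ x` unfolds to a statement about terms, from which `x`
-- is not inferred.
record NonNeg (x : ℝ) : Set where
  constructor wrap
  field unwrap : 0ℝ ≤ x

abstract
  -- Tolerance ½ is enough for an integer: a negative a would give 0 ≤ a + ½ < a + 1 ≤ 0. Here
  -- approximate real inequalities turn into exact integer ones.
  NonNeg-fromℤ⁻ : ∀ {a} → NonNeg (fromℤ a) → + 0 ℤ.≤ a
  NonNeg-fromℤ⁻ {a} (wrap h) = ℤ.≮⇒≥ λ a<0 →
    let _ , 0≤a+½ = Eventually⇒∃ (h ½ (ℚ.positive⁻¹ ½))
        open ℚ.≤-Reasoning
    in ℚ.<-irrefl {0ℚ} refl (begin-strict
      0ℚ                      ≤⟨ 0≤a+½ ⟩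
      a ℚ./ 1 ℚ.+ ½           <⟨ ℚ.+-monoʳ-< (a ℚ./ 1) (ℚ.*<* (ℤ.+<+ (ℕ.s≤s (ℕ.s≤s ℕ.z≤n)))) ⟩
      a ℚ./ 1 ℚ.+ (+ 1) ℚ./ 1 ≡⟨ /1-+ a (+ 1) ⟨
      (a ℤ.+ + 1) ℚ./ 1       ≤⟨ /1-mono-≤ (subst (ℤ._≤ + 0) (ℤ.+-comm (+ 1) a) (ℤ.i<j⇒suc[i]≤j a<0)) ⟩
      0ℚ                      ∎)

  NonNeg-resp-≃ : ∀ {x y} → x ≃ y → NonNeg x → NonNeg y
  NonNeg-resp-≃ {x} {y} (wrap x≈y) (wrap 0≤x) .NonNeg.unwrap ε 0<ε = Eventually-zip
    (λ n h h′ → let open ℚ.≤-Reasoning in begin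
      0ℚ                                                     ≤⟨ +-nonNeg (0≤p-q h) h′ ⟩
      (½ ℚ.* ε ℚ.- ℚ.∣ seq x n ℚ.- seq y n ∣) ℚ.+ (seq x n ℚ.+ ½ ℚ.* ε)
        ≤⟨ ℚ.+-monoˡ-≤ _ (ℚ.+-monoʳ-≤ (½ ℚ.* ε) (ℚ.neg-antimono-≤ (p≤∣p∣ _))) ⟩
      (½ ℚ.* ε ℚ.- (seq x n ℚ.- seq y n)) ℚ.+ (seq x n ℚ.+ ½ ℚ.* ε)
        ≡⟨ solve 3 (λ x y ε → (con ½ :* ε :- (x :- y)) :+ (x :+ con ½ :* ε) := y :+ ε) refl (seq x n) (seq y n) ε ⟩
      seq y n ℚ.+ ε                                          ∎)
    (x≈y _ (0<½ 0<ε)) (0≤x _ (0<½ 0<ε))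
    where open +-*-Solver

  NonNeg-+ : ∀ {x y} → NonNeg x → NonNeg y → NonNeg (x + y)
  NonNeg-+ {x} {y} (wrap 0≤x) (wrap 0≤y) .NonNeg.unwrap ε 0<ε = Eventually-zip
    (λ n h h′ → ℚ.≤-trans (+-nonNeg h h′) (ℚ.≤-reflexive
      (solve 3 (λ x y ε → (x :+ con ½ :* ε) :+ (y :+ con ½ :* ε) := (x :+ y) :+ ε) refl
        (seq x n) (seq y n) ε)))
    (0≤x _ (0<½ 0<ε)) (0≤y _ (0<½ 0<ε))
    where open +-*-Solver

  NonNeg-*fromℚ : ∀ {x q} → NonNeg x → 0ℚ ℚ.≤ q → NonNeg (x * fromℚ q)
  NonNeg-*fromℚ {x} {q} (wrap 0≤x) 0≤q .NonNeg.unwrap ε 0<ε =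
    -- The error δ of the factor x grows to q δ. The extra 1 keeps the divisor positive when q is 0.
    let δ , 0<δ , [1+q]δ≡ε = ∃-divisor 0<ε (ℚ.+-mono-<-≤ (ℚ.positive⁻¹ 1ℚ) 0≤q)
    in Eventually-map (λ n h → let open ℚ.≤-Reasoning in begin
      0ℚ                                   ≤⟨ +-nonNeg (*-nonNeg h 0≤q) (ℚ.<⇒≤ 0<δ) ⟩
      (seq x n ℚ.+ δ) ℚ.* q ℚ.+ δ          ≡⟨ solve 3 (λ x q δ → (x :+ δ) :* q :+ δ := x :* q :+ (con 1ℚ :+ q) :* δ) refl (seq x n) q δ ⟩
      seq x n ℚ.* q ℚ.+ (1ℚ ℚ.+ q) ℚ.* δ   ≡⟨ cong (seq x n ℚ.* q ℚ.+_) [1+q]δ≡ε ⟩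
      seq x n ℚ.* q ℚ.+ ε                  ∎)
    (0≤x δ 0<δ)
    where open +-*-Solver

NonNeg-fromℚ : ∀ {q} → 0ℚ ℚ.≤ q → NonNeg (fromℚ q)
NonNeg-fromℚ {q} 0≤q .NonNeg.unwrap ε 0<ε = always λ _ → +-nonNeg 0≤q (ℚ.<⇒≤ 0<ε)

NonNeg-∑ : ∀ {m} (x : Vector ℝ m) → (∀ j → NonNeg (x j)) → NonNeg (∑ x)
NonNeg-∑ {zero}  x 0≤x = NonNeg-fromℚ ℚ.≤-refl
NonNeg-∑ {suc m} x 0≤x = NonNeg-+ (0≤x zero) (NonNeg-∑ (λ j → x (suc j)) (λ j → 0≤x (suc j)))

fromℤ-injective : ∀ {a b} → fromℤ a ≃ fromℤ b → a ≡ b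
fromℤ-injective {a} {b} a≃b = ℤ.≤-antisym (half a≃b) (half (≃-sym a≃b))
  where
  half : ∀ {a b} → fromℤ a ≃ fromℤ b → a ℤ.≤ b
  half {a} {b} a≃b = ℤ.0≤i-j⇒j≤i (NonNeg-fromℤ⁻ (NonNeg-resp-≃ eq (NonNeg-fromℚ ℚ.≤-refl)))
    where
    open import Relation.Binary.Reasoning.Setoid ℝ-Ring.setoid
    eq : 0ℝ ≃ fromℤ (b ℤ.- a)
    eq = begin
      0ℝ                           ≡⟨ cong fromℤ (ℤ.+-inverseʳ a) ⟨
      fromℤ (a ℤ.- a)              ≈⟨ fromℤ-+ a (ℤ.- a) ⟩
      fromℤ a + fromℤ (ℤ.- a)      ≈⟨ +-cong a≃b (pointwise λ _ → refl) ⟩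
      fromℤ b + fromℤ (ℤ.- a)      ≈⟨ fromℤ-+ b (ℤ.- a) ⟨
      fromℤ (b ℤ.- a)              ∎

-- Barycentric coordinates

module ℤ-Collect = Collect ℤ.+-*-semiring
module ℝ-Collect = Collect ℝ-Ring.semiring
module Σℤ = Sum ℤ.+-*-semiring
module Σℝ = Sum ℝ-Ring.semiring

fromℤ-sum : ∀ {k} (b : Vector ℤ k) → fromℤ (Σℤ.sum b) ≃ ∑ (λ i → fromℤ (b i))
fromℤ-sum {zero}  b = pointwise λ _ → refl
fromℤ-sum {suc k} b = ≃-trans (fromℤ-+ (b zero) (Σℤ.sum (b ∘ suc)))
  (ℝ-Ring.+-congˡ (fromℤ-sum (b ∘ suc)))

∑-- : ∀ {k} (x y : Vector ℝ k) → ∑ (λ i → x i - y i) ≃ ∑ x - ∑ y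
∑-- {zero}  x y = pointwise λ _ → refl
∑-- {suc k} x y = ≃-trans (ℝ-Ring.+-congˡ (∑-- (x ∘ suc) (y ∘ suc)))
  (pointwise λ n → solve 4 (λ a b c d → (a :- b) :+ (c :- d) := (a :+ c) :- (b :+ d)) refl
    (seq (x zero) n) (seq (y zero) n) (seq (∑ (x ∘ suc)) n) (seq (∑ (y ∘ suc)) n))
  where open +-*-Solver

≃⇒-≃0 : ∀ {x y} → x ≃ y → x - y ≃ 0ℝ
≃⇒-≃0 {x} {y} x≃y = ≃-trans (ℝ-Ring.+-congʳ x≃y) (ℝ-Ring.-‿inverseʳ y)

-≃0⇒≃ : ∀ {x y} → x - y ≃ 0ℝ → x ≃ y
-≃0⇒≃ {x} {y} h = ≃-trans
  (pointwise λ n → solve 2 (λ x y → x := (x :- y) :+ y) refl (seq x n) (seq y n))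
  (≃-trans (ℝ-Ring.+-congʳ h) (ℝ-Ring.+-identityˡ y))
  where open +-*-Solver

module _ {k n} {v : Vector (Vector ℝ n) k} (indep : AffinelyIndependent v) where

  -- The difference of the two coordinate vectors is an affine dependence of total 0.
  affine-coordinates-unique : (c c′ : Vector ℝ k) → ∑ c ≃ ∑ c′ →
    (∀ s → combination c v s ≃ combination c′ v s) → ∀ i → c i ≃ c′ i
  affine-coordinates-unique c c′ ∑c≃∑c′ cv≃c′v i = -≃0⇒≃ (wrap (indep (λ j → c j - c′ j)
    (unwrap (≃-trans (∑-- c c′) (≃⇒-≃0 ∑c≃∑c′)))
    (λ s → unwrap (≃-trans (Σℝ.sum-cong-≋ (λ j → distrib (c j) (c′ j) (v j s)))
      (≃-trans (∑-- (λ j → c j * v j s) (λ j → c′ j * v j s)) (≃⇒-≃0 (cv≃c′v s)))))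
    i))
    where
    open +-*-Solver
    distrib : ∀ x y z → (x - y) * z ≃ x * z - y * z
    distrib x y z = pointwise λ n →
      solve 3 (λ x y z → (x :- y) :* z := x :* z :- y :* z) refl (seq x n) (seq y n) (seq z n)

combinationℤ : ∀ {k n} → Vector ℤ k → Vec (Vec ℤ n) k → Fin n → ℤ
combinationℤ b σ s = Σℤ.sum (λ i → b i ℤ.* Vec.lookup (Vec.lookup σ i) s)

vertices : ∀ {k n} → Vec (Vec ℤ n) k → Vector (Vector ℝ n) k
vertices σ i = ι (Vec.lookup σ i)

fromℤ-combination : ∀ {k n} (b : Vector ℤ k) (σ : Vec (Vec ℤ n) k) s →
  fromℤ (combinationℤ b σ s) ≃ combination (fromℤ ∘ b) (vertices σ) s
fromℤ-combination b σ s = ≃-trans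
  (fromℤ-sum (λ i → b i ℤ.* Vec.lookup (Vec.lookup σ i) s))
  (Σℝ.sum-cong-≋ (λ i → fromℤ-* (b i) (Vec.lookup (Vec.lookup σ i) s)))

fromℤ-cong : ∀ {a b} → a ≡ b → fromℤ a ≃ fromℤ b
fromℤ-cong refl = pointwise λ _ → refl

index : ∀ {A : Set} {k} {σ : Vec A k} {v} → v ∈ Vec.toList σ → ∃ λ i → Vec.lookup σ i ≡ v
index v∈σ = let v∈ = VecMembership.∈-toList⁻ v∈σ in VecAny.index v∈ , ≡.sym (VecAny.lookup-index v∈)

record Barycentric {k n} (vs : List (Vec ℤ n)) (σ : Vec (Vec ℤ n) k) (x : Vector ℝ n) : Set where
  field
    coordinates : Vector ℝ k
    nonNeg      : ∀ i → NonNeg (coordinates i)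
    total       : ∑ coordinates ≃ 1ℝ
    represents  : ∀ s → x s ≃ combination coordinates (vertices σ) s
    support     : ∀ i → Vec.lookup σ i ∉ vs → coordinates i ≃ 0ℝ

-- Each listed point is replaced by its position in σ and the weights are collected. No listed point
-- is sent to a vertex outside `vs`, which gives `support`: this is how a face is recognised inside
-- a simplex.
barycentric : ∀ {k n} {vs : List (Vec ℤ n)} {σ : Vec (Vec ℤ n) k} {x} →
              vs ⊆ Vec.toList σ → conv vs x → Barycentric vs σ x
barycentric {k} {n} {vs} {σ} {x} vs⊆σ (m , y , μ , y∈vs , 0≤μ , ∑μ≈1 , x≋) = record
  { coordinates = collect ix μ
  ; nonNeg      = λ i → NonNeg-∑ (λ j → μ j * δ (ix j) i) (λ j → NonNeg-*δ (ix j) i (wrap (0≤μ j)))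
  ; total       = ≃-trans (sum-collect ix μ) (wrap ∑μ≈1)
  ; represents  = λ s → begin
      x s                                               ≈⟨ wrap (x≋ s) ⟩
      ∑ (λ j → μ j * y j s)                             ≈⟨ Σℝ.sum-cong-≋ (λ j → *-congˡ (y≃ j s)) ⟩
      ∑ (λ j → μ j * vertices σ (ix j) s)               ≈⟨ sum-collect-* ix μ (λ i → vertices σ i s) ⟨
      combination (collect ix μ) (vertices σ) s         ∎
  ; support     = λ i σᵢ∉vs → ≃-trans
      (Σℝ.sum-cong-≋ (λ j → ≃-trans (ℝ-Ring.*-congˡ {μ j}
          (ℝ-Ring.reflexive (δ-off-diagonal (λ eq → σᵢ∉vs (subst (_∈ vs)
            (≡.trans (≡.sym (lookup-ix j)) (cong (Vec.lookup σ) eq)) (z∈vs j))))))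
        (ℝ-Ring.zeroʳ (μ j))))
      (Σℝ.sum-replicate-zero m) }
  where
  open ℝ-Collect
  open SetoidReasoning ℝ-Ring.setoid
  z : Fin m → Vec ℤ n
  z j = proj₁ (y∈vs j)
  z∈vs : ∀ j → z j ∈ vs
  z∈vs j = proj₁ (proj₂ (y∈vs j))
  ix : Fin m → Fin k
  ix j = proj₁ (index {σ = σ} (vs⊆σ (z∈vs j)))
  lookup-ix : ∀ j → Vec.lookup σ (ix j) ≡ z j
  lookup-ix j = proj₂ (index {σ = σ} (vs⊆σ (z∈vs j)))
  y≃ : ∀ j s → y j s ≃ vertices σ (ix j) s
  y≃ j s = ≃-trans (wrap (proj₂ (proj₂ (y∈vs j)) s)) (fromℤ-cong (cong (λ u → Vec.lookup u s) (≡.sym (lookup-ix j))))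
  NonNeg-*δ : ∀ {μ} i j → NonNeg μ → NonNeg (μ * δ {k} i j)
  NonNeg-*δ i j 0≤μ with i Fin.≟ j
  ... | yes _ = NonNeg-*fromℚ 0≤μ (ℚ.nonNegative⁻¹ 1ℚ)
  ... | no  _ = NonNeg-*fromℚ 0≤μ ℚ.≤-refl

-- Integral barycentric coordinates in unimodular simplices

0⊞0 : ∀ {d} → 𝟎 {d} ⊞ 𝟎 ≡ 𝟎
0⊞0 {zero}  = refl
0⊞0 {suc d} = cong (+ 0 ∷_) 0⊞0

0⊞x : ∀ {d} (x : Vec ℤ d) → 𝟎 ⊞ x ≡ x
0⊞x []      = refl
0⊞x (a ∷ x) = cong₂ _∷_ (ℤ.+-identityˡ a) (0⊞x x)

x⊟0 : ∀ {d} (x : Vec ℤ d) → x ⊟ 𝟎 ≡ x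
x⊟0 []      = refl
x⊟0 (a ∷ x) = cong₂ _∷_ (ℤ.+-identityʳ a) (x⊟0 x)

module _ (f : ℤ → ℤ) (f-+ : ∀ a b → f (a ℤ.+ b) ≡ f a ℤ.+ f b) where
  private
    f-pos : ∀ n → f (+ n) ≡ + n ℤ.* f (+ 1)
    f-pos zero    = x+x≈x⇒x≈0 _ (≡.sym (f-+ (+ 0) (+ 0)))
    f-pos (suc n) = ≡.trans (f-+ (+ 1) (+ n))
      (≡.trans (cong (λ x → f (+ 1) ℤ.+ x) (f-pos n)) (≡.sym (ℤ.suc-* (+ n) (f (+ 1)))))

  additive-ℤ : ∀ a → f a ≡ a ℤ.* f (+ 1)
  additive-ℤ (+ n)     = f-pos n
  additive-ℤ -[1+ n ] = +-cancelˡ (f (+ suc n)) (f -[1+ n ]) (-[1+ n ] ℤ.* f (+ 1)) (≡.trans (≡.sym (f-+ (+ suc n) -[1+ n ]))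
    (≡.trans (cong f (ℤ.+-inverseʳ (+ suc n))) (≡.trans (f-pos 0)
    (≡.trans (cong (ℤ._* f (+ 1)) (≡.sym (ℤ.+-inverseʳ (+ suc n))))
    (≡.trans (ℤ.*-distribʳ-+ (f (+ 1)) (+ suc n) -[1+ n ])
      (cong (λ x → x ℤ.+ -[1+ n ] ℤ.* f (+ 1)) (≡.sym (f-pos (suc n)))))))))

additive-expansion : ∀ {d} (g : Vec ℤ d → ℤ) → (∀ x y → g (x ⊞ y) ≡ g x ℤ.+ g y) →
                     ∀ t → g t ≡ Σℤ.sum (λ i → Vec.lookup t i ℤ.* g (𝐞 i))
additive-expansion {zero}  g g-+ []      = x+x≈x⇒x≈0 _ (≡.sym (g-+ [] []))
additive-expansion {suc d} g g-+ (a ∷ t) = begin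
  g (a ∷ t)
    ≡⟨ cong₂ (λ b u → g (b ∷ u)) (≡.sym (ℤ.+-identityʳ a)) (≡.sym (0⊞x t)) ⟩
  g ((a ∷ 𝟎) ⊞ (+ 0 ∷ t))
    ≡⟨ g-+ (a ∷ 𝟎) (+ 0 ∷ t) ⟩
  g (a ∷ 𝟎) ℤ.+ g (+ 0 ∷ t)
    ≡⟨ cong₂ ℤ._+_
         (additive-ℤ (λ b → g (b ∷ 𝟎)) (λ b c → ≡.trans (cong (λ u → g (b ℤ.+ c ∷ u)) (≡.sym 0⊞0)) (g-+ (b ∷ 𝟎) (c ∷ 𝟎))) a)
         (additive-expansion (λ u → g (+ 0 ∷ u)) (λ x y → g-+ (+ 0 ∷ x) (+ 0 ∷ y)) t) ⟩
  a ℤ.* g (𝐞 zero) ℤ.+ Σℤ.sum (λ i → Vec.lookup t i ℤ.* g (𝐞 (suc i))) ∎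
  where open ≡.≡-Reasoning

lookup-⊞ : ∀ {n} (u v : Vec ℤ n) s → Vec.lookup (u ⊞ v) s ≡ Vec.lookup u s ℤ.+ Vec.lookup v s
lookup-⊞ u v s = Vec.lookup-zipWith ℤ._+_ s u v

lookup-⊟ : ∀ {n} (u v : Vec ℤ n) s → Vec.lookup (u ⊟ v) s ≡ Vec.lookup u s ℤ.- Vec.lookup v s
lookup-⊟ u v s = Vec.lookup-zipWith ℤ._-_ s u v

-- Write w as φ t. Since φ is affine, w is the combination of φ 0 and the φ (𝐞 i) with weights 1 - Σ
-- t and t i, and these images are the vertices of σ up to order, which `ix` undoes. The argument in
-- `Fin k` excludes k = 0, where `Unimodular` carries no information.
integral-coordinates : ∀ {k n} {Λ : Pred (Vec ℤ n) 0ℓ} {σ : Vec (Vec ℤ n) k} → Fin k → Unimodular Λ σ →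
  ∀ w → Λ w → ∃ λ b → Σℤ.sum b ≡ + 1 × (∀ s → combinationℤ b σ s ≡ Vec.lookup w s)
integral-coordinates {suc d} {n} {Λ} {σ} _ E w Λw =
  collect ix t′ , ≡.trans (sum-collect ix t′) total , λ s → begin
    combinationℤ (collect ix t′) σ s
      ≡⟨ sum-collect-* ix t′ (λ i → Vec.lookup (Vec.lookup σ i) s) ⟩
    Σℤ.sum (λ j → t′ j ℤ.* Vec.lookup (Vec.lookup σ (ix j)) s)
      ≡⟨ Σℤ.sum-cong-≗ (λ j → cong (λ u → t′ j ℤ.* Vec.lookup u s) (lookup-ix j)) ⟩
    (+ 1 ℤ.- S) ℤ.* Φ s 𝟎 ℤ.+ Σℤ.sum (λ i → T i ℤ.* Φ s (𝐞 i))
      ≡⟨ cong (λ x → (+ 1 ℤ.- S) ℤ.* Φ s 𝟎 ℤ.+ x) (expand s) ⟩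
    (+ 1 ℤ.- S) ℤ.* Φ s 𝟎 ℤ.+ (S ℤ.* Φ s 𝟎 ℤ.+ (Φ s t ℤ.- Φ s 𝟎))
      ≡⟨ solve 3 (λ S a b → (con (+ 1) :- S) :* a :+ (S :* a :+ (b :- a)) := b) refl S (Φ s 𝟎) (Φ s t) ⟩
    Φ s t
      ≡⟨ cong (λ u → Vec.lookup u s) φt≡w ⟩
    Vec.lookup w s ∎
  where
  open ≡.≡-Reasoning
  open ℤ-Collect
  open ℤ-Solver.+-*-Solver
  open StandardLatticeEquivalence E renaming (vertices to φ-vertices)
  t : Vec ℤ d
  t = proj₁ (surjective w Λw)
  φt≡w : φ t ≡ w
  φt≡w = proj₂ (surjective w Λw)
  T : Vector ℤ d
  T = Vec.lookup t
  S : ℤ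
  S = Σℤ.sum T
  t′ : Vector ℤ (suc d)
  t′ zero    = + 1 ℤ.- S
  t′ (suc i) = T i
  V : Fin (suc d) → Vec ℤ d
  V zero    = 𝟎
  V (suc i) = 𝐞 i
  V∈ : ∀ j → V j ∈ Vec.toList (standardSimplex d)
  V∈ zero    = here refl
  V∈ (suc i) = there (VecMembership.∈-toList⁺ (VecMembership.∈-tabulate⁺ 𝐞 i))
  ix : Fin (suc d) → Fin (suc d)
  ix j = proj₁ (index {σ = σ} (∈-resp-↭ φ-vertices (∈-map⁺ φ (V∈ j))))
  lookup-ix : ∀ j → Vec.lookup σ (ix j) ≡ φ (V j)
  lookup-ix j = proj₂ (index {σ = σ} (∈-resp-↭ φ-vertices (∈-map⁺ φ (V∈ j))))
  Φ : Fin n → Vec ℤ d → ℤ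
  Φ s x = Vec.lookup (φ x) s
  total : Σℤ.sum t′ ≡ + 1
  total = solve 1 (λ S → (con (+ 1) :- S) :+ S := con (+ 1)) refl S
  -- The linear part of φ in coordinate s; being additive, it is determined by its values on the
  -- unit vectors.
  L : Fin n → Vec ℤ d → ℤ
  L s x = Φ s x ℤ.- Φ s 𝟎
  Φ-⊞ : ∀ s x y → Φ s (x ⊞ y) ≡ (Φ s x ℤ.+ Φ s y) ℤ.- Φ s 𝟎
  Φ-⊞ s x y = begin
    Φ s (x ⊞ y)                             ≡⟨ cong (Φ s) (≡.sym (x⊟0 (x ⊞ y))) ⟩
    Φ s (x ⊞ y ⊟ 𝟎)                         ≡⟨ cong (λ u → Vec.lookup u s) (affine x y 𝟎) ⟩
    Vec.lookup (φ x ⊞ φ y ⊟ φ 𝟎) s          ≡⟨ lookup-⊟ (φ x ⊞ φ y) (φ 𝟎) s ⟩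
    Vec.lookup (φ x ⊞ φ y) s ℤ.- Φ s 𝟎      ≡⟨ cong (ℤ._- Φ s 𝟎) (lookup-⊞ (φ x) (φ y) s) ⟩
    (Φ s x ℤ.+ Φ s y) ℤ.- Φ s 𝟎             ∎
  L-⊞ : ∀ s x y → L s (x ⊞ y) ≡ L s x ℤ.+ L s y
  L-⊞ s x y = ≡.trans (cong (ℤ._- Φ s 𝟎) (Φ-⊞ s x y))
    (solve 3 (λ a b c → ((a :+ b) :- c) :- c := (a :- c) :+ (b :- c)) refl (Φ s x) (Φ s y) (Φ s 𝟎))
  expand : ∀ s → Σℤ.sum (λ i → T i ℤ.* Φ s (𝐞 i)) ≡ S ℤ.* Φ s 𝟎 ℤ.+ (Φ s t ℤ.- Φ s 𝟎)
  expand s = begin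
    Σℤ.sum (λ i → T i ℤ.* Φ s (𝐞 i))
      ≡⟨ Σℤ.sum-cong-≗ (λ i → solve 3 (λ x a b → x :* a := x :* b :+ x :* (a :- b)) refl (T i) (Φ s (𝐞 i)) (Φ s 𝟎)) ⟩
    Σℤ.sum (λ i → T i ℤ.* Φ s 𝟎 ℤ.+ T i ℤ.* L s (𝐞 i))
      ≡⟨ Σℤ.∑-distrib-+ (λ i → T i ℤ.* Φ s 𝟎) (λ i → T i ℤ.* L s (𝐞 i)) ⟩
    Σℤ.sum (λ i → T i ℤ.* Φ s 𝟎) ℤ.+ Σℤ.sum (λ i → T i ℤ.* L s (𝐞 i))
      ≡⟨ cong₂ ℤ._+_ (≡.sym (Σℤ.*-distribʳ-sum (Φ s 𝟎) T)) (≡.sym (additive-expansion (L s) (L-⊞ s) t)) ⟩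
    S ℤ.* Φ s 𝟎 ℤ.+ L s t ∎

-- Pairs of vertices and the coordinates of their sums

∈-pairs⁻ : ∀ {A : Set} {k} (σ : Vec A k) {u v} → (u , v) ∈ pairs (Vec.toList σ) →
           ∃₂ λ i j → i ≢ j × Vec.lookup σ i ≡ u × Vec.lookup σ j ≡ v
∈-pairs⁻ (x ∷ σ) uv∈ with ∈-++⁻ (List.map (x ,_) (Vec.toList σ)) uv∈
... | inj₁ uv∈map with ∈-map⁻ (x ,_) uv∈map
...   | v , v∈σ , refl with index {σ = σ} v∈σ
...     | j , eq = zero , suc j , (λ ()) , refl , eq
∈-pairs⁻ (x ∷ σ) uv∈ | inj₂ uv∈pairs with ∈-pairs⁻ σ uv∈pairs
...   | i , j , i≢j , eq , eq′ = suc i , suc j , i≢j ∘ Fin.suc-injective , eq , eq′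

∈-pairs⁺ : ∀ {A : Set} {k} (σ : Vec A k) {i j} → i ≢ j →
  (Vec.lookup σ i , Vec.lookup σ j) ∈ pairs (Vec.toList σ) ⊎
  (Vec.lookup σ j , Vec.lookup σ i) ∈ pairs (Vec.toList σ)
∈-pairs⁺ (x ∷ σ) {zero}  {zero}  i≢j = contradiction refl i≢j
∈-pairs⁺ (x ∷ σ) {zero}  {suc j} i≢j =
  inj₁ (∈-++⁺ˡ (∈-map⁺ (x ,_) (VecMembership.∈-toList⁺ (VecMembership.∈-lookup j σ))))
∈-pairs⁺ (x ∷ σ) {suc i} {zero}  i≢j =
  inj₂ (∈-++⁺ˡ (∈-map⁺ (x ,_) (VecMembership.∈-toList⁺ (VecMembership.∈-lookup i σ))))
∈-pairs⁺ (x ∷ σ) {suc i} {suc j} i≢j with ∈-pairs⁺ σ (i≢j ∘ cong suc)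
... | inj₁ ∈pairs = inj₁ (∈-++⁺ʳ (List.map (x ,_) (Vec.toList σ)) ∈pairs)
... | inj₂ ∈pairs = inj₂ (∈-++⁺ʳ (List.map (x ,_) (Vec.toList σ)) ∈pairs)

open ℤ-Collect using (δ; δ-diagonal; δ-off-diagonal; sum-δ; sum-*1)

infixl 6 _⊕_
_⊕_ : ∀ {k} → Vector ℤ k → Vector ℤ k → Vector ℤ k
(b ⊕ c) i = b i ℤ.+ c i

sum-⊕ : ∀ {k} (b c : Vector ℤ k) → Σℤ.sum (b ⊕ c) ≡ Σℤ.sum b ℤ.+ Σℤ.sum c
sum-⊕ b c = Σℤ.∑-distrib-+ b c

combinationℤ-⊕ : ∀ {k n} (b c : Vector ℤ k) (σ : Vec (Vec ℤ n) k) s →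
  combinationℤ (b ⊕ c) σ s ≡ combinationℤ b σ s ℤ.+ combinationℤ c σ s
combinationℤ-⊕ b c σ s = ≡.trans
  (Σℤ.sum-cong-≗ (λ i → ℤ.*-distribʳ-+ (Vec.lookup (Vec.lookup σ i) s) (b i) (c i)))
  (Σℤ.∑-distrib-+ (λ i → b i ℤ.* Vec.lookup (Vec.lookup σ i) s) (λ i → c i ℤ.* Vec.lookup (Vec.lookup σ i) s))

sum-δ-1 : ∀ {k} (i : Fin k) → Σℤ.sum (δ i) ≡ + 1
sum-δ-1 i = ≡.trans (≡.sym (sum-*1 (δ i))) (sum-δ i (λ _ → + 1))

combinationℤ-δ : ∀ {k n} i (σ : Vec (Vec ℤ n) k) s → combinationℤ (δ i) σ s ≡ Vec.lookup (Vec.lookup σ i) s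
combinationℤ-δ i σ s = sum-δ i (λ j → Vec.lookup (Vec.lookup σ j) s)

sum-δ⊕δ : ∀ {k} (i j : Fin k) → Σℤ.sum (δ i ⊕ δ j) ≡ + 2
sum-δ⊕δ i j = ≡.trans (sum-⊕ (δ i) (δ j)) (cong₂ ℤ._+_ (sum-δ-1 i) (sum-δ-1 j))

combinationℤ-δ⊕δ : ∀ {k n} i j (σ : Vec (Vec ℤ n) k) s →
  combinationℤ (δ i ⊕ δ j) σ s ≡ Vec.lookup (Vec.lookup σ i ⊞ Vec.lookup σ j) s
combinationℤ-δ⊕δ i j σ s = ≡.trans (combinationℤ-⊕ (δ i) (δ j) σ s)
  (≡.trans (cong₂ ℤ._+_ (combinationℤ-δ i σ s) (combinationℤ-δ j σ s))
    (≡.sym (lookup-⊞ (Vec.lookup σ i) (Vec.lookup σ j) s)))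

δ-cases : ∀ {k} (i j : Fin k) → (i ≡ j × δ i j ≡ + 1) ⊎ (i ≢ j × δ i j ≡ + 0)
δ-cases i j with i Fin.≟ j
... | yes i≡j = inj₁ (i≡j , refl)
... | no  i≢j = inj₂ (i≢j , refl)

δ⊕δ≢0 : ∀ {k} (i j : Fin k) → (δ i ⊕ δ j) i ≢ + 0
δ⊕δ≢0 i j eq with δ-cases j i
... | inj₁ (_ , eq′) = contradiction (≡.trans (≡.sym (cong₂ ℤ._+_ (δ-diagonal i) eq′)) eq) λ ()
... | inj₂ (_ , eq′) = contradiction (≡.trans (≡.sym (cong₂ ℤ._+_ (δ-diagonal i) eq′)) eq) λ ()

δ⊕δ-support : ∀ {k} {i j l : Fin k} → (δ i ⊕ δ j) l ≢ + 0 → i ≡ l ⊎ j ≡ l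
δ⊕δ-support {i = i} {j} {l} ≢0 with δ-cases i l | δ-cases j l
... | inj₁ (i≡l , _) | _                = inj₁ i≡l
... | inj₂ _         | inj₁ (j≡l , _)   = inj₂ j≡l
... | inj₂ (_ , eq)  | inj₂ (_ , eq′)   = contradiction (cong₂ ℤ._+_ eq eq′) ≢0

module _ {k n} {σ : Vec (Vec ℤ n) k} (indep : AffinelyIndependent (vertices σ)) where

  integral-coordinates-unique : (b c : Vector ℤ k) → Σℤ.sum b ≡ Σℤ.sum c →
    (∀ s → combinationℤ b σ s ≡ combinationℤ c σ s) → ∀ i → b i ≡ c i
  integral-coordinates-unique b c Σb≡Σc bσ≡cσ i = fromℤ-injective
    (affine-coordinates-unique {v = vertices σ} indep (fromℤ ∘ b) (fromℤ ∘ c)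
      (≃-trans (≃-sym (fromℤ-sum b)) (≃-trans (fromℤ-cong Σb≡Σc) (fromℤ-sum c)))
      (λ s → ≃-trans (≃-sym (fromℤ-combination b σ s))
        (≃-trans (fromℤ-cong (bσ≡cσ s)) (fromℤ-combination c σ s)))
      i)

  -- Both 2c and b represent z = 2x with total 2, so affine independence identifies them. This
  -- transfers signs and zeros between the real coordinates of x and the integral ones of z.
  doubled-coordinates : (c : Vector ℝ k) (b : Vector ℤ k) (x : Vector ℝ n) (z : Vec ℤ n) →
    ∑ c ≃ 1ℝ → Σℤ.sum b ≡ + 2 →
    (∀ s → x s ≃ combination c (vertices σ) s) → (∀ s → combinationℤ b σ s ≡ Vec.lookup z s) →
    (∀ s → ι z s ≃ x s + x s) → ∀ i → c i + c i ≃ fromℤ (b i)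
  doubled-coordinates c b x z ∑c Σb x≃ bσ≡z z≃2x = affine-coordinates-unique {v = vertices σ} indep
    (λ i → c i + c i) (fromℤ ∘ b)
    (≃-trans (Σℝ.∑-distrib-+ c c) (≃-trans (+-cong ∑c ∑c)
      (≃-trans (≃-sym (fromℤ-+ (+ 1) (+ 1))) (≃-trans (fromℤ-cong (≡.sym Σb)) (fromℤ-sum b)))))
    (λ s → ≃-trans (Σℝ.sum-cong-≋ (λ i → ℝ-Ring.distribʳ (vertices σ i s) (c i) (c i)))
      (≃-trans (Σℝ.∑-distrib-+ (λ i → c i * vertices σ i s) (λ i → c i * vertices σ i s))
      (≃-trans (≃-sym (+-cong (x≃ s) (x≃ s)))
      (≃-trans (≃-sym (z≃2x s)) (≃-trans (fromℤ-cong (≡.sym (bσ≡z s))) (fromℤ-combination b σ s))))))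

∑ˡ : ∀ {A : Set} → (A → ℤ) → List A → ℤ
∑ˡ g = List.foldr (λ i x → g i ℤ.+ x) (+ 0)

∑ˡ-++ : ∀ {A : Set} (g : A → ℤ) is js → ∑ˡ g (is ++ js) ≡ ∑ˡ g is ℤ.+ ∑ˡ g js
∑ˡ-++ g []       js = ≡.sym (ℤ.+-identityˡ _)
∑ˡ-++ g (i ∷ is) js = ≡.trans (cong (λ x → g i ℤ.+ x) (∑ˡ-++ g is js)) (≡.sym (ℤ.+-assoc (g i) (∑ˡ g is) (∑ˡ g js)))

∑ˡ-map : ∀ {A B : Set} (g : B → ℤ) (f : A → B) is → ∑ˡ g (List.map f is) ≡ ∑ˡ (g ∘ f) is
∑ˡ-map g f []       = refl
∑ˡ-map g f (i ∷ is) = cong (λ x → g (f i) ℤ.+ x) (∑ˡ-map g f is)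

∑ˡ-replicate : ∀ {A : Set} (g : A → ℤ) m i → ∑ˡ g (List.replicate m i) ≡ + m ℤ.* g i
∑ˡ-replicate g zero    i = refl
∑ˡ-replicate g (suc m) i = ≡.trans (cong (λ x → g i ℤ.+ x) (∑ˡ-replicate g m i)) (≡.sym (ℤ.suc-* (+ m) (g i)))

-- The indices listed with multiplicity. One list serves every g, so the total weight and all
-- coordinates can be read off from it.
multiset : ∀ {k} (b : Vector ℕ k) → ∃ λ is → ∀ (g : Vector ℤ k) → Σℤ.sum (λ i → + b i ℤ.* g i) ≡ ∑ˡ g is
multiset {zero}  b = [] , λ g → refl
multiset {suc k} b with multiset (λ i → b (suc i))
... | is , eq = List.replicate (b zero) zero ++ List.map suc is , λ g → ≡.sym
  (≡.trans (∑ˡ-++ g (List.replicate (b zero) zero) (List.map suc is))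
    (cong₂ ℤ._+_ (∑ˡ-replicate g (b zero) zero)
      (≡.trans (∑ˡ-map g suc is) (≡.sym (eq (λ i → g (suc i)))))))

-- Taking g constantly 1 shows that the list from `multiset` has length 2. Its two entries may
-- coincide, which is the case of an even point.
two-points : ∀ {k} (b : Vector ℤ k) → (∀ i → + 0 ℤ.≤ b i) → Σℤ.sum b ≡ + 2 →
             ∃₂ λ i j → ∀ (g : Vector ℤ k) → Σℤ.sum (λ l → b l ℤ.* g l) ≡ g i ℤ.+ g j
two-points {k} b 0≤b Σb≡2 = go (proj₁ ms) expand
  (ℤ.+-injective (≡.trans (≡.sym (∑ˡ1 (proj₁ ms))) (≡.trans (≡.sym (expand (λ _ → + 1))) (≡.trans (sum-*1 b) Σb≡2))))
  where
  ms : ∃ λ is → ∀ (g : Vector ℤ k) → Σℤ.sum (λ i → + ℤ.∣ b i ∣ ℤ.* g i) ≡ ∑ˡ g is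
  ms = multiset (λ i → ℤ.∣ b i ∣)
  expand : ∀ g → Σℤ.sum (λ l → b l ℤ.* g l) ≡ ∑ˡ g (proj₁ ms)
  expand g = ≡.trans
    (Σℤ.sum-cong-≗ (λ l → cong (ℤ._* g l) (≡.sym (ℤ.0≤i⇒+∣i∣≡i (0≤b l))))) (proj₂ ms g)
  ∑ˡ1 : (is : List (Fin k)) → ∑ˡ (λ _ → + 1) is ≡ + length is
  ∑ˡ1 []       = refl
  ∑ˡ1 (_ ∷ is) = cong (λ x → + 1 ℤ.+ x) (∑ˡ1 is)
  go : ∀ is → (∀ g → Σℤ.sum (λ l → b l ℤ.* g l) ≡ ∑ˡ g is) → length is ≡ 2 →
       ∃₂ λ i j → ∀ (g : Vector ℤ k) → Σℤ.sum (λ l → b l ℤ.* g l) ≡ g i ℤ.+ g j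
  go (i ∷ j ∷ []) eq refl = i , j , λ g → ≡.trans (eq g) (cong (λ x → g i ℤ.+ x) (ℤ.+-identityʳ (g j)))

-- Edges of a unimodular triangulation

weights : ℚ → Vector ℝ 2
weights q zero    = fromℚ q
weights q (suc _) = fromℚ (1ℚ ℚ.- q)

endpoints : ∀ {n} → Vec ℤ n → Vec ℤ n → Vector (Vector ℝ n) 2
endpoints u v zero    = ι u
endpoints u v (suc _) = ι v

segment : ∀ {n} → ℚ → Vec ℤ n → Vec ℤ n → Vector ℝ n
segment q u v = combination (weights q) (endpoints u v)

segment∈Conv : ∀ {n} {A : Pred (Vec ℤ n) 0ℓ} {u v q} → A u → A v → 0ℚ ℚ.≤ q → q ℚ.≤ 1ℚ →
               ∀ {x} → (∀ s → x s ≃ segment q u v s) → Conv ⟦ A ⟧ x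
segment∈Conv {A = A} {u} {v} {q} Au Av 0≤q q≤1 x≃ =
  2 , endpoints u v , weights q ,
  (λ { zero → u , Au , λ s → ≃-refl {ι u s} .unwrap ; (suc _) → v , Av , λ s → ≃-refl {ι v s} .unwrap }) ,
  (λ { zero → NonNeg-fromℚ 0≤q .NonNeg.unwrap ; (suc _) → NonNeg-fromℚ (0≤p-q q≤1) .NonNeg.unwrap }) ,
  total .unwrap ,
  λ s → x≃ s .unwrap
  where
  open +-*-Solver
  ≃-refl : ∀ {x} → x ≃ x
  ≃-refl = pointwise λ _ → refl
  total : ∑ (weights q) ≃ 1ℝ
  total = pointwise λ _ → solve 1 (λ q → q :+ ((con 1ℚ :- q) :+ con 0ℚ) := con 1ℚ) refl q

vertex∈conv : ∀ {n} {vs : List (Vec ℤ n)} {v} → v ∈ vs → conv vs (ι v)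
vertex∈conv {v = v} v∈vs = segment∈Conv v∈vs v∈vs (ℚ.nonNegative⁻¹ 1ℚ) ℚ.≤-refl {ι v}
  (λ s → pointwise λ n → solve 1 (λ a → a := con 1ℚ :* a :+ ((con 1ℚ :- con 1ℚ) :* a :+ con 0ℚ)) refl (seq (ι v s) n))
  where open +-*-Solver

midpoint : ∀ {n} → Vec ℤ n → Vec ℤ n → Vector ℝ n
midpoint = segment ½

midpoint-doubled : ∀ {n} (u v : Vec ℤ n) s → ι (u ⊞ v) s ≃ midpoint u v s + midpoint u v s
midpoint-doubled u v s = ≃-trans (fromℤ-cong (lookup-⊞ u v s))
  (≃-trans (fromℤ-+ (Vec.lookup u s) (Vec.lookup v s)) (pointwise λ _ →
    solve 2 (λ a b → a :+ b := (con ½ :* a :+ ((con 1ℚ :- con ½) :* b :+ con 0ℚ))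
                               :+ (con ½ :* a :+ ((con 1ℚ :- con ½) :* b :+ con 0ℚ))) refl
      (Vec.lookup u s ℚ./ 1) (Vec.lookup v s ℚ./ 1)))
  where open +-*-Solver

½≤1 : ½ ℚ.≤ 1ℚ
½≤1 = ℚ.*≤* (ℤ.+≤+ (ℕ.s≤s ℕ.z≤n))

midpoint∈Conv : ∀ {n} {A : Pred (Vec ℤ n) 0ℓ} {u v} → A u → A v → Conv ⟦ A ⟧ (midpoint u v)
midpoint∈Conv {u = u} {v} Au Av = segment∈Conv Au Av (ℚ.nonNegative⁻¹ ½) ½≤1 {midpoint u v} (λ s → pointwise λ _ → refl)

double-injective : ∀ {x y} → x + x ≃ y + y → x ≃ y
double-injective {x} {y} 2x≃2y = ≃-trans (halve x) (≃-trans (ℝ-Ring.*-congˡ 2x≃2y) (≃-sym (halve y)))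
  where
  open +-*-Solver
  halve : ∀ x → x ≃ fromℚ ½ * (x + x)
  halve x = pointwise λ n → solve 1 (λ a → a := con ½ :* (a :+ a)) refl (seq x n)

-- A point in a simplex forces the simplex to have a vertex, which `integral-coordinates` asks for.
∑≃1⇒index : ∀ {k} (c : Vector ℝ k) → ∑ c ≃ 1ℝ → Fin k
∑≃1⇒index {zero}  c 0≃1 = contradiction (fromℤ-injective {+ 0} {+ 1} 0≃1) λ ()
∑≃1⇒index {suc k} c _   = zero

lookup-extensionality : ∀ {A : Set} {n} {u v : Vec A n} → (∀ s → Vec.lookup u s ≡ Vec.lookup v s) → u ≡ v
lookup-extensionality {u = u} {v} u≗v = ≡.trans (≡.sym (Vec.tabulate∘lookup u))
  (≡.trans (Vec.tabulate-cong u≗v) (Vec.tabulate∘lookup v))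

a+a≢1 : ∀ a → a ℤ.+ a ≢ + 1
a+a≢1 (+ suc a) eq with ≡.trans (≡.sym (ℕ.+-suc a a)) (ℕ.suc-injective (ℤ.+-injective eq))
... | ()

Doubled : ∀ {n} → Pred (Vector ℝ n) 0ℓ → Pred (Vec ℤ n) 0ℓ
Doubled P z = ∃ λ x → P x × (∀ s → ι z s ≃ x s + x s)

-- One odd coordinate is enough; this is no condition on every coordinate.
Odd : ∀ {n} → Pred (Vec ℤ n) 0ℓ
Odd z = ∀ w → z ≢ w ⊞ w

⊞-comm : ∀ {n} (u v : Vec ℤ n) → u ⊞ v ≡ v ⊞ u
⊞-comm = Vec.zipWith-comm ℤ.+-comm

SameEdge⇒≡sum : ∀ {n} {e f : Vec ℤ n × Vec ℤ n} → SameEdge e f → uncurry _⊞_ e ≡ uncurry _⊞_ f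
SameEdge⇒≡sum (inj₁ (refl , refl)) = refl
SameEdge⇒≡sum {e = u , v} (inj₂ (refl , refl)) = ⊞-comm u v

sameEdge-decSetoid : ℕ → DecSetoid 0ℓ 0ℓ
sameEdge-decSetoid n = record
  { Carrier = Vec ℤ n × Vec ℤ n
  ; _≈_ = SameEdge
  ; isDecEquivalence = record
    { isEquivalence = record
      { refl  = inj₁ (refl , refl)
      ; sym   = λ { (inj₁ (refl , refl)) → inj₁ (refl , refl)
                  ; (inj₂ (refl , refl)) → inj₂ (refl , refl) }
      ; trans = λ { (inj₁ (refl , refl)) e → e
                  ; (inj₂ (refl , refl)) (inj₁ (refl , refl)) → inj₂ (refl , refl)
                  ; (inj₂ (refl , refl)) (inj₂ (refl , refl)) → inj₁ (refl , refl) } }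
    ; _≟_ = sameEdge? } }

AllPairs-map-All : ∀ {A : Set} {Q : A → Set} {R S : A → A → Set} →
  (∀ {x y} → Q x → Q y → R x y → S x y) → ∀ {xs} → All Q xs → AllPairs R xs → AllPairs S xs
AllPairs-map-All f []        []          = []
AllPairs-map-All f (qx ∷ qs) (rx ∷ rs) =
  All.zipWith (λ { (qy , rxy) → f qx qy rxy }) (qs , rx) ∷ AllPairs-map-All f qs rs

module _ {n} {P : Pred (Vector ℝ n) 0ℓ} (T : UnimodularTriangulation P) where
  open UnimodularTriangulation T

  edgeSums : List (Vec ℤ n)
  edgeSums = List.map (uncurry _⊞_) (edges T)

  record IsEdge (u v : Vec ℤ n) : Set where
    field
      {simplex}  : Vec (Vec ℤ n) k
      simplex∈   : simplex ∈ simplices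
      {i j}      : Fin k
      i≢j        : i ≢ j
      ≡u         : Vec.lookup simplex i ≡ u
      ≡v         : Vec.lookup simplex j ≡ v

  ∈-edges⁻ : ∀ {u v} → (u , v) ∈ edges T → IsEdge u v
  ∈-edges⁻ uv∈ with find (∈-concatMap⁻ (λ σ → pairs (Vec.toList σ)) {xs = simplices} (∈-deduplicate⁻ sameEdge? _ uv∈))
  ... | σ , σ∈ , uv∈pairs with ∈-pairs⁻ σ uv∈pairs
  ... | i , j , i≢j , ≡u , ≡v = record { simplex∈ = σ∈ ; i≢j = i≢j ; ≡u = ≡u ; ≡v = ≡v }

  module _ {u v} (uv : IsEdge u v) where
    open IsEdge uv

    u∈simplex : u ∈ Vec.toList simplex
    u∈simplex = subst (_∈ Vec.toList simplex) ≡u (VecMembership.∈-toList⁺ (VecMembership.∈-lookup i simplex))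

    v∈simplex : v ∈ Vec.toList simplex
    v∈simplex = subst (_∈ Vec.toList simplex) ≡v (VecMembership.∈-toList⁺ (VecMembership.∈-lookup j simplex))

    combination≡sum : ∀ s → combinationℤ (δ i ⊕ δ j) simplex s ≡ Vec.lookup (u ⊞ v) s
    combination≡sum s = ≡.trans (combinationℤ-δ⊕δ i j simplex s)
      (cong₂ (λ a b → Vec.lookup (a ⊞ b) s) ≡u ≡v)

    midpoint∈P : P (midpoint u v)
    midpoint∈P = contained simplex∈ (midpoint∈Conv u∈simplex v∈simplex)

    -- If u + v were 2w, then w would be the midpoint of the edge, hence a lattice point of `Aff P`
    -- with integral coordinates b. Doubling gives b i + b i = 1 at the end i, which is impossible.
    edge-Odd : Odd (u ⊞ v)
    edge-Odd w u+v≡w+w = a+a≢1 (b i)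
      (≡.trans (integral-coordinates-unique {σ = simplex} (isSimplex simplex∈) (b ⊕ b) (δ i ⊕ δ j)
        (≡.trans (sum-⊕ b b) (≡.trans (cong₂ ℤ._+_ Σb≡1 Σb≡1) (≡.sym (sum-δ⊕δ i j))))
        (λ s → ≡.trans (combinationℤ-⊕ b b simplex s)
          (≡.trans (cong₂ ℤ._+_ (bσ≡w s) (bσ≡w s)) (≡.trans (≡.sym (lookup-⊞ w w s))
          (≡.trans (cong (λ z → Vec.lookup z s) (≡.sym u+v≡w+w)) (≡.sym (combination≡sum s))))))
        i)
      (cong₂ ℤ._+_ (δ-diagonal i) (δ-off-diagonal (i≢j ∘ ≡.sym))))
      where
      w∈Aff : Aff P (ι w)
      w∈Aff = 1 , (λ _ → midpoint u v) , (λ _ → 1ℝ) , (λ _ → midpoint∈P) ,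
        ℝ-Ring.+-identityʳ 1ℝ .unwrap ,
        λ s → ≃-trans
          (double-injective (≃-trans (≃-sym (fromℤ-+ (Vec.lookup w s) (Vec.lookup w s)))
            (≃-trans (fromℤ-cong (≡.trans (≡.sym (lookup-⊞ w w s)) (cong (λ z → Vec.lookup z s) (≡.sym u+v≡w+w))))
              (midpoint-doubled u v s))))
          (≃-sym (≃-trans (ℝ-Ring.+-identityʳ (1ℝ * midpoint u v s)) (ℝ-Ring.*-identityˡ (midpoint u v s)))) .unwrap
      coords = integral-coordinates i (unimodular simplex∈) w w∈Aff
      b = proj₁ coords
      Σb≡1 = proj₁ (proj₂ coords)
      bσ≡w = proj₂ (proj₂ coords)

  ∈-edgeSums⁻ : ∀ {z} → z ∈ edgeSums → Doubled P z × Odd z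
  ∈-edgeSums⁻ z∈ with ∈-map⁻ (uncurry _⊞_) z∈
  ... | (u , v) , uv∈ , refl = (midpoint u v , midpoint∈P uv , midpoint-doubled u v) , edge-Odd uv
    where uv = ∈-edges⁻ uv∈

  -- Equal sums mean a common midpoint, which lies in both simplices and so in their common face.
  -- The coordinates of u and v there are ½, so both are vertices of the face and therefore of τ.
  -- Uniqueness of coordinates in τ then matches them with u′ and v′.
  edge-unique : ∀ {u v u′ v′} → IsEdge u v → IsEdge u′ v′ → u ⊞ v ≡ u′ ⊞ v′ → SameEdge (u , v) (u′ , v′)
  edge-unique {u} {v} {u′} {v′} e e′ u+v≡u′+v′ = conclude
    (δ⊕δ-support (λ eq → δ⊕δ≢0 E′.i E′.j (≡.trans (≡.sym (coords≡ E′.i)) eq)))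
    (δ⊕δ-support (λ eq → δ⊕δ≢0 E′.j E′.i (≡.trans (ℤ.+-comm (δ E′.j E′.j) (δ E′.i E′.j))
      (≡.trans (≡.sym (coords≡ E′.j)) eq))))
    where
    module E = IsEdge e
    module E′ = IsEdge e′
    σ = E.simplex
    τ = E′.simplex
    x : Vector ℝ n
    x = midpoint u v
    x≃ : ∀ s → x s ≃ midpoint u′ v′ s
    x≃ s = double-injective (≃-trans (≃-sym (midpoint-doubled u v s))
      (≃-trans (fromℤ-cong (cong (λ z → Vec.lookup z s) u+v≡u′+v′)) (midpoint-doubled u′ v′ s)))
    common = meet E.simplex∈ E′.simplex∈
    face = proj₁ common
    face⊆σ : face ⊆ Vec.toList σ
    face⊆σ = proj₁ (proj₂ common)
    face⊆τ : face ⊆ Vec.toList τ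
    face⊆τ = proj₁ (proj₂ (proj₂ common))
    x∈face : conv face x
    x∈face = Equivalence.to (proj₂ (proj₂ (proj₂ common)) x)
      ( midpoint∈Conv (u∈simplex e) (v∈simplex e)
      , segment∈Conv (u∈simplex e′) (v∈simplex e′) (ℚ.nonNegative⁻¹ ½) ½≤1 {x} x≃ )
    module B = Barycentric (barycentric {vs = face} {σ = σ} {x = x} face⊆σ x∈face)
    -- A vertex off the face would have coordinate 0, but u and v have coordinate 1/2.
    in-face : ∀ l → (δ E.i ⊕ δ E.j) l ≢ + 0 → Vec.lookup σ l ∈ face
    in-face l ≢0 = decidable-stable (mem? (Vec.≡-dec ℤ._≟_) (Vec.lookup σ l) face) λ ∉face →
      ≢0 (fromℤ-injective (≃-trans
        (≃-sym (doubled-coordinates {σ = σ} (isSimplex E.simplex∈) B.coordinates (δ E.i ⊕ δ E.j) x (u ⊞ v)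
          B.total (sum-δ⊕δ E.i E.j) B.represents (combination≡sum e) (midpoint-doubled u v) l))
        (≃-trans (+-cong (B.support l ∉face) (B.support l ∉face)) (ℝ-Ring.+-identityʳ 0ℝ))))
    u∈τ : u ∈ Vec.toList τ
    u∈τ = face⊆τ (subst (_∈ face) E.≡u (in-face E.i (δ⊕δ≢0 E.i E.j)))
    v∈τ : v ∈ Vec.toList τ
    v∈τ = face⊆τ (subst (_∈ face) E.≡v (in-face E.j (δ⊕δ≢0 E.j E.i ∘ ≡.trans (ℤ.+-comm (δ E.j E.j) (δ E.i E.j)))))
    iu = proj₁ (index {σ = τ} u∈τ)
    τ-iu = proj₂ (index {σ = τ} u∈τ)
    iv = proj₁ (index {σ = τ} v∈τ)
    τ-iv = proj₂ (index {σ = τ} v∈τ)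
    coords≡ : ∀ l → (δ iu ⊕ δ iv) l ≡ (δ E′.i ⊕ δ E′.j) l
    coords≡ = integral-coordinates-unique {σ = τ} (isSimplex E′.simplex∈) (δ iu ⊕ δ iv) (δ E′.i ⊕ δ E′.j)
      (≡.trans (sum-δ⊕δ iu iv) (≡.sym (sum-δ⊕δ E′.i E′.j)))
      (λ s → ≡.trans (combinationℤ-δ⊕δ iu iv τ s)
        (≡.trans (cong₂ (λ a b → Vec.lookup (a ⊞ b) s) τ-iu τ-iv)
        (≡.trans (cong (λ z → Vec.lookup z s) u+v≡u′+v′) (≡.sym (combination≡sum e′ s)))))
    same : ∀ {l l′ a b} → Vec.lookup τ l ≡ a → Vec.lookup τ l′ ≡ b → l ≡ l′ → a ≡ b
    same eq eq′ refl = ≡.trans (≡.sym eq) eq′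
    conclude : iu ≡ E′.i ⊎ iv ≡ E′.i → iu ≡ E′.j ⊎ iv ≡ E′.j → SameEdge (u , v) (u′ , v′)
    conclude (inj₁ p) (inj₂ q) = inj₁ (same τ-iu E′.≡u p , same τ-iv E′.≡v q)
    conclude (inj₂ p) (inj₁ q) = inj₂ (same τ-iu E′.≡v q , same τ-iv E′.≡u p)
    conclude (inj₁ p) (inj₁ q) = contradiction (≡.trans (≡.sym p) q) E′.i≢j
    conclude (inj₂ p) (inj₂ q) = contradiction (≡.trans (≡.sym p) q) E′.i≢j

  -- Deduplication leaves pairwise different edges, and different edges have different sums. The
  -- number of edges is therefore a number of lattice points.
  edgeSums-unique : Unique edgeSums
  edgeSums-unique = AllPairs.map⁺ (AllPairs-map-All
    (λ e e′ different sum≡ → different (edge-unique e e′ sum≡))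
    (All.tabulate ∈-edges⁻)
    (DecSetoidUnique.deduplicate-! (sameEdge-decSetoid n) _))

  edge∈edgeSums : ∀ {σ} → σ ∈ simplices → ∀ {u v} → (u , v) ∈ pairs (Vec.toList σ) → u ⊞ v ∈ edgeSums
  edge∈edgeSums {σ} σ∈ {u} {v} uv∈ = Any.map⁺ (Any.deduplicate⁺ sameEdge?
    (λ {e} {f} f~e e≡ → ≡.trans e≡ (≡.sym (SameEdge⇒≡sum f~e)))
    (Any.map (λ { refl → refl }) (∈-concatMap⁺ (λ σ → pairs (Vec.toList σ)) {xs = simplices}
      (Any.map (λ { refl → uv∈ }) σ∈))))

  -- The half x of z lies in some simplex σ, where z has integral coordinates of total 2. They are
  -- twice the coordinates of x and hence nonnegative, so z is a sum of two vertices of σ, different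
  -- ones because z is odd. Membership in a list of integer vectors is decidable, which discharges
  -- the double negation of `covers`.
  ∈-edgeSums⁺ : ∀ {z} → Doubled P z → Odd z → z ∈ edgeSums
  ∈-edgeSums⁺ {z} (x , x∈P , z≃2x) z-odd = decidable-stable (mem? (Vec.≡-dec ℤ._≟_) z edgeSums)
    λ z∉ → covers x x∈P λ (σ , σ∈ , x∈σ) → z∉ (from-simplex σ∈ x∈σ)
    where
    from-simplex : ∀ {σ} → σ ∈ simplices → conv (Vec.toList σ) x → z ∈ edgeSums
    from-simplex {σ} σ∈ x∈σ = conclude (two-points b 0≤b Σb≡2)
      where
      module B = Barycentric (barycentric {σ = σ} {x = x} (λ v∈ → v∈) x∈σ)
      o : Fin k
      o = ∑≃1⇒index B.coordinates B.total
      u w : Vec ℤ n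
      u = Vec.lookup σ o
      -- The point z lies in 2P but need not lie in `Aff P`. Taking off a vertex u leaves w = 2x -
      -- u, an affine combination of points of P with weights 2 and -1.
      w = z ⊟ u
      w+u≡z : ∀ s → Vec.lookup w s ℤ.+ Vec.lookup u s ≡ Vec.lookup z s
      w+u≡z s = ≡.trans (cong (ℤ._+ Vec.lookup u s) (lookup-⊟ z u s))
        (solve 2 (λ a b → (a :- b) :+ b := a) refl (Vec.lookup z s) (Vec.lookup u s))
        where open ℤ-Solver.+-*-Solver
      w∈Aff : Aff P (ι w)
      w∈Aff = 2 , (λ { zero → x ; (suc _) → ι u }) , (λ { zero → 1ℝ + 1ℝ ; (suc _) → - 1ℝ }) ,
        (λ { zero → x∈P ; (suc _) → contained σ∈ (vertex∈conv (VecMembership.∈-toList⁺ (VecMembership.∈-lookup o σ))) }) ,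
        total .unwrap , λ s → value s .unwrap
        where
        open +-*-Solver
        total : (1ℝ + 1ℝ) + (- 1ℝ + 0ℝ) ≃ 1ℝ
        total = pointwise λ _ → refl
        value : ∀ s → ι w s ≃ (1ℝ + 1ℝ) * x s + (- 1ℝ * ι u s + 0ℝ)
        value s = ≃-trans
          (pointwise λ m → solve 2 (λ a b → a := (a :+ b) :- b) refl (seq (ι w s) m) (seq (ι u s) m))
          (≃-trans (ℝ-Ring.+-congʳ { - ι u s} (≃-trans
            (≃-trans (≃-sym (fromℤ-+ (Vec.lookup w s) (Vec.lookup u s))) (fromℤ-cong (w+u≡z s))) (z≃2x s)))
          (pointwise λ m → solve 2 (λ a b → (a :+ a) :- b
            := (con 1ℚ :+ con 1ℚ) :* a :+ (:- con 1ℚ :* b :+ con 0ℚ)) refl (seq (x s) m) (seq (ι u s) m)))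
      coords = integral-coordinates o (unimodular σ∈) w w∈Aff
      b : Vector ℤ k
      b = proj₁ coords ⊕ δ o
      Σb≡2 : Σℤ.sum b ≡ + 2
      Σb≡2 = ≡.trans (sum-⊕ (proj₁ coords) (δ o)) (cong₂ ℤ._+_ (proj₁ (proj₂ coords)) (sum-δ-1 o))
      bσ≡z : ∀ s → combinationℤ b σ s ≡ Vec.lookup z s
      bσ≡z s = ≡.trans (combinationℤ-⊕ (proj₁ coords) (δ o) σ s)
        (≡.trans (cong₂ ℤ._+_ (proj₂ (proj₂ coords) s) (combinationℤ-δ o σ s)) (w+u≡z s))
      0≤b : ∀ i → + 0 ℤ.≤ b i
      0≤b i = NonNeg-fromℤ⁻ (NonNeg-resp-≃
        (doubled-coordinates {σ = σ} (isSimplex σ∈) B.coordinates b x z B.total Σb≡2 B.represents bσ≡z z≃2x i)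
        (NonNeg-+ (B.nonNeg i) (B.nonNeg i)))
      conclude : (∃₂ λ i j → ∀ (g : Vector ℤ k) → Σℤ.sum (λ l → b l ℤ.* g l) ≡ g i ℤ.+ g j) → z ∈ edgeSums
      conclude (i , j , expand) = by-cases (i Fin.≟ j)
        where
        z≡ : z ≡ Vec.lookup σ i ⊞ Vec.lookup σ j
        z≡ = lookup-extensionality λ s → ≡.trans (≡.sym (bσ≡z s))
          (≡.trans (expand (λ l → Vec.lookup (Vec.lookup σ l) s)) (≡.sym (lookup-⊞ (Vec.lookup σ i) (Vec.lookup σ j) s)))
        by-cases : Dec (i ≡ j) → z ∈ edgeSums
        by-cases (yes refl) = contradiction z≡ (z-odd (Vec.lookup σ i))
        by-cases (no i≢j) = [ (λ ij∈ → subst (_∈ edgeSums) (≡.sym z≡) (edge∈edgeSums σ∈ ij∈))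
          , (λ ji∈ → subst (_∈ edgeSums)
              (≡.trans (⊞-comm (Vec.lookup σ j) (Vec.lookup σ i)) (≡.sym z≡)) (edge∈edgeSums σ∈ ji∈)) ]′
          (∈-pairs⁺ σ i≢j)

-- Integral functionals bounding the doubled polytope

⟨_,_⟩ : ∀ {n} → Vector ℤ n → Vec ℤ n → ℤ
⟨ w , z ⟩ = Σℤ.sum (λ s → w s ℤ.* Vec.lookup z s)

module _ {n} (w : Vector ℤ n) where

  ⟨⟩-⊞ : ∀ u v → ⟨ w , u ⊞ v ⟩ ≡ ⟨ w , u ⟩ ℤ.+ ⟨ w , v ⟩
  ⟨⟩-⊞ u v = ≡.trans
    (Σℤ.sum-cong-≗ (λ s → ≡.trans (cong (w s ℤ.*_) (lookup-⊞ u v s)) (ℤ.*-distribˡ-+ (w s) (Vec.lookup u s) (Vec.lookup v s))))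
    (Σℤ.∑-distrib-+ (λ s → w s ℤ.* Vec.lookup u s) (λ s → w s ℤ.* Vec.lookup v s))

  ℓ : Vector ℝ n → ℝ
  ℓ x = ∑ (λ s → fromℤ (w s) * x s)

  ℓ-ι : ∀ z → fromℤ ⟨ w , z ⟩ ≃ ℓ (ι z)
  ℓ-ι z = ≃-trans (fromℤ-sum (λ s → w s ℤ.* Vec.lookup z s))
    (Σℝ.sum-cong-≋ (λ s → fromℤ-* (w s) (Vec.lookup z s)))

  ℓ-cong : ∀ {x y} → (∀ s → x s ≃ y s) → ℓ x ≃ ℓ y
  ℓ-cong x≃y = Σℝ.sum-cong-≋ (λ s → ℝ-Ring.*-congˡ (x≃y s))

  ℓ-combination : ∀ {m} (μ : Vector ℝ m) (y : Vector (Vector ℝ n) m) →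
                  ℓ (combination μ y) ≃ ∑ (λ j → μ j * ℓ (y j))
  ℓ-combination μ y = begin
    ∑ (λ s → fromℤ (w s) * ∑ (λ j → μ j * y j s))
      ≈⟨ Σℝ.sum-cong-≋ (λ s → Σℝ.*-distribˡ-sum (fromℤ (w s)) (λ j → μ j * y j s)) ⟩
    ∑ (λ s → ∑ (λ j → fromℤ (w s) * (μ j * y j s)))
      ≈⟨ Σℝ.∑-comm (λ s j → fromℤ (w s) * (μ j * y j s)) ⟩
    ∑ (λ j → ∑ (λ s → fromℤ (w s) * (μ j * y j s)))
      ≈⟨ Σℝ.sum-cong-≋ (λ j → Σℝ.sum-cong-≋ (λ s → pointwise λ m →
           solve 3 (λ a b c → a :* (b :* c) := b :* (a :* c)) refl (w s ℚ./ 1) (seq (μ j) m) (seq (y j s) m))) ⟩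
    ∑ (λ j → ∑ (λ s → μ j * (fromℤ (w s) * y j s)))
      ≈⟨ Σℝ.sum-cong-≋ (λ j → Σℝ.*-distribˡ-sum (μ j) (λ s → fromℤ (w s) * y j s)) ⟨
    ∑ (λ j → μ j * ℓ (y j)) ∎
    where
    open SetoidReasoning ℝ-Ring.setoid
    open +-*-Solver

  -- For x with weights μ j on the points g j, the slack 2 - ⟨ w , z ⟩ is twice the sum of μ j (1 -
  -- ⟨ w , g j ⟩), whose summands are nonnegative. The slack is an integer, so the conclusion is
  -- exact.
  ⟨⟩≤2 : ∀ {A : Pred (Vec ℤ n) 0ℓ} → (∀ g → A g → ⟨ w , g ⟩ ℤ.≤ + 1) →
         ∀ z → Doubled (Conv ⟦ A ⟧) z → ⟨ w , z ⟩ ℤ.≤ + 2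
  ⟨⟩≤2 {A} ≤1 z (x , (m , y , μ , y∈A , 0≤μ , ∑μ≈1 , x≋) , z≃2x) =
    ℤ.0≤i-j⇒j≤i (NonNeg-fromℤ⁻ (NonNeg-resp-≃ (≃-sym slack) (NonNeg-+ 0≤N 0≤N)))
    where
    f : Fin m → ℤ
    f j = ⟨ w , proj₁ (y∈A j) ⟩
    W N : ℝ
    W = ∑ (λ j → μ j * fromℤ (f j))
    N = ∑ (λ j → μ j * fromℤ (+ 1 ℤ.- f j))
    0≤N : NonNeg N
    0≤N = NonNeg-∑ (λ j → μ j * fromℤ (+ 1 ℤ.- f j))
      (λ j → NonNeg-*fromℚ (wrap (0≤μ j)) (/1-mono-≤ (ℤ.i≤j⇒0≤j-i (≤1 _ (proj₁ (proj₂ (y∈A j)))))))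
    open SetoidReasoning ℝ-Ring.setoid
    open +-*-Solver
    fromℤ-- : ∀ a b → fromℤ (a ℤ.- b) ≃ fromℤ a - fromℤ b
    fromℤ-- a b = ≃-trans (pointwise λ _ → solve 2 (λ c b → c := (c :+ b) :- b) refl ((a ℤ.- b) ℚ./ 1) (b ℚ./ 1))
      (ℝ-Ring.+-congʳ (≃-trans (≃-sym (fromℤ-+ (a ℤ.- b) b)) (fromℤ-cong
        (ℤS.solve 2 (λ a b → (a ℤS.:- b) ℤS.:+ b ℤS.:= a) refl a b))))
      where module ℤS = ℤ-Solver.+-*-Solver
    ℓx≃W : ℓ x ≃ W
    ℓx≃W = begin
      ℓ x                      ≈⟨ ℓ-cong (λ s → wrap (x≋ s)) ⟩
      ℓ (combination μ y)      ≈⟨ ℓ-combination μ y ⟩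
      ∑ (λ j → μ j * ℓ (y j))  ≈⟨ Σℝ.sum-cong-≋ (λ j → ℝ-Ring.*-congˡ (≃-trans
                                    (ℓ-cong (λ s → wrap (proj₂ (proj₂ (y∈A j)) s))) (≃-sym (ℓ-ι (proj₁ (y∈A j)))))) ⟩
      W                        ∎
    N≃1-W : N ≃ 1ℝ - W
    N≃1-W = begin
      N                                              ≈⟨ Σℝ.sum-cong-≋ (λ j → ℝ-Ring.*-congˡ (fromℤ-- (+ 1) (f j))) ⟩
      ∑ (λ j → μ j * (1ℝ - fromℤ (f j)))             ≈⟨ Σℝ.sum-cong-≋ (λ j → pointwise λ m →
                                                          solve 2 (λ a b → a :* (con 1ℚ :- b) := a :- a :* b) refl (seq (μ j) m) (f j ℚ./ 1)) ⟩
      ∑ (λ j → μ j - μ j * fromℤ (f j))              ≈⟨ ∑-- μ (λ j → μ j * fromℤ (f j)) ⟩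
      ∑ μ - W                                        ≈⟨ ℝ-Ring.+-congʳ (wrap ∑μ≈1) ⟩
      1ℝ - W                                         ∎
    slack : fromℤ (+ 2 ℤ.- ⟨ w , z ⟩) ≃ N + N
    slack = begin
      fromℤ (+ 2 ℤ.- ⟨ w , z ⟩)          ≈⟨ fromℤ-- (+ 2) ⟨ w , z ⟩ ⟩
      fromℤ (+ 2) - fromℤ ⟨ w , z ⟩      ≈⟨ +-cong (fromℤ-+ (+ 1) (+ 1)) (-‿cong (≃-trans (ℓ-ι z) (≃-trans (ℓ-cong z≃2x) ℓ-2x))) ⟩
      (1ℝ + 1ℝ) - (W + W)                ≈⟨ pointwise (λ m → solve 1 (λ a → (con 1ℚ :+ con 1ℚ) :- (a :+ a)
                                              := (con 1ℚ :- a) :+ (con 1ℚ :- a)) refl (seq W m)) ⟩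
      (1ℝ - W) + (1ℝ - W)                ≈⟨ +-cong N≃1-W N≃1-W ⟨
      N + N                              ∎
      where
      ℓ-2x : ℓ (λ s → x s + x s) ≃ W + W
      ℓ-2x = ≃-trans (Σℝ.sum-cong-≋ (λ s → ℝ-Ring.distribˡ (fromℤ (w s)) (x s) (x s)))
        (≃-trans (Σℝ.∑-distrib-+ (λ s → fromℤ (w s) * x s) (λ s → fromℤ (w s) * x s)) (+-cong ℓx≃W ℓx≃W))

Conv-mono : ∀ {n} {A A′ : Pred (Vec ℤ n) 0ℓ} → (∀ {z} → A z → A′ z) → ∀ {x} → Conv ⟦ A ⟧ x → Conv ⟦ A′ ⟧ x
Conv-mono A⊆A′ (m , y , μ , y∈A , rest) =
  m , y , μ , (λ j → proj₁ (y∈A j) , A⊆A′ (proj₁ (proj₂ (y∈A j))) , proj₂ (proj₂ (y∈A j))) , rest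

-- The old edge sums are odd points of 2P, hence of 2P′, hence edge sums of T′, although T and T′
-- may have no simplex in common. The points of `zs` join them without repetition because they lie
-- outside 2P.
edges-grow : ∀ {n} {P P′ : Pred (Vector ℝ n) 0ℓ} (T : UnimodularTriangulation P) (T′ : UnimodularTriangulation P′) →
  (∀ {x} → P x → P′ x) → (zs : List (Vec ℤ n)) → Unique zs →
  (∀ {z} → z ∈ zs → Odd z × Doubled P′ z × ¬ Doubled P z) →
  length (edges T) ℕ.+ length zs ℕ.≤ length (edges T′)
edges-grow T T′ P⊆P′ zs zs! new = begin
  length (edges T) ℕ.+ length zs         ≡⟨ cong (ℕ._+ length zs) (List.length-map (uncurry _⊞_) (edges T)) ⟨
  length (edgeSums T) ℕ.+ length zs      ≡⟨ List.length-++ (edgeSums T) ⟨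
  length (edgeSums T ++ zs)              ≤⟨ unique∧⊆⇒length≤ all! all⊆ ⟩
  length (edgeSums T′)                   ≡⟨ List.length-map (uncurry _⊞_) (edges T′) ⟩
  length (edges T′)                      ∎
  where
  open ℕ.≤-Reasoning
  all! : Unique (edgeSums T ++ zs)
  all! = Unique.++⁺ (edgeSums-unique T) zs! (λ (z∈T , z∈zs) →
    proj₂ (proj₂ (new z∈zs)) (proj₁ (∈-edgeSums⁻ T z∈T)))
  all⊆ : edgeSums T ++ zs ⊆ edgeSums T′
  all⊆ {z} z∈ = [ (λ z∈T → let (x , x∈P , z≃2x) , z-odd = ∈-edgeSums⁻ T z∈T
                           in ∈-edgeSums⁺ T′ (x , P⊆P′ x∈P , z≃2x) z-odd)
                , (λ z∈zs → let z-odd , z∈2P′ , _ = new z∈zs in ∈-edgeSums⁺ T′ z∈2P′ z-odd) ]′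
    (∈-++⁻ (edgeSums T) z∈)

-- Directed arcs as vectors, and functionals supported near one node

lookup-𝐞 : ∀ {n} (i s : Fin n) → Vec.lookup (𝐞 i) s ≡ δ i s
lookup-𝐞 i s with δ-cases i s
... | inj₁ (refl , δ≡1) = ≡.trans (Vec.lookup∘update i 𝟎 (+ 1)) (≡.sym δ≡1)
... | inj₂ (i≢s , δ≡0)  = ≡.trans (Vec.lookup∘update′ (i≢s ∘ ≡.sym) 𝟎 (+ 1))
  (≡.trans (Vec.lookup-replicate s (+ 0)) (≡.sym δ≡0))

arrow : ∀ {n} → Fin n → Fin n → Vec ℤ n
arrow i j = 𝐞 i ⊟ 𝐞 j

lookup-arrow : ∀ {n} (i j s : Fin n) → Vec.lookup (arrow i j) s ≡ δ i s ℤ.- δ j s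
lookup-arrow i j s = ≡.trans (lookup-⊟ (𝐞 i) (𝐞 j) s) (cong₂ ℤ._-_ (lookup-𝐞 i s) (lookup-𝐞 j s))

⟨⟩-arrow : ∀ {n} (w : Vector ℤ n) i j → ⟨ w , arrow i j ⟩ ≡ w i ℤ.- w j
⟨⟩-arrow w i j = ≡.trans
  (Σℤ.sum-cong-≗ (λ s → ≡.trans (cong (w s ℤ.*_) (lookup-arrow i j s))
    (solve 3 (λ w a b → w :* (a :- b) := a :* w :+ con -[1+ 0 ] :* (b :* w)) refl (w s) (δ i s) (δ j s))))
  (≡.trans (Σℤ.∑-distrib-+ (λ s → δ i s ℤ.* w s) (λ s → -[1+ 0 ] ℤ.* (δ j s ℤ.* w s)))
  (≡.trans (cong₂ ℤ._+_ (sum-δ i w) (≡.trans (≡.sym (Σℤ.*-distribˡ-sum -[1+ 0 ] (λ s → δ j s ℤ.* w s)))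
      (cong (-[1+ 0 ] ℤ.*_) (sum-δ j w))))
    (solve 2 (λ a b → a :+ con -[1+ 0 ] :* b := a :- b) refl (w i) (w j))))
  where open ℤ-Solver.+-*-Solver

0≤δ : ∀ {k} (i j : Fin k) → + 0 ℤ.≤ δ i j
0≤δ i j with δ-cases i j
... | inj₁ (_ , eq) = subst (+ 0 ℤ.≤_) (≡.sym eq) (ℤ.+≤+ ℕ.z≤n)
... | inj₂ (_ , eq) = subst (+ 0 ℤ.≤_) (≡.sym eq) ℤ.≤-refl

δ≤1 : ∀ {k} (i j : Fin k) → δ i j ℤ.≤ + 1
δ≤1 i j with δ-cases i j
... | inj₁ (_ , eq) = ℤ.≤-reflexive eq
... | inj₂ (_ , eq) = subst (ℤ._≤ + 1) (≡.sym eq) (ℤ.+≤+ ℕ.z≤n)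

module _ {n} (a : Fin n) (m : Vector ℤ n) (0≤m : ∀ s → + 0 ℤ.≤ m s) (m≤1 : ∀ s → m s ℤ.≤ + 1) where

  -- After regrouping, the positive part is δ a s + m t. It exceeds 1 only for s = a and m t = 1,
  -- that is, on an arc from a into the set with indicator m.
  difference≤1 : ∀ s t → a ≢ s ⊎ m t ≡ + 0 → (δ a s ℤ.- m s) ℤ.- (δ a t ℤ.- m t) ℤ.≤ + 1
  difference≤1 s t h = begin
    (δ a s ℤ.- m s) ℤ.- (δ a t ℤ.- m t)        ≡⟨ solve 4 (λ p q r u → (p :- q) :- (r :- u) := (p :+ u) :- (q :+ r)) refl (δ a s) (m s) (δ a t) (m t) ⟩
    (δ a s ℤ.+ m t) ℤ.- (m s ℤ.+ δ a t)        ≤⟨ ℤ.+-mono-≤ (bound h) (ℤ.neg-mono-≤ (ℤ.+-mono-≤ (0≤m s) (0≤δ a t))) ⟩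
    + 1                                        ∎
    where
    open ℤ.≤-Reasoning
    open ℤ-Solver.+-*-Solver
    bound : a ≢ s ⊎ m t ≡ + 0 → δ a s ℤ.+ m t ℤ.≤ + 1
    bound (inj₁ a≢s)  = ℤ.+-mono-≤ (ℤ.≤-reflexive (δ-off-diagonal a≢s)) (m≤1 t)
    bound (inj₂ mt≡0) = ℤ.+-mono-≤ (δ≤1 a s) (ℤ.≤-reflexive mt≡0)

≡1⇒Odd : ∀ {n} {z : Vec ℤ n} s → Vec.lookup z s ≡ + 1 → Odd z
≡1⇒Odd s zₛ≡1 w refl = a+a≢1 (Vec.lookup w s) (≡.trans (≡.sym (lookup-⊞ w w s)) zₛ≡1)

≡-1⇒Odd : ∀ {n} {z : Vec ℤ n} s → Vec.lookup z s ≡ -[1+ 0 ] → Odd z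
≡-1⇒Odd s zₛ≡-1 w refl = a+a≢1 (ℤ.- Vec.lookup w s)
  (≡.trans (≡.sym (ℤ.neg-distrib-+ (Vec.lookup w s) (Vec.lookup w s)))
    (cong ℤ.-_ (≡.trans (≡.sym (lookup-⊞ w w s)) zₛ≡-1)))

-- Adding an arc to a graph

arcEnds : ∀ n → Fin (length (allArcs n)) → Fin n × Fin n
arcEnds n = List.lookup (allArcs n)

arcEnds-< : ∀ n c → proj₁ (arcEnds n c) Fin.< proj₂ (arcEnds n c)
arcEnds-< n c = proj₂ (∈-filter⁻ (λ a → proj₁ a Fin.<? proj₂ a)
  {xs = List.cartesianProduct (List.allFin n) (List.allFin n)} (∈-lookup {xs = allArcs n} c))

arcEnds-injective : ∀ n {c c′} → arcEnds n c ≡ arcEnds n c′ → c ≡ c′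
arcEnds-injective n = unique-lookup-injective
  (Unique.filter⁺ (λ a → proj₁ a Fin.<? proj₂ a) (Unique.cartesianProduct⁺ (Unique.allFin⁺ n) (Unique.allFin⁺ n)))

arc : ∀ {n} {i j : Fin n} → i Fin.< j → ∃ λ c → arcEnds n c ≡ (i , j)
arc {n} {i} {j} i<j = Any.index ij∈ , ≡.sym (Any.lookup-index ij∈)
  where
  ij∈ : (i , j) ∈ allArcs n
  ij∈ = ∈-filter⁺ (λ a → proj₁ a Fin.<? proj₂ a) (∈-cartesianProduct⁺ (∈-allFin i) (∈-allFin j)) i<j

module AddArc {n} (G : Graph n) (e : Fin (length (allArcs n)))
  (T : ∀ G → UnimodularTriangulation (symmetricEdgePolytope n G)) where

  G⁻ G⁺ : Graph n
  G⁻ = G Vec.[ e ]≔ outside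
  G⁺ = G Vec.[ e ]≔ inside

  a b : Fin n
  a = proj₁ (arcEnds n e)
  b = proj₂ (arcEnds n e)

  a<b : a Fin.< b
  a<b = arcEnds-< n e

  a≢b : a ≢ b
  a≢b = Fin.<⇒≢ a<b

  e∉G⁻ : Vec.lookup G⁻ e ≡ outside
  e∉G⁻ = Vec.lookup∘update e G outside

  e∈G⁺ : e ∈ˢ G⁺
  e∈G⁺ = Vec.lookup⇒[]= e G⁺ (Vec.lookup∘update e G inside)

  G⁻⊆G⁺ : ∀ {c} → c ∈ˢ G⁻ → c ∈ˢ G⁺
  G⁻⊆G⁺ {c} c∈ = go (c Fin.≟ e)
    where
    go : Dec (c ≡ e) → c ∈ˢ G⁺
    go (yes refl) = contradiction (≡.trans (≡.sym (Vec.[]=⇒lookup c∈)) e∉G⁻) λ ()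
    go (no c≢e)   = Vec.lookup⇒[]= c G⁺ (≡.trans (Vec.lookup∘update′ c≢e G inside)
      (≡.trans (≡.sym (Vec.lookup∘update′ c≢e G outside)) (Vec.[]=⇒lookup c∈)))

  P⁻⊆P⁺ : ∀ {x} → symmetricEdgePolytope n G⁻ x → symmetricEdgePolytope n G⁺ x
  P⁻⊆P⁺ {x} = Conv-mono (λ (c , c∈ , eq) → c , G⁻⊆G⁺ c∈ , eq) {x}

  NonAdjacent : Fin n → Fin n → Set
  NonAdjacent i j = ∀ c → c ∈ˢ G⁻ → arcEnds n c ≢ (i , j) × arcEnds n c ≢ (j , i)

  -- An arc is listed once, so another index with the same ends is impossible, and the reversed pair
  -- would violate the order of the ends.
  nonAdjacent : ∀ {i j c} → arcEnds n c ≡ (i , j) → Vec.lookup G⁻ c ≡ outside → NonAdjacent i j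
  nonAdjacent {i} {j} {c} c≡ij c∉ c′ c′∈ =
    (λ c′≡ij → contradiction (≡.trans (≡.sym (Vec.[]=⇒lookup c′∈))
      (≡.trans (cong (Vec.lookup G⁻) (arcEnds-injective n (≡.trans c′≡ij (≡.sym c≡ij)))) c∉)) λ ()) ,
    (λ c′≡ji → Fin.<-asym (subst (λ p → proj₁ p Fin.< proj₂ p) c≡ij (arcEnds-< n c))
                          (subst (λ p → proj₁ p Fin.< proj₂ p) c′≡ji (arcEnds-< n c′)))

  ab-nonAdjacent : NonAdjacent a b
  ab-nonAdjacent = nonAdjacent {c = e} refl e∉G⁻

  functional-bound : (w : Vector ℤ n) →
    (∀ c → c ∈ˢ G⁻ → let s , t = arcEnds n c in w s ℤ.- w t ℤ.≤ + 1 × w t ℤ.- w s ℤ.≤ + 1) →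
    ∀ {z} → + 3 ℤ.≤ ⟨ w , z ⟩ → ¬ Doubled (symmetricEdgePolytope n G⁻) z
  functional-bound w w≤1 {z} 3≤ z∈2P = contradiction (ℤ.≤-trans 3≤ (⟨⟩≤2 w bound z z∈2P))
    λ { (ℤ.+≤+ (ℕ.s≤s (ℕ.s≤s ()))) }
    where
    bound : ∀ g → directedArcs n G⁻ g → ⟨ w , g ⟩ ℤ.≤ + 1
    bound g (c , c∈ , inj₁ refl) = subst (ℤ._≤ + 1) (≡.sym (⟨⟩-arrow w _ _)) (proj₁ (w≤1 c c∈))
    bound g (c , c∈ , inj₂ refl) = subst (ℤ._≤ + 1) (≡.sym (⟨⟩-arrow w _ _)) (proj₂ (w≤1 c c∈))

  -- The functional δ a − m, where m is the indicator of a set of nodes not joined to a in G⁻.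
  module _ (m : Vector ℤ n) (0≤m : ∀ s → + 0 ℤ.≤ m s) (m≤1 : ∀ s → m s ℤ.≤ + 1)
           (S? : ∀ s → NonAdjacent a s ⊎ m s ≡ + 0) where

    w : Vector ℤ n
    w s = δ a s ℤ.- m s

    star-bound : ∀ {z} → + 3 ℤ.≤ ⟨ w , z ⟩ → ¬ Doubled (symmetricEdgePolytope n G⁻) z
    star-bound {z} = functional-bound w (λ c c∈ →
      difference≤1 a m 0≤m m≤1 _ _
        (cases (S? _) (a Fin.≟ _) λ non a≡ → proj₁ (non c c∈) (cong (_, _) (≡.sym a≡))) ,
      difference≤1 a m 0≤m m≤1 _ _
        (cases (S? _) (a Fin.≟ _) λ non a≡ → proj₂ (non c c∈) (cong (_ ,_) (≡.sym a≡)))) {z}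
      where
      cases : ∀ {s t} → NonAdjacent a t ⊎ m t ≡ + 0 → Dec (a ≡ s) →
              (NonAdjacent a t → a ≢ s) → a ≢ s ⊎ m t ≡ + 0
      cases (inj₂ mt≡0) _         _ = inj₂ mt≡0
      cases (inj₁ non)  (no a≢s)  _ = inj₁ a≢s
      cases (inj₁ non)  (yes a≡s) f = contradiction a≡s (f non)

  IsNew : Vec ℤ n → Set
  IsNew z = Odd z × Doubled (symmetricEdgePolytope n G⁺) z × ¬ Doubled (symmetricEdgePolytope n G⁻) z

  sum∈2P⁺ : ∀ {g g′} → directedArcs n G⁺ g → directedArcs n G⁺ g′ → Doubled (symmetricEdgePolytope n G⁺) (g ⊞ g′)
  sum∈2P⁺ {g} {g′} g∈ g′∈ = midpoint g g′ , midpoint∈Conv g∈ g′∈ , midpoint-doubled g g′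

  ab∈G⁺ : directedArcs n G⁺ (arrow a b)
  ab∈G⁺ = e , e∈G⁺ , inj₁ refl

  ba∈G⁺ : directedArcs n G⁺ (arrow b a)
  ba∈G⁺ = e , e∈G⁺ , inj₂ refl

  lookup-arrows : ∀ i j k l s → Vec.lookup (arrow {n} i j ⊞ arrow k l) s ≡ (δ i s ℤ.- δ j s) ℤ.+ (δ k s ℤ.- δ l s)
  lookup-arrows i j k l s = ≡.trans (lookup-⊞ (arrow i j) (arrow k l) s) (cong₂ ℤ._+_ (lookup-arrow i j s) (lookup-arrow k l s))

  ⟨⟩-arrows : ∀ w i j k l → ⟨ w , arrow {n} i j ⊞ arrow k l ⟩ ≡ (w i ℤ.- w j) ℤ.+ (w k ℤ.- w l)
  ⟨⟩-arrows w i j k l = ≡.trans (⟨⟩-⊞ w (arrow i j) (arrow k l)) (cong₂ ℤ._+_ (⟨⟩-arrow w i j) (⟨⟩-arrow w k l))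

  -- The coordinate at a is 1, which gives oddness. With m the indicator of b and l, neither
  -- adjacent to a in `G⁻`, the functional takes the values 1, -1, 0, -1 at a, b, j, l. It is thus 2
  -- on the first arrow and 1 on the second.
  quad-isNew : ∀ {j l} → a ≢ j → a ≢ l → b ≢ j → b ≢ l → j ≢ l →
               directedArcs n G⁺ (arrow j l) → NonAdjacent a l → IsNew (arrow a b ⊞ arrow j l)
  quad-isNew {j} {l} a≢j a≢l b≢j b≢l j≢l jl∈ al∉ =
    ≡1⇒Odd a (≡.trans (lookup-arrows a b j l a)
      (cong₂ ℤ._+_ (cong₂ ℤ._-_ (δ-diagonal a) (δ-off-diagonal (a≢b ∘ ≡.sym)))
                   (cong₂ ℤ._-_ (δ-off-diagonal (a≢j ∘ ≡.sym)) (δ-off-diagonal (a≢l ∘ ≡.sym))))) ,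
    sum∈2P⁺ ab∈G⁺ jl∈ ,
    star-bound m 0≤m m≤1 S? {arrow a b ⊞ arrow j l} (ℤ.≤-reflexive (≡.sym value))
    where
    m : Vector ℤ n
    m s = δ b s ℤ.+ δ l s
    0≤m : ∀ s → + 0 ℤ.≤ m s
    0≤m s = ℤ.+-mono-≤ (0≤δ b s) (0≤δ l s)
    S? : ∀ s → NonAdjacent a s ⊎ m s ≡ + 0
    S? s with δ-cases b s | δ-cases l s
    ... | inj₁ (refl , _) | _               = inj₁ ab-nonAdjacent
    ... | inj₂ _          | inj₁ (refl , _) = inj₁ al∉
    ... | inj₂ (_ , eq)   | inj₂ (_ , eq′)  = inj₂ (cong₂ ℤ._+_ eq eq′)
    m≤1 : ∀ s → m s ℤ.≤ + 1
    m≤1 s with δ-cases b s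
    ... | inj₁ (refl , eq) = ℤ.≤-reflexive (cong₂ ℤ._+_ eq (δ-off-diagonal (b≢l ∘ ≡.sym)))
    ... | inj₂ (_ , eq)    = ℤ.+-mono-≤ (ℤ.≤-reflexive eq) (δ≤1 l s)
    f : Vector ℤ n
    f s = δ a s ℤ.- m s
    value : ⟨ f , arrow a b ⊞ arrow j l ⟩ ≡ + 3
    value = ≡.trans (⟨⟩-arrows f a b j l) (cong₂ ℤ._+_ (cong₂ ℤ._-_ fa fb) (cong₂ ℤ._-_ fj fl))
      where
      fa : f a ≡ + 1
      fa = cong₂ ℤ._-_ (δ-diagonal a) (cong₂ ℤ._+_ (δ-off-diagonal (a≢b ∘ ≡.sym)) (δ-off-diagonal (a≢l ∘ ≡.sym)))
      fb : f b ≡ -[1+ 0 ]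
      fb = cong₂ ℤ._-_ (δ-off-diagonal a≢b) (cong₂ ℤ._+_ (δ-diagonal b) (δ-off-diagonal (b≢l ∘ ≡.sym)))
      fj : f j ≡ + 0
      fj = cong₂ ℤ._-_ (δ-off-diagonal a≢j) (cong₂ ℤ._+_ (δ-off-diagonal b≢j) (δ-off-diagonal (j≢l ∘ ≡.sym)))
      fl : f l ≡ -[1+ 0 ]
      fl = cong₂ ℤ._-_ (δ-off-diagonal a≢l) (cong₂ ℤ._+_ (δ-off-diagonal b≢l) (δ-diagonal l))

  -- Oddness is seen at b, since the coordinate at a is 2. The functional x_a - x_b is 2 on the
  -- first arrow and 1 on the second.
  fan-isNew : ∀ {k} → a ≢ k → b ≢ k → directedArcs n G⁺ (arrow a k) → IsNew (arrow a b ⊞ arrow a k)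
  fan-isNew {k} a≢k b≢k ak∈ =
    ≡-1⇒Odd b (≡.trans (lookup-arrows a b a k b)
      (cong₂ ℤ._+_ (cong₂ ℤ._-_ (δ-off-diagonal a≢b) (δ-diagonal b))
                   (cong₂ ℤ._-_ (δ-off-diagonal a≢b) (δ-off-diagonal (b≢k ∘ ≡.sym))))) ,
    sum∈2P⁺ ab∈G⁺ ak∈ ,
    star-bound (δ b) (0≤δ b) (δ≤1 b) S? {arrow a b ⊞ arrow a k} (ℤ.≤-reflexive (≡.sym value))
    where
    S? : ∀ s → NonAdjacent a s ⊎ δ b s ≡ + 0
    S? s with δ-cases b s
    ... | inj₁ (refl , _) = inj₁ ab-nonAdjacent
    ... | inj₂ (_ , eq)   = inj₂ eq
    f : Vector ℤ n
    f s = δ a s ℤ.- δ b s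
    value : ⟨ f , arrow a b ⊞ arrow a k ⟩ ≡ + 3
    value = ≡.trans (⟨⟩-arrows f a b a k) (cong₂ ℤ._+_ (cong₂ ℤ._-_ fa fb) (cong₂ ℤ._-_ fa fk))
      where
      fa : f a ≡ + 1
      fa = cong₂ ℤ._-_ (δ-diagonal a) (δ-off-diagonal (a≢b ∘ ≡.sym))
      fb : f b ≡ -[1+ 0 ]
      fb = cong₂ ℤ._-_ (δ-off-diagonal a≢b) (δ-diagonal b)
      fk : f k ≡ + 0
      fk = cong₂ ℤ._-_ (δ-off-diagonal a≢k) (δ-off-diagonal b≢k)

  -- Half of arrow a b is ¾ (arrow a b) + ¼ (arrow b a).
  isolated-isNew : (∀ c → c ∈ˢ G⁻ → a ≢ proj₁ (arcEnds n c) × a ≢ proj₂ (arcEnds n c)) → IsNew (arrow a b)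
  isolated-isNew isolated =
    ≡1⇒Odd a (≡.trans (lookup-arrow a b a) (cong₂ ℤ._-_ (δ-diagonal a) (δ-off-diagonal (a≢b ∘ ≡.sym)))) ,
    (x , segment∈Conv ab∈G⁺ ba∈G⁺ (ℚ.nonNegative⁻¹ ¾) ¾≤1 {x} (λ s → pointwise λ _ → refl) , doubled) ,
    functional-bound f (λ c c∈ → let s≢ , t≢ = isolated c c∈ in
        subst (ℤ._≤ + 1) (≡.sym (cong₂ ℤ._-_ (f≡0 s≢) (f≡0 t≢))) (ℤ.+≤+ ℕ.z≤n) ,
        subst (ℤ._≤ + 1) (≡.sym (cong₂ ℤ._-_ (f≡0 t≢) (f≡0 s≢))) (ℤ.+≤+ ℕ.z≤n))
      {arrow a b} (ℤ.≤-reflexive (≡.sym (≡.trans (⟨⟩-arrow f a b)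
        (cong₂ ℤ._-_ (cong (+ 3 ℤ.*_) (δ-diagonal a)) (f≡0 a≢b)))))
    where
    ¾ : ℚ
    ¾ = + 3 ℚ./ 4
    ¾≤1 : ¾ ℚ.≤ 1ℚ
    ¾≤1 = ℚ.*≤* (ℤ.+≤+ (ℕ.s≤s (ℕ.s≤s (ℕ.s≤s ℕ.z≤n))))
    -- Any multiple of x_a vanishes on the arcs of `G⁻` when a is isolated; the factor 3 reaches the
    -- threshold of `functional-bound`.
    f : Vector ℤ n
    f s = + 3 ℤ.* δ a s
    f≡0 : ∀ {s} → a ≢ s → f s ≡ + 0
    f≡0 a≢s = cong (+ 3 ℤ.*_) (δ-off-diagonal a≢s)
    x : Vector ℝ n
    x = segment ¾ (arrow a b) (arrow b a)
    reverse : ∀ s → Vec.lookup (arrow b a) s ≡ ℤ.- Vec.lookup (arrow a b) s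
    reverse s = ≡.trans (lookup-arrow b a s) (≡.trans
      (ℤS.solve 2 (λ p q → q ℤS.:- p ℤS.:= ℤS.:- (p ℤS.:- q)) refl (δ a s) (δ b s))
      (cong ℤ.-_ (≡.sym (lookup-arrow a b s))))
      where module ℤS = ℤ-Solver.+-*-Solver
    fromℤ-neg : ∀ c → fromℤ (ℤ.- c) ≃ - fromℤ c
    fromℤ-neg c = ≃-trans (pointwise λ _ → solve 2 (λ p q → p := (p :+ q) :- q) refl ((ℤ.- c) ℚ./ 1) (c ℚ./ 1))
      (≃-trans (ℝ-Ring.+-congʳ (≃-trans (≃-sym (fromℤ-+ (ℤ.- c) c)) (fromℤ-cong (ℤ.+-inverseˡ c))))
        (ℝ-Ring.+-identityˡ _))
      where open +-*-Solver
    doubled : ∀ s → ι (arrow a b) s ≃ x s + x s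
    doubled s = ≃-trans
      (pointwise λ _ → solve 1 (λ p → p := (con ¾ :* p :+ ((con 1ℚ :- con ¾) :* (:- p) :+ con 0ℚ))
                                          :+ (con ¾ :* p :+ ((con 1ℚ :- con ¾) :* (:- p) :+ con 0ℚ))) refl (Vec.lookup (arrow a b) s ℚ./ 1))
      (≃-sym (+-cong x≃ x≃))
      where
      open +-*-Solver
      x≃ : x s ≃ fromℚ ¾ * ι (arrow a b) s + (fromℚ (1ℚ ℚ.- ¾) * (- ι (arrow a b) s) + 0ℝ)
      x≃ = ℝ-Ring.+-congˡ (ℝ-Ring.+-congʳ (ℝ-Ring.*-congˡ
        (≃-trans (fromℤ-cong (reverse s)) (fromℤ-neg (Vec.lookup (arrow a b) s)))))

  -- If a has a neighbour k in `G⁻`, the arrow a b itself may be old (say, when k is also adjacent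
  -- to b), so the second arc at a is used for a fan. If there is none, a is isolated and the arrow
  -- a b is new.
  some-isNew : ∃ IsNew
  some-isNew = decide (Fin.any? touches?)
    where
    Touches : Fin (length (allArcs n)) → Set
    Touches c = c ∈ˢ G⁻ × (a ≡ proj₁ (arcEnds n c) ⊎ a ≡ proj₂ (arcEnds n c))
    touches? : ∀ c → Dec (Touches c)
    touches? c = (c ∈ˢ? G⁻) ×-dec ((a Fin.≟ proj₁ (arcEnds n c)) ⊎-dec (a Fin.≟ proj₂ (arcEnds n c)))
    decide : Dec (∃ Touches) → ∃ IsNew
    decide (no none) = arrow a b , isolated-isNew (λ c c∈ → (λ eq → none (c , c∈ , inj₁ eq)) , (λ eq → none (c , c∈ , inj₂ eq)))
    decide (yes (c , c∈ , inj₁ a≡)) = _ , fan-isNew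
      (λ a≡k → Fin.<⇒≢ (arcEnds-< n c) (≡.trans (≡.sym a≡) a≡k))
      (λ b≡k → proj₁ (ab-nonAdjacent c c∈) (cong₂ _,_ (≡.sym a≡) (≡.sym b≡k)))
      (c , G⁻⊆G⁺ c∈ , inj₁ (cong (λ i → arrow i (proj₂ (arcEnds n c))) a≡))
    decide (yes (c , c∈ , inj₂ a≡)) = _ , fan-isNew
      (λ a≡k → Fin.<⇒≢ (arcEnds-< n c) (≡.trans (≡.sym a≡k) a≡))
      (λ b≡k → proj₂ (ab-nonAdjacent c c∈) (cong₂ _,_ (≡.sym b≡k) (≡.sym a≡)))
      (c , G⁻⊆G⁺ c∈ , inj₂ (cong (λ i → arrow i (proj₁ (arcEnds n c))) a≡))

  edges-increase : length (edges (T G⁻)) ℕ.+ 1 ℕ.≤ length (edges (T G⁺))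
  edges-increase = edges-grow (T G⁻) (T G⁺) (λ {x} → P⁻⊆P⁺ {x}) (proj₁ some-isNew ∷ []) ([] ∷ [])
    λ { (here refl) → proj₂ some-isNew }

δ≡1⇒≡ : ∀ {k} {i j : Fin k} → δ i j ≡ + 1 → i ≡ j
δ≡1⇒≡ {i = i} {j} eq with δ-cases i j
... | inj₁ (i≡j , _) = i≡j
... | inj₂ (_ , eq′) = contradiction (≡.trans (≡.sym eq) eq′) λ ()

-- Four blocks of nodes and the points gained between them

gridList : ∀ h → List (Fin h × Fin h)
gridList h = List.tabulate (Fin.remQuot {h} h)

gridList-unique : ∀ h → Unique (gridList h)
gridList-unique h = Unique.tabulate⁺ λ {i} {j} eq → ≡.trans (≡.sym (Fin.combine-remQuot {h} h i))
  (≡.trans (cong (uncurry Fin.combine) eq) (Fin.combine-remQuot {h} h j))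

length-gridList : ∀ h → length (gridList h) ≡ h ℕ.* h
length-gridList h = List.length-tabulate (Fin.remQuot {h} h)

module Blocks {n h} (4h≤n : 4 ℕ.* h ℕ.≤ n) where

  -- Four consecutive intervals of h nodes, holding a, b, j and l in turn. A node of an earlier
  -- block is smaller, so every arc used below is listed in a known direction.
  block : Fin 4 → Fin h → Fin n
  block c x = Fin.inject≤ (Fin.combine c x) 4h≤n

  block-< : ∀ {c d} x y → c Fin.< d → block c x Fin.< block d y
  block-< {c} {d} x y c<d = ≡.subst₂ ℕ._<_
    (≡.sym (Fin.toℕ-inject≤ (Fin.combine c x) 4h≤n)) (≡.sym (Fin.toℕ-inject≤ (Fin.combine d y) 4h≤n))
    (Fin.combine-monoˡ-< x y c<d)

  block-injective : ∀ {c x y} → block c x ≡ block c y → x ≡ y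
  block-injective {c} {x} {y} eq = Fin.combine-injectiveʳ c x c y
    (Fin.inject≤-injective 4h≤n 4h≤n (Fin.combine c x) (Fin.combine c y) eq)

  block-≢ : ∀ c x d y → c Fin.< d → block c x ≢ block d y
  block-≢ c x d y c<d = Fin.<⇒≢ (block-< x y c<d)

  arc₀₁ arc₀₃ arc₂₃ : Fin h → Fin h → Fin (length (allArcs n))
  arc₀₁ x y = proj₁ (arc (block-< {0F} {1F} x y (ℕ.s≤s ℕ.z≤n)))
  arc₀₃ x y = proj₁ (arc (block-< {0F} {3F} x y (ℕ.s≤s ℕ.z≤n)))
  arc₂₃ x y = proj₁ (arc (block-< {2F} {3F} x y (ℕ.s≤s (ℕ.s≤s (ℕ.s≤s ℕ.z≤n)))))

  ends₀₁ : ∀ x y → arcEnds n (arc₀₁ x y) ≡ (block 0F x , block 1F y)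
  ends₀₁ x y = proj₂ (arc (block-< {0F} {1F} x y (ℕ.s≤s ℕ.z≤n)))
  ends₀₃ : ∀ x y → arcEnds n (arc₀₃ x y) ≡ (block 0F x , block 3F y)
  ends₀₃ x y = proj₂ (arc (block-< {0F} {3F} x y (ℕ.s≤s ℕ.z≤n)))
  ends₂₃ : ∀ x y → arcEnds n (arc₂₃ x y) ≡ (block 2F x , block 3F y)
  ends₂₃ x y = proj₂ (arc (block-< {2F} {3F} x y (ℕ.s≤s (ℕ.s≤s (ℕ.s≤s ℕ.z≤n)))))

  arcs₀₁ : List (Fin (length (allArcs n)))
  arcs₀₁ = List.map (uncurry arc₀₁) (gridList h)

  arcs₀₁-unique : Unique arcs₀₁
  arcs₀₁-unique = Unique.map⁺ (λ {(x , y)} {(x′ , y′)} eq →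
    let eq′ = ≡.trans (≡.sym (ends₀₁ x y)) (≡.trans (cong (arcEnds n) eq) (ends₀₁ x′ y′))
    in cong₂ _,_ (block-injective {0F} (cong proj₁ eq′)) (block-injective {1F} (cong proj₂ eq′))) (gridList-unique h)

  length-arcs₀₁ : length arcs₀₁ ≡ h ℕ.* h
  length-arcs₀₁ = ≡.trans (List.length-map (uncurry arc₀₁) (gridList h)) (length-gridList h)

  -- The sufficient condition of `quad-isNew` for j and l in the last two blocks: {j , l} is present
  -- and {a , l} is absent. It reads two different bits, so it has probability q (1 - q).
  creates : Fin h → Graph n → Fin h × Fin h → Bool
  creates x G (u , v) = Vec.lookup G (arc₂₃ u v) ∧ not (Vec.lookup G (arc₀₃ x v))

  module _ (T : ∀ G → UnimodularTriangulation (symmetricEdgePolytope n G)) (x y : Fin h) (G : Graph n) where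
    open AddArc G (arc₀₁ x y) T

    quad : Fin h × Fin h → Vec ℤ n
    quad (u , v) = arrow a b ⊞ arrow (block 2F u) (block 3F v)

    a≡ : a ≡ block 0F x
    a≡ = cong proj₁ (ends₀₁ x y)
    b≡ : b ≡ block 1F y
    b≡ = cong proj₂ (ends₀₁ x y)

    -- After cancelling the arrow a b, the node j is recovered as the place of the coordinate 1 and
    -- l as the place of -1.
    quad-injective : ∀ {uv uv′} → quad uv ≡ quad uv′ → uv ≡ uv′
    quad-injective {u , v} {u′ , v′} eq = cong₂ _,_
      (≡.sym (block-injective {2F} (δ≡1⇒≡ (begin
        δ j′ j                ≡⟨ ℤ.+-identityʳ (δ j′ j) ⟨
        δ j′ j ℤ.- + 0        ≡⟨ cong (λ d → δ j′ j ℤ.- d) (δ-off-diagonal (block-≢ 2F u 3F v′ 2<3 ∘ ≡.sym)) ⟨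
        δ j′ j ℤ.- δ l′ j     ≡⟨ same j ⟨
        δ j j ℤ.- δ l j       ≡⟨ cong₂ ℤ._-_ (δ-diagonal j) (δ-off-diagonal (block-≢ 2F u 3F v 2<3 ∘ ≡.sym)) ⟩
        + 1                   ∎))))
      (≡.sym (block-injective {3F} (δ≡1⇒≡ (ℤ.neg-injective (begin
        ℤ.- δ l′ l            ≡⟨ ℤ.+-identityˡ (ℤ.- δ l′ l) ⟨
        + 0 ℤ.- δ l′ l        ≡⟨ cong (ℤ._- δ l′ l) (δ-off-diagonal (block-≢ 2F u′ 3F v 2<3)) ⟨
        δ j′ l ℤ.- δ l′ l     ≡⟨ same l ⟨
        δ j l ℤ.- δ l l       ≡⟨ cong₂ ℤ._-_ (δ-off-diagonal (block-≢ 2F u 3F v 2<3)) (δ-diagonal l) ⟩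
        ℤ.- + 1               ∎)))))
      where
      open ≡.≡-Reasoning
      2<3 : Fin._<_ {4} {4} 2F 3F
      2<3 = ℕ.s≤s (ℕ.s≤s (ℕ.s≤s ℕ.z≤n))
      j j′ l l′ : Fin n
      j = block 2F u
      j′ = block 2F u′
      l = block 3F v
      l′ = block 3F v′
      same : ∀ s → δ j s ℤ.- δ l s ≡ δ j′ s ℤ.- δ l′ s
      same s = +-cancelˡ (δ a s ℤ.- δ b s) (δ j s ℤ.- δ l s) (δ j′ s ℤ.- δ l′ s) (≡.trans (≡.sym (lookup-arrows a b j l s))
        (≡.trans (cong (λ z → Vec.lookup z s) eq) (lookup-arrows a b j′ l′ s)))

    creates⇒isNew : ∀ {uv} → creates x G uv ≡ true → IsNew (quad uv)
    creates⇒isNew {u , v} created = quad-isNew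
      (λ eq → block-≢ 0F x 2F u (ℕ.s≤s ℕ.z≤n) (≡.trans (≡.sym a≡) eq))
      (λ eq → block-≢ 0F x 3F v (ℕ.s≤s ℕ.z≤n) (≡.trans (≡.sym a≡) eq))
      (λ eq → block-≢ 1F y 2F u (ℕ.s≤s (ℕ.s≤s ℕ.z≤n)) (≡.trans (≡.sym b≡) eq))
      (λ eq → block-≢ 1F y 3F v (ℕ.s≤s (ℕ.s≤s ℕ.z≤n)) (≡.trans (≡.sym b≡) eq))
      (block-≢ 2F u 3F v (ℕ.s≤s (ℕ.s≤s (ℕ.s≤s ℕ.z≤n))))
      ( arc₂₃ u v
      , Vec.lookup⇒[]= (arc₂₃ u v) G⁺ (≡.trans (Vec.lookup∘update′ ₂₃≢e G inside) (∧-conicalˡ _ _ created))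
      , inj₁ (≡.sym (cong (uncurry arrow) (ends₂₃ u v))) )
      (nonAdjacent {c = arc₀₃ x v} (≡.trans (ends₀₃ x v) (cong (_, block 3F v) (≡.sym a≡)))
        (≡.trans (Vec.lookup∘update′ ₀₃≢e G outside) (not-injective (∧-conicalʳ _ _ created))))
      where
      -- The two bits read by `creates` differ from the bit being set, so their values in G persist
      -- in `G⁺` and `G⁻`.
      ₂₃≢e : arc₂₃ u v ≢ arc₀₁ x y
      ₂₃≢e eq = block-≢ 0F x 2F u (ℕ.s≤s ℕ.z≤n) (cong proj₁
        (≡.trans (≡.sym (ends₀₁ x y)) (≡.trans (cong (arcEnds n) (≡.sym eq)) (ends₂₃ u v))))
      ₀₃≢e : arc₀₃ x v ≢ arc₀₁ x y
      ₀₃≢e eq = block-≢ 1F y 3F v (ℕ.s≤s (ℕ.s≤s ℕ.z≤n)) (cong proj₂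
        (≡.trans (≡.sym (ends₀₁ x y)) (≡.trans (cong (arcEnds n) (≡.sym eq)) (ends₀₃ x v))))

    edges-increase-by-quads : length (edges (T G⁻)) ℕ.+ length (filterᵇ (creates x G) (gridList h))
                              ℕ.≤ length (edges (T G⁺))
    edges-increase-by-quads = subst (λ c → length (edges (T G⁻)) ℕ.+ c ℕ.≤ length (edges (T G⁺)))
      (List.length-map quad created)
      (edges-grow (T G⁻) (T G⁺) (λ {x} → P⁻⊆P⁺ {x}) (List.map quad created)
        (Unique.map⁺ quad-injective (Unique.filter⁺ (T? ∘ creates x G) (gridList-unique h)))
        λ z∈ → let uv , uv∈ , z≡ = ∈-map⁻ quad z∈ in
          subst IsNew (≡.sym z≡) (creates⇒isNew (Equivalence.to T-≡ (proj₂ (∈-filter⁻ (T? ∘ creates x G) {xs = gridList h} uv∈)))))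
      where
      created : List (Fin h × Fin h)
      created = filterᵇ (creates x G) (gridList h)

0≤fromℕℚ : ∀ k → 0ℚ ℚ.≤ fromℕℚ k
0≤fromℕℚ k = /1-mono-≤ {+ 0} {+ k} (ℤ.+≤+ ℕ.z≤n)

-- From gained edges to lower bounds for the variance over ℚ

module EdgeCountVariance {n} (T : ∀ G → UnimodularTriangulation (symmetricEdgePolytope n G)) where

  K : Graph n → ℚ
  K G = fromℕℚ (length (edges (T G)))

  gain≤Δ : ∀ e G {c} → length (edges (T (G Vec.[ e ]≔ outside))) ℕ.+ c ℕ.≤ length (edges (T (G Vec.[ e ]≔ inside))) →
           fromℕℚ c ℚ.≤ Δ e K G
  gain≤Δ e G {c} l⁻+c≤l⁺ = begin
    fromℕℚ c                          ≡⟨ solve 2 (λ l c → c := (l :+ c) :- l) refl (fromℕℚ l⁻) (fromℕℚ c) ⟩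
    (fromℕℚ l⁻ ℚ.+ fromℕℚ c) ℚ.- fromℕℚ l⁻
      ≡⟨ cong (ℚ._- fromℕℚ l⁻) (≡.sym (/1-+ (+ l⁻) (+ c))) ⟩
    fromℕℚ (l⁻ ℕ.+ c) ℚ.- fromℕℚ l⁻   ≤⟨ ℚ.+-monoˡ-≤ (ℚ.- fromℕℚ l⁻) (/1-mono-≤ (ℤ.+≤+ l⁻+c≤l⁺)) ⟩
    Δ e K G                           ∎
    where
    open ℚ.≤-Reasoning
    open +-*-Solver
    l⁻ : ℕ
    l⁻ = length (edges (T (G Vec.[ e ]≔ outside)))

  module _ {h} (4h≤n : 4 ℕ.* h ℕ.≤ n) {q} (0≤q : 0ℚ ℚ.≤ q) (q≤1 : q ℚ.≤ 1ℚ) where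
    open Blocks {h = h} 4h≤n

    H : ℚ
    H = fromℕℚ (h ℕ.* h)

    𝕍-from-influence : ∀ {L} → 0ℚ ℚ.≤ L → (∀ x y → L ℚ.≤ 𝔼ℚ q (Δ (arc₀₁ x y) K)) →
                       q ℚ.* (1ℚ ℚ.- q) ℚ.* (H ℚ.* (L ℚ.* L)) ℚ.≤ 𝕍ℚ q K
    𝕍-from-influence {L} 0≤L L≤ = subst (λ k → q ℚ.* (1ℚ ℚ.- q) ℚ.* (fromℕℚ k ℚ.* (L ℚ.* L)) ℚ.≤ 𝕍ℚ q K) length-arcs₀₁
      (influences-lower-bound 0≤q q≤1 K arcs₀₁-unique 0≤L λ {e} e∈ →
        let (x , y) , _ , e≡ = ∈-map⁻ (uncurry arc₀₁) e∈ in subst (λ e → L ℚ.≤ 𝔼ℚ q (Δ e K)) (≡.sym e≡) (L≤ x y))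

    𝕍-sparse : q ℚ.* (1ℚ ℚ.- q) ℚ.* (H ℚ.* (1ℚ ℚ.* 1ℚ)) ℚ.≤ 𝕍ℚ q K
    𝕍-sparse = 𝕍-from-influence (ℚ.nonNegative⁻¹ 1ℚ) λ x y → subst (ℚ._≤ 𝔼ℚ q (Δ (arc₀₁ x y) K))
      (𝔼ℚ-const {length (allArcs n)} q 1ℚ)
      (𝔼ℚ-mono 0≤q q≤1 λ G → gain≤Δ (arc₀₁ x y) G (AddArc.edges-increase G (arc₀₁ x y) T))

    -- Each of the h² pairs (j , l) yields a new point with probability q (1 - q), so L is the
    -- expected number of points created by one arc.
    𝕍-dense : let L = H ℚ.* (q ℚ.* (1ℚ ℚ.- q)) in q ℚ.* (1ℚ ℚ.- q) ℚ.* (H ℚ.* (L ℚ.* L)) ℚ.≤ 𝕍ℚ q K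
    𝕍-dense = 𝕍-from-influence (*-nonNeg (0≤fromℕℚ (h ℕ.* h)) (*-nonNeg 0≤q (0≤p-q q≤1))) λ x y →
      subst (ℚ._≤ 𝔼ℚ q (Δ (arc₀₁ x y) K))
        (≡.trans (𝔼ℚ-count q (q ℚ.* (1ℚ ℚ.- q)) (creates x) (gridList h) (λ {uv} _ → 𝔼ℚ-∈∧∉ q (₂₃≢₀₃ x uv)))
          (cong (λ k → fromℕℚ k ℚ.* (q ℚ.* (1ℚ ℚ.- q))) (length-gridList h)))
        (𝔼ℚ-mono 0≤q q≤1 λ G → gain≤Δ (arc₀₁ x y) G (edges-increase-by-quads T x y G))
      where
      ₂₃≢₀₃ : ∀ x (uv : Fin h × Fin h) → arc₂₃ (proj₁ uv) (proj₂ uv) ≢ arc₀₃ x (proj₂ uv)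
      ₂₃≢₀₃ x (u , v) eq = block-≢ 0F x 2F u (ℕ.s≤s ℕ.z≤n) (cong proj₁
        (≡.trans (≡.sym (ends₀₃ x v)) (≡.trans (cong (arcEnds n) (≡.sym eq)) (ends₂₃ u v))))

-- The variance of the number of edges

seq-𝔼 : ∀ {m} p (X : Subset m → ℝ) k → seq (𝔼 p X) k ≡ 𝔼ℚ (seq p k) (λ G → seq (X G) k)
seq-𝔼 {zero}  p X k = refl
seq-𝔼 {suc m} p X k = cong₂ (λ x y → seq p k ℚ.* x ℚ.+ (1ℚ ℚ.- seq p k) ℚ.* y)
  (seq-𝔼 p (λ G → X (inside ∷ G)) k) (seq-𝔼 p (λ G → X (outside ∷ G)) k)

seq-𝕍 : ∀ {m} p (X : Subset m → ℝ) k → seq (𝕍 p X) k ≡ 𝕍ℚ (seq p k) (λ G → seq (X G) k)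
seq-𝕍 p X k = ≡.trans (seq-𝔼 p (λ G → (X G - 𝔼 p X) ^ 2) k)
  (cong (λ c → 𝔼ℚ (seq p k) (λ G → (seq (X G) k ℚ.- c) ℚ.* ((seq (X G) k ℚ.- c) ℚ.* 1ℚ))) (seq-𝔼 p X k))

≤-eventually : ∀ {x y} → Eventually (λ k → seq x k ℚ.≤ seq y k) → x ≤ y
≤-eventually {x} {y} x≤y ε 0<ε = Eventually-map
  (λ k h → ℚ.≤-trans h (ℚ.≤-trans (ℚ.≤-reflexive (≡.sym (ℚ.+-identityʳ (seq y k))))
    (ℚ.+-monoʳ-≤ (seq y k) (ℚ.<⇒≤ 0<ε)))) x≤y

0<fromℚ : ∀ {q} → 0ℚ ℚ.< q → 0ℝ < fromℚ q
0<fromℚ {q} 0<q = q , 0<q , always λ _ → ℚ.≤-reflexive (ℚ.+-identityˡ q)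

0<x⇒0≤seq : ∀ {x} → 0ℝ < x → Eventually (λ k → 0ℚ ℚ.≤ seq x k)
0<x⇒0≤seq (ε , 0<ε , ε≤x) = Eventually-map
  (λ k h → ℚ.≤-trans (ℚ.<⇒≤ 0<ε) (ℚ.≤-trans (ℚ.≤-reflexive (≡.sym (ℚ.+-identityˡ ε))) h)) ε≤x

-- Of the distance ε between c and 1, one half absorbs the error with which the terms of `p n` obey
-- the bound c. The resulting δ is the same for all n; only the index from which it is valid depends
-- on n.
limsup<1⇒gap : ∀ {p} → limsup p < 1ℝ → ∃ λ δ → 0ℚ ℚ.< δ ×
  Eventually (λ n → Eventually (λ k → δ ℚ.≤ 1ℚ ℚ.- seq (p n) k))
limsup<1⇒gap {p} (c , (ε , 0<ε , c+ε≤1) , p≤c) = ½ ℚ.* ε , 0<½ 0<ε , Eventually-map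
  (λ n pₙ≤c → Eventually-zip (λ k c+ε≤1 pₙ≤c+½ε → 0≤p-q⁻¹ (subst (0ℚ ℚ.≤_)
      (solve 3 (λ c ε p → (con 1ℚ :- (c :+ ε)) :+ ((c :+ con ½ :* ε) :- p) := (con 1ℚ :- p) :- con ½ :* ε) refl
        (seq c k) ε (seq (p n) k))
      (+-nonNeg (0≤p-q c+ε≤1) (0≤p-q pₙ≤c+½ε))))
    c+ε≤1 (pₙ≤c (½ ℚ.* ε) (0<½ 0<ε)))
  p≤c
  where open +-*-Solver

-- The remainder is at most 3, and 3 ≤ 3 (n / 4) as soon as the quotient is positive; 4 + 3 = 7.
n≤7[n/4] : ∀ {n} → 4 ℕ.≤ n → n ℕ.≤ 7 ℕ.* (n ℕ./ 4)
n≤7[n/4] {n} 4≤n = begin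
  n                                       ≡⟨ ℕ.m≡m%n+[m/n]*n n 4 ⟩
  n ℕ.% 4 ℕ.+ n ℕ./ 4 ℕ.* 4               ≤⟨ ℕ.+-monoˡ-≤ (n ℕ./ 4 ℕ.* 4) (ℕ.≤-pred (ℕ.m%n<n n 4)) ⟩
  3 ℕ.+ n ℕ./ 4 ℕ.* 4                     ≤⟨ ℕ.+-monoˡ-≤ (n ℕ./ 4 ℕ.* 4) (ℕ.*-monoʳ-≤ 3 (ℕ.m≥n⇒m/n>0 4≤n)) ⟩
  3 ℕ.* (n ℕ./ 4) ℕ.+ n ℕ./ 4 ℕ.* 4       ≡⟨ 3h+h4≡7h (n ℕ./ 4) ⟩
  7 ℕ.* (n ℕ./ 4)                         ∎
  where
  open ℕ.≤-Reasoning
  3h+h4≡7h : ∀ h → 3 ℕ.* h ℕ.+ h ℕ.* 4 ≡ 7 ℕ.* h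
  3h+h4≡7h = ℕ-Solver.solve-∀

n²≤49[n/4]² : ∀ {n} → 4 ℕ.≤ n → n ℕ.^ 2 ℕ.≤ 49 ℕ.* (n ℕ./ 4 ℕ.* (n ℕ./ 4))
n²≤49[n/4]² {n} 4≤n = ℕ.≤-trans (ℕ.^-monoˡ-≤ 2 (n≤7[n/4] 4≤n)) (ℕ.≤-reflexive (square (n ℕ./ 4)))
  where
  square : ∀ h → 7 ℕ.* h ℕ.* (7 ℕ.* h ℕ.* 1) ≡ 49 ℕ.* (h ℕ.* h)
  square = ℕ-Solver.solve-∀

fromℕℚ-* : ∀ k l → fromℕℚ (k ℕ.* l) ≡ fromℕℚ k ℚ.* fromℕℚ l
fromℕℚ-* k l = ≡.trans (cong (λ z → z ℚ./ 1) (ℤ.pos-* k l)) (/1-* (+ k) (+ l))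

fromℕℚ-n⁶ : ∀ n → fromℕℚ (n ℕ.^ 6) ≡ fromℕℚ (n ℕ.^ 2) ℚ.* (fromℕℚ (n ℕ.^ 2) ℚ.* fromℕℚ (n ℕ.^ 2))
fromℕℚ-n⁶ n = ≡.trans (cong fromℕℚ (n⁶ n))
  (≡.trans (fromℕℚ-* (n ℕ.^ 2) (n ℕ.^ 2 ℕ.* n ℕ.^ 2)) (cong (fromℕℚ (n ℕ.^ 2) ℚ.*_) (fromℕℚ-* (n ℕ.^ 2) (n ℕ.^ 2))))
  where
  n⁶ : ∀ n → n ℕ.* (n ℕ.* (n ℕ.* (n ℕ.* (n ℕ.* (n ℕ.* 1))))) ≡ n ℕ.* (n ℕ.* 1) ℕ.* (n ℕ.* (n ℕ.* 1) ℕ.* (n ℕ.* (n ℕ.* 1)))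
  n⁶ = ℕ-Solver.solve-∀

cube-mono : ∀ {x y} → 0ℚ ℚ.≤ x → x ℚ.≤ y → x ℚ.* (x ℚ.* x) ℚ.≤ y ℚ.* (y ℚ.* y)
cube-mono 0≤x x≤y = *-mono-≤-nonNeg 0≤x (*-nonNeg 0≤y 0≤y) x≤y (*-mono-≤-nonNeg 0≤x 0≤y x≤y x≤y)
  where 0≤y = ℚ.≤-trans 0≤x x≤y

module _ {n} (4≤n : 4 ℕ.≤ n) (T : ∀ G → UnimodularTriangulation (symmetricEdgePolytope n G))
         {δ γ} (0≤γ : 0ℚ ℚ.≤ γ) (49γ≡δ : fromℕℚ 49 ℚ.* γ ≡ δ)
         {q} (0≤q : 0ℚ ℚ.≤ q) (0≤δ : 0ℚ ℚ.≤ δ) (δ≤1-q : δ ℚ.≤ 1ℚ ℚ.- q) where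
  open EdgeCountVariance T using (K; 𝕍-dense; 𝕍-sparse)
  open +-*-Solver

  h : ℕ
  h = n ℕ./ 4

  4h≤n : 4 ℕ.* h ℕ.≤ n
  4h≤n = ℕ.≤-trans (ℕ.≤-reflexive (ℕ.*-comm 4 h)) (ℕ.m/n*n≤m n 4)

  q≤1 : q ℚ.≤ 1ℚ
  q≤1 = 0≤p-q⁻¹ (ℚ.≤-trans 0≤δ δ≤1-q)

  X L : ℚ
  X = fromℕℚ (n ℕ.^ 2)
  L = fromℕℚ (h ℕ.* h) ℚ.* (q ℚ.* (1ℚ ℚ.- q))

  0≤γXq : 0ℚ ℚ.≤ γ ℚ.* (X ℚ.* q)
  0≤γXq = *-nonNeg 0≤γ (*-nonNeg (0≤fromℕℚ (n ℕ.^ 2)) 0≤q)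

  -- The origin of γ = δ / 49: from n² ≤ 49 h² and δ ≤ 1 - q follows γ n² q ≤ h² q (1 - q).
  γXq≤L : γ ℚ.* (X ℚ.* q) ℚ.≤ L
  γXq≤L = begin
    γ ℚ.* (X ℚ.* q)
      ≤⟨ ℚ.*-monoˡ-≤-nonNeg γ {{ℚ.nonNegative 0≤γ}} (ℚ.*-monoʳ-≤-nonNeg q {{ℚ.nonNegative 0≤q}}
           (/1-mono-≤ (ℤ.+≤+ (n²≤49[n/4]² 4≤n)))) ⟩
    γ ℚ.* (fromℕℚ (49 ℕ.* (h ℕ.* h)) ℚ.* q)
      ≡⟨ cong (λ x → γ ℚ.* (x ℚ.* q)) (fromℕℚ-* 49 (h ℕ.* h)) ⟩
    γ ℚ.* (fromℕℚ 49 ℚ.* H ℚ.* q)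
      ≡⟨ solve 4 (λ γ a H q → γ :* (a :* H :* q) := (a :* γ) :* (H :* q)) refl γ (fromℕℚ 49) H q ⟩
    (fromℕℚ 49 ℚ.* γ) ℚ.* (H ℚ.* q)
      ≡⟨ cong (ℚ._* (H ℚ.* q)) 49γ≡δ ⟩
    δ ℚ.* (H ℚ.* q)
      ≤⟨ ℚ.*-monoʳ-≤-nonNeg (H ℚ.* q) {{ℚ.nonNegative (*-nonNeg (0≤fromℕℚ (h ℕ.* h)) 0≤q)}} δ≤1-q ⟩
    (1ℚ ℚ.- q) ℚ.* (H ℚ.* q)
      ≡⟨ solve 2 (λ H q → (con 1ℚ :- q) :* (H :* q) := H :* (q :* (con 1ℚ :- q))) refl H q ⟩
    L ∎
    where
    open ℚ.≤-Reasoning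
    H : ℚ
    H = fromℕℚ (h ℕ.* h)

  -- The bound `𝕍-dense` is L³ up to order of factors, and n⁶ q³ is the cube of n² q, so γ³ is the
  -- constant.
  dense-bound : γ ℚ.* (γ ℚ.* γ) ℚ.* ℚ.∣ fromℕℚ (n ℕ.^ 6) ℚ.* (q ℚ.* (q ℚ.* (q ℚ.* 1ℚ))) ∣ ℚ.≤ 𝕍ℚ q K
  dense-bound = begin
    γ ℚ.* (γ ℚ.* γ) ℚ.* ℚ.∣ fromℕℚ (n ℕ.^ 6) ℚ.* (q ℚ.* (q ℚ.* (q ℚ.* 1ℚ))) ∣
      ≡⟨ cong (γ ℚ.* (γ ℚ.* γ) ℚ.*_) (ℚ.0≤p⇒∣p∣≡p (*-nonNeg (0≤fromℕℚ (n ℕ.^ 6))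
           (*-nonNeg 0≤q (*-nonNeg 0≤q (*-nonNeg 0≤q (ℚ.nonNegative⁻¹ 1ℚ)))))) ⟩
    γ ℚ.* (γ ℚ.* γ) ℚ.* (fromℕℚ (n ℕ.^ 6) ℚ.* (q ℚ.* (q ℚ.* (q ℚ.* 1ℚ))))
      ≡⟨ cong (λ x → γ ℚ.* (γ ℚ.* γ) ℚ.* (x ℚ.* (q ℚ.* (q ℚ.* (q ℚ.* 1ℚ))))) (fromℕℚ-n⁶ n) ⟩
    γ ℚ.* (γ ℚ.* γ) ℚ.* (X ℚ.* (X ℚ.* X) ℚ.* (q ℚ.* (q ℚ.* (q ℚ.* 1ℚ))))
      ≡⟨ solve 3 (λ γ X q → γ :* (γ :* γ) :* (X :* (X :* X) :* (q :* (q :* (q :* con 1ℚ))))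
           := γ :* (X :* q) :* (γ :* (X :* q) :* (γ :* (X :* q)))) refl γ X q ⟩
    γ ℚ.* (X ℚ.* q) ℚ.* (γ ℚ.* (X ℚ.* q) ℚ.* (γ ℚ.* (X ℚ.* q)))
      ≤⟨ cube-mono 0≤γXq γXq≤L ⟩
    L ℚ.* (L ℚ.* L)
      ≡⟨ solve 3 (λ H s l → (H :* s) :* (l :* l) := s :* (H :* (l :* l))) refl (fromℕℚ (h ℕ.* h)) (q ℚ.* (1ℚ ℚ.- q)) L ⟩
    q ℚ.* (1ℚ ℚ.- q) ℚ.* (fromℕℚ (h ℕ.* h) ℚ.* (L ℚ.* L))
      ≤⟨ 𝕍-dense {h} 4h≤n 0≤q q≤1 ⟩
    𝕍ℚ q K ∎
    where open ℚ.≤-Reasoning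

  -- With the gain 1 per arc, the bound `𝕍-sparse` is L itself, so γ is the constant.
  sparse-bound : γ ℚ.* ℚ.∣ fromℕℚ (n ℕ.^ 2) ℚ.* q ∣ ℚ.≤ 𝕍ℚ q K
  sparse-bound = begin
    γ ℚ.* ℚ.∣ X ℚ.* q ∣
      ≡⟨ cong (γ ℚ.*_) (ℚ.0≤p⇒∣p∣≡p (*-nonNeg (0≤fromℕℚ (n ℕ.^ 2)) 0≤q)) ⟩
    γ ℚ.* (X ℚ.* q)
      ≤⟨ γXq≤L ⟩
    L
      ≡⟨ solve 2 (λ H s → H :* s := s :* (H :* (con 1ℚ :* con 1ℚ))) refl (fromℕℚ (h ℕ.* h)) (q ℚ.* (1ℚ ℚ.- q)) ⟩
    q ℚ.* (1ℚ ℚ.- q) ℚ.* (fromℕℚ (h ℕ.* h) ℚ.* (1ℚ ℚ.* 1ℚ))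
      ≤⟨ 𝕍-sparse {h} 4h≤n 0≤q q≤1 ⟩
    𝕍ℚ q K ∎
    where open ℚ.≤-Reasoning

-- One operation at a time: conversion checking unfolds a nested product of
-- rationals to a term of exponential size.
seq-^-suc : ∀ x m k → seq (x ^ suc m) k ≡ seq x k ℚ.* seq (x ^ m) k
seq-^-suc x m k = refl

seq-∣*∣ : ∀ x y k → seq ∣ x * y ∣ k ≡ ℚ.∣ seq x k ℚ.* seq y k ∣
seq-∣*∣ x y k = refl

seq-fromℚ* : ∀ c x k → seq (fromℚ c * x) k ≡ c ℚ.* seq x k
seq-fromℚ* c x k = refl

seq-c∣ax∣ : ∀ c a x k → seq (fromℚ c * ∣ a * x ∣) k ≡ c ℚ.* ℚ.∣ seq a k ℚ.* seq x k ∣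
seq-c∣ax∣ c a x k = ≡.trans (seq-fromℚ* c ∣ a * x ∣ k) (cong (c ℚ.*_) (seq-∣*∣ a x k))

seq-c∣ax³∣ : ∀ c a x k → seq (fromℚ c * ∣ a * x ^ 3 ∣) k ≡
  c ℚ.* ℚ.∣ seq a k ℚ.* (seq x k ℚ.* (seq x k ℚ.* (seq x k ℚ.* 1ℚ))) ∣
seq-c∣ax³∣ c a x k = ≡.trans (seq-c∣ax∣ c a (x ^ 3) k)
  (cong (λ y → c ℚ.* ℚ.∣ seq a k ℚ.* y ∣) (≡.trans (seq-^-suc x 2 k)
    (cong (seq x k ℚ.*_) (≡.trans (seq-^-suc x 1 k) (cong (seq x k ℚ.*_) (seq-^-suc x 0 k))))))

theorem4p2 :
  (p : ℕ → ℝ) → (∀ n → 0ℝ < p n × p n < 1ℝ) → limsup p < 1ℝ →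
  (T : ∀ n (G : Graph n) → UnimodularTriangulation (symmetricEdgePolytope n G)) →
  let K : ∀ n → Graph n → ℝ
      K n G = fromℕ (length (edges (T n G)))
  in (p ≫ n⁻² → (λ n → 𝕍 (p n) (K n)) ≳ (λ n → fromℕ (n ℕ.^ 6) * p n ^ 3))
   × (p ≲ n⁻² → (λ n → 𝕍 (p n) (K n)) ≳ (λ n → fromℕ (n ℕ.^ 2) * p n))
theorem4p2 p 0<p<1 limsup<1 T = (λ _ → dense) , (λ _ → sparse)
  where
  K : ∀ n → Graph n → ℝ
  K n G = fromℕ (length (edges (T n G)))
  gap = limsup<1⇒gap {p} limsup<1
  δ₀ = proj₁ gap
  0<δ₀ = proj₁ (proj₂ gap)
  γ-data = ∃-divisor {δ₀} {fromℕℚ 49} 0<δ₀ (ℚ.positive⁻¹ (fromℕℚ 49))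
  γ = proj₁ γ-data
  0<γ = proj₁ (proj₂ γ-data)
  49γ≡δ₀ = proj₂ (proj₂ γ-data)

  -- For fixed n, all late terms of `p n` satisfy both conditions, so a rational bound under these
  -- conditions gives the real inequality. The absolute value is the one in `_≳_`.
  eventually-≤∣𝕍∣ : ∀ {n x} → Eventually (λ k → 0ℚ ℚ.≤ seq (p n) k) → Eventually (λ k → δ₀ ℚ.≤ 1ℚ ℚ.- seq (p n) k) →
    (∀ k → 0ℚ ℚ.≤ seq (p n) k → δ₀ ℚ.≤ 1ℚ ℚ.- seq (p n) k →
      seq x k ℚ.≤ 𝕍ℚ (seq (p n) k) (λ G → seq (K n G) k)) →
    x ≤ ∣ 𝕍 (p n) (K n) ∣
  eventually-≤∣𝕍∣ {n} {x} 0≤p δ₀≤1-p bound = ≤-eventually {x} {∣ 𝕍 (p n) (K n) ∣} (Eventually-zip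
    (λ k 0≤pₖ δ₀≤1-pₖ → ℚ.≤-trans (bound k 0≤pₖ δ₀≤1-pₖ)
      (ℚ.≤-trans (ℚ.≤-reflexive (≡.sym (seq-𝕍 (p n) (K n) k))) (p≤∣p∣ _)))
    0≤p δ₀≤1-p)

  dense : (λ n → 𝕍 (p n) (K n)) ≳ (λ n → fromℕ (n ℕ.^ 6) * p n ^ 3)
  dense = fromℚ (γ ℚ.* (γ ℚ.* γ)) , 0<fromℚ (*-pos 0<γ (*-pos 0<γ 0<γ)) , Eventually-zip
    (λ n 4≤n δ₀≤1-p → eventually-≤∣𝕍∣ {n} {fromℚ (γ ℚ.* (γ ℚ.* γ)) * ∣ fromℕ (n ℕ.^ 6) * p n ^ 3 ∣}
      (0<x⇒0≤seq {p n} (proj₁ (0<p<1 n))) δ₀≤1-p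
      (λ k 0≤pₖ δ₀≤1-pₖ → subst (ℚ._≤ 𝕍ℚ (seq (p n) k) (λ G → seq (K n G) k))
        (≡.sym (seq-c∣ax³∣ (γ ℚ.* (γ ℚ.* γ)) (fromℕ (n ℕ.^ 6)) (p n) k))
        (dense-bound 4≤n (T n) (ℚ.<⇒≤ 0<γ) 49γ≡δ₀ 0≤pₖ (ℚ.<⇒≤ 0<δ₀) δ₀≤1-pₖ)))
    -- From four nodes on, the blocks are nonempty.
    (4 , λ n 4≤n → 4≤n) (proj₂ (proj₂ gap))

  sparse : (λ n → 𝕍 (p n) (K n)) ≳ (λ n → fromℕ (n ℕ.^ 2) * p n)
  sparse = fromℚ γ , 0<fromℚ 0<γ , Eventually-zip
    (λ n 4≤n δ₀≤1-p → eventually-≤∣𝕍∣ {n} {fromℚ γ * ∣ fromℕ (n ℕ.^ 2) * p n ∣}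
      (0<x⇒0≤seq {p n} (proj₁ (0<p<1 n))) δ₀≤1-p
      (λ k 0≤pₖ δ₀≤1-pₖ → subst (ℚ._≤ 𝕍ℚ (seq (p n) k) (λ G → seq (K n G) k))
        (≡.sym (seq-c∣ax∣ γ (fromℕ (n ℕ.^ 2)) (p n) k))
        (sparse-bound 4≤n (T n) (ℚ.<⇒≤ 0<γ) 49γ≡δ₀ 0≤pₖ (ℚ.<⇒≤ 0<δ₀) δ₀≤1-pₖ)))
    (4 , λ n 4≤n → 4≤n) (proj₂ (proj₂ gap))
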